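{- There is a number $N$ such that every connected strongly regular graph $G$ on $v > N$ vertices contains a Hamiltonian cycle.
   Context: A graph is strongly regular with parameters $(v,k,\lambda,\mu)$ if it is a $k$-regular graph on $v$ vertices such that each edge lies in exactly $\lambda$ triangles and any two non-adjacent vertices have exactly $\mu$ common neighbours. Complete graphs and empty (edgeless) graphs are excluded from being strongly regular. -}

module Defs where

open import Data.Nat using (ℕ; zero; suc; _+_; _≤_; _>_)
open import Data.Fin using (Fin; zero; suc; toℕ)
open import Data.Bool using (Bool; true; false; _∧_)
open import Data.List using (List; []; _∷_; filter; length; allFin)
open import Data.Product using (Σ; ∃; _×_; _,_)
open import Relation.Binary.PropositionalEquality using (_≡_; _≢_)
open import Relation.Nullary using (¬_)
open import Data.Bool.Properties using (T?)
open import Data.Bool using (T)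
open import Function.Definitions using (Injective)

record Graph (v : ℕ) : Set where
  field
    adj       : Fin v → Fin v → Bool
    irrefl    : ∀ x → adj x x ≡ false
    symmetric : ∀ x y → adj x y ≡ adj y x
open Graph public

count : {v : ℕ} → (Fin v → Bool) → ℕ
count {v} p = length (filter (λ z → T? (p z)) (allFin v))

degree : {v : ℕ} → Graph v → Fin v → ℕ
degree G x = count (λ z → adj G x z)

commonNeighbours : {v : ℕ} → Graph v → Fin v → Fin v → ℕ
commonNeighbours G x y = count (λ z → adj G x z ∧ adj G y z)

record IsStronglyRegular {v : ℕ} (G : Graph v) (k l m : ℕ) : Set where
  field
    regular     : ∀ x → degree G x ≡ k
    adjacentλ   : ∀ x y → adj G x y ≡ true → commonNeighbours G x y ≡ l
    nonadjμ     : ∀ x y → x ≢ y → adj G x y ≡ false → commonNeighbours G x y ≡ m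
    notEmpty    : Σ (Fin v) λ x → Σ (Fin v) λ y → adj G x y ≡ true
    notComplete : Σ (Fin v) λ x → Σ (Fin v) λ y → (x ≢ y) × (adj G x y ≡ false)

StronglyRegular : {v : ℕ} → Graph v → Set
StronglyRegular G = Σ ℕ λ k → Σ ℕ λ l → Σ ℕ λ m → IsStronglyRegular G k l m

data Walk {v : ℕ} (G : Graph v) : Fin v → Fin v → Set where
  [] : ∀ {x} → Walk G x x
  _∷_ : ∀ {x y z} → adj G x y ≡ true → Walk G y z → Walk G x z

Connected : {v : ℕ} → Graph v → Set
Connected {v} G = ∀ (x y : Fin v) → Walk G x y

nextIdx : {n : ℕ} → Fin n → Fin n
nextIdx {suc n} i with Data.Fin.toℕ i Data.Nat.<? n
... | Relation.Nullary.yes i<n = Data.Fin.fromℕ< (Data.Nat.s≤s i<n)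
... | Relation.Nullary.no _ = zero

-- A Hamiltonian cycle: a cyclic ordering c(0),…,c(v-1) of all vertices
-- (c a bijection Fin v → Fin v, injectivity suffices on a finite set),
-- with c(i) adjacent to c(i+1 mod v), and v ≥ 3.
HamiltonianCycle : {v : ℕ} → Graph v → Set
HamiltonianCycle {v} G =
  (3 ≤ v) × Σ (Fin v → Fin v) λ c →
    Injective _≡_ _≡_ c × (∀ i → adj G (c i) (c (nextIdx i)) ≡ true)

{-# OPTIONS --safe #-}
-- Let k, r, −s be the eigenvalues of G (integers, as eigenprojections have integral traces, except for the
-- conference parameters), so that k = μ + rs.
--
-- If s ≤ μ the argument of Chvátal and Erdős applies: a component H left over by a longest cycle C has a set S of
-- neighbours on C whose successors, together with a vertex of H, are independent, so |S| < α ≤ vs/(k + s) ≤ k − r.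
-- But all degrees inside H and inside the rest of G − S are at least k − |S| > r, although Rayleigh quotients
-- of vectors orthogonal to 1 never exceed r. Conference graphs yield to the same comparison.
--
-- If s > μ, the Krein condition gives s ≤ 8r² and counting the neighbours of an induced claw gives r ≤ 7s³.
-- Hence k/max(r, s) ≥ R := min(r, s) with v ≤ 512 R⁸, so G is polynomially pseudorandom. In a longest path a bounded
-- number of Pósa rotations at each end produces more than v/1000 endpoints. The path is cut into 20 arcs,
-- each carrying a "zone" that expands into its own interior; all but few vertices have a neighbour inside all zones.
-- After nine rotations at either end two arcs survive and both ends see all zones; rotating further, separately in one
-- arc for each end, gives two sets of endpoints so large that an edge joins them and closes the path to a cycle.
module Submission where

open import Defs
open import Data.Nat using (ℕ; _>_)

-- No real numbers occur. Since A² = τA + κI + μJ, the quantity ‖(A + c)u‖² is a combination of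
-- uᵀAu, ‖u‖² and (Σu)², and its nonnegativity for suitable integers c replaces diagonalisation. The
-- border s = μ is forced by the method: the ratio bound is |I| ≤ (k - r)s/μ, which is at most k - r
-- exactly when s ≤ μ. Beyond it, k and v are bounded by powers of R = min(r, s), so a fixed number
-- of rotation rounds suffices and all constants may be crude: nine rounds because v ≤ R⁹, and 20 =
-- 9 + 9 + 2 arcs. The obstacle is that rotations break the very arcs whose zones are used later;
-- hence the spare arcs, and a separate one for each end, so that the last two families of rotations
-- cannot interfere. Reachable sets, sets of endpoints and longest cycles are never computed. They
-- are obtained inside proofs of ⊥, where any predicate on vertices may be treated as a Boolean set,
-- and "longest" becomes an induction on the room left for growth. The cycle is recovered at the end
-- because its existence is decidable.

module TraceOfIdempotent where

  open import Algebra.Bundles using (CommutativeRing)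
  open import Level using (0ℓ)
  open import Data.Nat using (zero; suc)
  open import Data.Fin using (Fin)
  import Data.Fin.Properties as FinP
  open import Data.List using (List; []; _∷_; allFin)
  open import Data.List.Membership.Propositional using (_∉_)
  open import Data.List.Membership.Propositional.Properties using (∈-allFin)
  open import Data.List.Relation.Unary.Any using (here; there)
  open import Data.Product using (∃; _,_)
  open import Data.Empty using (⊥-elim)
  open import Relation.Nullary using (¬_; Dec; yes; no)
  import Relation.Binary.PropositionalEquality as ≡

  -- Traces of scaled projections over an integral domain.

  module _ (K : CommutativeRing 0ℓ 0ℓ) where

    open CommutativeRing K
    open import Algebra.Properties.Semiring.Sum semiring
      using (sum; sum-cong-≋; ∑-distrib-+; *-distribˡ-sum; sum-replicate-zero)
    open import Algebra.Properties.Ring ring using (-‿distribˡ-*; -‿distribʳ-*)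
    open import Algebra.Solver.Ring.NaturalCoefficients.Default commutativeSemiring
    open import Algebra.Properties.Semiring.Mult semiring using (_×_)
    open import Relation.Binary.Reasoning.Setoid setoid

    ×-*-comm : ∀ t a c → t × (a * c) ≈ a * (t × c)
    ×-*-comm zero a c = sym (zeroʳ a)
    ×-*-comm (suc t) a c = trans (+-congˡ (×-*-comm t a c)) (sym (distribˡ a c (t × c)))

    sum-linear₄ : ∀ {n} a b c d (f g h i : Fin n → Carrier) →
      sum (λ z → a * f z + b * g z + c * h z + d * i z) ≈ a * sum f + b * sum g + c * sum h + d * sum i
    sum-linear₄ {n} a b c d f g h i = trans (∑-distrib-+ {n} _ _) (+-cong
      (trans (∑-distrib-+ {n} _ _) (+-cong (trans (∑-distrib-+ {n} _ _) (+-cong (sym (*-distribˡ-sum a f))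
        (sym (*-distribˡ-sum b g))))
        (sym (*-distribˡ-sum c h)))) (sym (*-distribˡ-sum d i)))

    module _ (zero? : ∀ x → Dec (x ≈ 0#)) (cancel : ∀ {a d} → ¬ a ≈ 0# → a * d ≈ 0# → d ≈ 0#) where

      private
        -- Subtracting the rank-one matrix u wᵀ through a pivot entry a = M i j keeps M² = cM, with c
        -- replaced by ac; the trace drops by exactly c (after rescaling by a) and column j becomes zero.
        peel : ∀ {n} (js : List (Fin n)) (M : Fin n → Fin n → Carrier) c → ¬ c ≈ 0# →
               (∀ x y → sum (λ z → M x z * M z y) ≈ c * M x y) → (∀ x y → y ∉ js → M x y ≈ 0#) →
               ∃ λ t → sum (λ x → M x x) ≈ t × c
        peel {n} [] M c c≢0 idem out = 0 , trans (sum-cong-≋ (λ x → out x x λ ())) (sum-replicate-zero n)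
        peel {n} (j ∷ js) M c c≢0 idem out with FinP.all? (λ x → zero? (M x j))
        ... | yes all = peel js M c c≢0 idem λ x y y∉ → f x y y∉ (y FinP.≟ j)
          where
          f : ∀ x y → y ∉ js → Dec (y ≡.≡ j) → M x y ≈ 0#
          f x y y∉ (yes ≡.refl) = all x
          f x y y∉ (no y≢j) = out x y λ { (here e) → y≢j e ; (there y∈) → y∉ y∈ }
        ... | no ¬all with FinP.¬∀⟶∃¬ n _ (λ x → zero? (M x j)) ¬all
        ... | i , pivot = let t , e = peel js M′ (a * c) (λ ac → c≢0 (cancel pivot ac)) idem′ out′ in suc t , tr t e
          where
          a : Carrier
          a = M i j
          u w : Fin n → Carrier
          u x = - M x j
          w y = M i y
          M′ : Fin n → Fin n → Carrier
          M′ x y = a * M x y + u x * w y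
          -- `u` is minus column j of `M`, so M² = cM makes it an eigenvector for c. Read in row i,
          -- the same equation gives the scalar product of `w` and `u`.
          Mu : ∀ x → sum (λ z → M x z * u z) ≈ c * u x
          Mu x = begin
            sum (λ z → M x z * u z)               ≈⟨ sum-cong-≋ (λ z → trans (sym (-‿distribʳ-* (M x z) (M z j)))
              (minus (M x z * M z j))) ⟩
            sum (λ z → - 1# * (M x z * M z j))    ≈⟨ *-distribˡ-sum (- 1#) (λ z → M x z * M z j) ⟨
            - 1# * sum (λ z → M x z * M z j)      ≈⟨ *-congˡ (idem x j) ⟩
            - 1# * (c * M x j)                    ≈⟨ minus (c * M x j) ⟨
            - (c * M x j)                         ≈⟨ -‿distribʳ-* c (M x j) ⟩
            c * u x                               ∎
            where
            minus : ∀ y → - y ≈ - 1# * y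
            minus y = trans (-‿cong (sym (*-identityˡ y))) (-‿distribˡ-* 1# y)
          wu : sum (λ z → w z * u z) ≈ c * - a
          wu = Mu i
          expand : ∀ a m m′ u w u′ w′ → (a * m + u * w) * (a * m′ + u′ * w′) ≈
                   (a * a) * (m * m′) + (a * w′) * (m * u′) + (a * u) * (w * m′) + (u * w′) * (w * u′)
          expand = solve 7 (λ a m m′ u w u′ w′ → (a :* m :+ u :* w) :* (a :* m′ :+ u′ :* w′) :=
                   (a :* a) :* (m :* m′) :+ (a :* w′) :* (m :* u′) :+ (a :* u) :* (w :* m′) :+ (u :* w′) :* (w :* u′))
                     refl
          collect : ∀ a n m u w c → (a * a) * (c * m) + (a * w) * (c * u) + (a * u) * (c * w) + (u * w) * (c * n) ≈
                    (a * c) * (a * m + u * w) + ((a + n) * (c * u * w))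
          collect = solve 6 (λ a n m u w c → (a :* a) :* (c :* m) :+ (a :* w) :* (c :* u) :+ (a :* u) :* (c :* w) :+
            (u :* w) :* (c :* n) :=
                    (a :* c) :* (a :* m :+ u :* w) :+ ((a :+ n) :* (c :* u :* w))) refl
          idem′ : ∀ x y → sum (λ z → M′ x z * M′ z y) ≈ (a * c) * M′ x y
          idem′ x y = begin
            sum (λ z → M′ x z * M′ z y)
              ≈⟨ sum-cong-≋ (λ z → expand a (M x z) (M z y) (u x) (w z) (u z) (w y)) ⟩
            _ ≈⟨ sum-linear₄ {n} (a * a) (a * w y) (a * u x) (u x * w y) _ _ _ _ ⟩
            _ ≈⟨ +-cong (+-cong (+-cong (*-congˡ (idem x y)) (*-congˡ (Mu x))) (*-congˡ (idem i y))) (*-congˡ wu) ⟩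
            _ ≈⟨ collect a (- a) (M x y) (u x) (w y) c ⟩
            (a * c) * M′ x y + (a + - a) * (c * u x * w y)
              ≈⟨ +-congˡ (trans (*-congʳ (-‿inverseʳ a)) (zeroˡ _)) ⟩
            (a * c) * M′ x y + 0# ≈⟨ +-identityʳ _ ⟩
            (a * c) * M′ x y ∎
          out′ : ∀ x y → y ∉ js → M′ x y ≈ 0#
          out′ x y y∉ with y FinP.≟ j
          ... | yes ≡.refl = trans (+-cong (*-comm a (M x j)) (sym (-‿distribˡ-* (M x j) a))) (-‿inverseʳ (M x j * a))
          ... | no y≢j = trans (+-cong (trans (*-congˡ (out x y y∉′)) (zeroʳ a)) (trans (*-congˡ (out i y y∉′))
            (zeroʳ (u x)))) (+-identityˡ 0#)
            where
            y∉′ : y ∉ j ∷ js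
            y∉′ (here e) = y≢j e
            y∉′ (there y∈) = y∉ y∈
          tr-M′ : sum (λ x → M′ x x) ≈ a * sum (λ x → M x x) + c * - a
          tr-M′ = trans (∑-distrib-+ {n} _ _) (+-cong (sym (*-distribˡ-sum a (λ x → M x x)))
            (trans (sum-cong-≋ (λ x → *-comm (u x) (w x))) wu))
          regroup : ∀ a t n s c → a * t + n * (c + s) ≈ (a * t + c * n) + n * s
          regroup = solve 5 (λ a t n s c → a :* t :+ n :* (c :+ s) := (a :* t :+ c :* n) :+ n :* s) refl
          tr : ∀ t → sum (λ x → M′ x x) ≈ t × (a * c) → sum (λ x → M x x) ≈ suc t × c
          tr t e = begin
            T                              ≈⟨ +-identityʳ T ⟨
            T + 0#                         ≈⟨ +-congˡ (-‿inverseˡ (suc t × c)) ⟨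
            T + (- (suc t × c) + suc t × c) ≈⟨ +-assoc _ _ _ ⟨
            (T + - (suc t × c)) + suc t × c ≈⟨ +-congʳ (cancel pivot vanish) ⟩
            0# + suc t × c                 ≈⟨ +-identityˡ _ ⟩
            suc t × c                      ∎
            where
            T : Carrier
            T = sum (λ x → M x x)
            -- The recursion controls the trace of `M′`, which is a·T - ac. The statement about T is
            -- therefore shown after multiplication by the pivot a, which is then cancelled.
            vanish : a * (T + - (suc t × c)) ≈ 0#
            vanish = begin
              a * (T + - (c + t × c))               ≈⟨ distribˡ a T _ ⟩
              a * T + a * - (c + t × c)             ≈⟨ +-congˡ (trans (sym (-‿distribʳ-* a _)) (-‿distribˡ-* a _)) ⟩
              a * T + - a * (c + t × c)             ≈⟨ regroup a T (- a) (t × c) c ⟩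
              (a * T + c * - a) + - a * (t × c)     ≈⟨ +-cong (trans (sym tr-M′) (trans e (×-*-comm t a c)))
                (sym (-‿distribˡ-* a (t × c))) ⟩
              a * (t × c) + - (a * (t × c))         ≈⟨ -‿inverseʳ _ ⟩
              0#                                    ∎

      -- Over the field of fractions M/c is a projection, and t is its rank. Keeping the factor c
      -- avoids fractions altogether.
      trace-of-scaled-idempotent : ∀ {n} (M : Fin n → Fin n → Carrier) c → ¬ c ≈ 0# →
        (∀ x y → sum (λ z → M x z * M z y) ≈ c * M x y) → ∃ λ t → sum (λ x → M x x) ≈ t × c
      trace-of-scaled-idempotent {n} M c c≢0 idem = peel (allFin n) M c c≢0 idem (λ x y y∉ → ⊥-elim (y∉ (∈-allFin y)))

open import Data.Fin using (Fin; zero; suc; toℕ)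
import Data.Fin.Properties as FinP
open import Data.Bool using (Bool; true; false; _∧_; _∨_; not; if_then_else_)
open import Data.Bool.Properties using (T?; T-≡)
open import Data.List using (List; []; _∷_; _++_; length; filter; allFin; concatMap; reverse)
open import Data.List.Properties using (length-++; length-tabulate; ∷-injective; unfold-reverse; ++-assoc;
  ++-identityʳ; reverse-++; reverse-involutive; take++drop≡id; length-take; length-drop)
open import Data.List.Membership.Propositional using (_∈_; _∉_)
open import Data.List.Relation.Unary.Any using (here; there)
open import Data.List.Relation.Unary.All using ([]; _∷_)
open import Data.List.Relation.Unary.AllPairs using ([]; _∷_)
open import Data.List.Relation.Unary.Unique.Propositional using (Unique)
open import Data.List.Relation.Binary.Permutation.Propositional using (_↭_; ↭⇒↭ₛ; ↭-refl; ↭-sym; ↭-trans; ↭-reflexive)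
open import Data.List.Relation.Binary.Permutation.Propositional.Properties using (++⁺; ++-comm; ↭-reverse; ++⁺ˡ; ++⁺ʳ;
  ∈-resp-↭; ↭-length)
open import Data.Product using (∃; _×_; _,_; proj₂; Σ; ∃₂; proj₁)
open import Data.Sum using (_⊎_; inj₁; inj₂)
open import Data.Empty using (⊥; ⊥-elim)
open import Function using (_∘_; Equivalence; id)
open import Relation.Nullary using (Dec; yes; does; no; ¬_)
open import Relation.Binary.PropositionalEquality hiding ([_])

-- Boolean subsets of a finite set and their cardinalities.

module FiniteSets where

  open import Defs using (count)
  open import Data.Nat using (ℕ; zero; suc; _+_; _*_; _≤_; _<_; z≤n; s≤s)
  open import Data.Nat.Properties
  open import Data.Bool using (T)
  open import Data.List.Membership.Propositional.Properties
  open import Data.List.Relation.Unary.All as All using (All; []; _∷_)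
  import Data.List.Relation.Unary.Unique.Propositional.Properties as UniqueP
  open import Relation.Nullary.Decidable using (dec-true; ¬¬-excluded-middle)

  private
    variable
      v : ℕ

  Subset : ℕ → Set
  Subset v = Fin v → Bool

  infixr 6 _∩_
  infixr 5 _∪_

  _∩_ _∪_ : Subset v → Subset v → Subset v
  (S ∩ T) x = S x ∧ T x
  (S ∪ T) x = S x ∨ T x

  ∁ : Subset v → Subset v
  ∁ S x = not (S x)

  ∧-true : ∀ {a b} → a ≡ true → b ≡ true → a ∧ b ≡ true
  ∧-true refl refl = refl

  ∧-trueˡ : ∀ a {b} → a ∧ b ≡ true → a ≡ true
  ∧-trueˡ true _ = refl

  ∧-trueʳ : ∀ a {b} → a ∧ b ≡ true → b ≡ true
  ∧-trueʳ true e = e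

  ∨-trueˡ : ∀ {a} b → a ≡ true → a ∨ b ≡ true
  ∨-trueˡ b refl = refl

  ∨-trueʳ : ∀ a {b} → b ≡ true → a ∨ b ≡ true
  ∨-trueʳ true e = refl
  ∨-trueʳ false e = e

  ∨-split : ∀ a {b} → a ∨ b ≡ true → a ≡ true ⊎ b ≡ true
  ∨-split true e = inj₁ refl
  ∨-split false e = inj₂ e

  ∨-falseˡ : ∀ a {b} → a ∨ b ≡ false → a ≡ false
  ∨-falseˡ false _ = refl

  ∨-falseʳ : ∀ a {b} → a ∨ b ≡ false → b ≡ false
  ∨-falseʳ false e = e

  not-true : ∀ {a} → a ≡ false → not a ≡ true
  not-true refl = refl

  not-true⁻¹ : ∀ {a} → not a ≡ true → a ≡ false
  not-true⁻¹ {false} _ = refl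

  true≢false : ∀ {a : Bool} → a ≡ true → a ≡ false → ⊥
  true≢false refl ()

  ¬true⇒false : ∀ {a : Bool} → (a ≡ true → ⊥) → a ≡ false
  ¬true⇒false {true} f = ⊥-elim (f refl)
  ¬true⇒false {false} f = refl

  ≡true? : ∀ a → (a ≡ true) ⊎ (a ≡ false)
  ≡true? true = inj₁ refl
  ≡true? false = inj₂ refl

  isTrue : ∀ {P : Set} (d : Dec P) → P → does d ≡ true
  isTrue d p = dec-true d p

  isTrue⁻¹ : ∀ {P : Set} (d : Dec P) → does d ≡ true → P
  isTrue⁻¹ (yes p) _ = p

  ∃ᵇ : Subset v → Bool
  ∃ᵇ S = does (FinP.any? (λ x → T? (S x)))

  ∃ᵇ-intro : (S : Subset v) (x : Fin v) → S x ≡ true → ∃ᵇ S ≡ true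
  ∃ᵇ-intro S x e = isTrue (FinP.any? (λ z → T? (S z))) (x , Equivalence.from T-≡ e)

  ∃ᵇ-elim : (S : Subset v) → ∃ᵇ S ≡ true → ∃ λ x → S x ≡ true
  ∃ᵇ-elim S e with isTrue⁻¹ (FinP.any? (λ z → T? (S z))) e
  ... | x , t = x , Equivalence.to T-≡ t

  excluded-middle : {A : Set} → (Dec A → ⊥) → ⊥
  excluded-middle = ¬¬-excluded-middle

  -- Excluded middle, used once for each vertex, turns an undecided predicate into a Boolean set
  -- that can be counted. This is available only while proving ⊥, hence the continuation.
  classify : (P : Fin v → Set) →
             ((S : Subset v) → (∀ x → S x ≡ true → P x) → (∀ x → P x → S x ≡ true) → ⊥) → ⊥
  classify {zero} P k = k (λ ()) (λ ()) (λ ())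
  classify {suc v} P k = excluded-middle λ d → classify (P ∘ suc) λ S to from →
    k (λ { zero → does d ; (suc x) → S x })
      (λ { zero e → isTrue⁻¹ d e ; (suc x) e → to x e })
      (λ { zero p → isTrue d p ; (suc x) p → from x p })

  elems : Subset v → List (Fin v)
  elems {v} S = filter (λ z → T? (S z)) (allFin v)

  ∈-elems : (S : Subset v) {x : Fin v} → S x ≡ true → x ∈ elems S
  ∈-elems S {x} e = ∈-filter⁺ (λ z → T? (S z)) (∈-allFin x) (Equivalence.from T-≡ e)

  ∈-elems⁻¹ : (S : Subset v) {x : Fin v} → x ∈ elems S → S x ≡ true
  ∈-elems⁻¹ S p = Equivalence.to T-≡ (proj₂ (∈-filter⁻ (λ z → T? (S z)) {xs = allFin _} p))

  elems-unique : (S : Subset v) → Unique (elems S)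
  elems-unique {v} S = UniqueP.filter⁺ (λ z → T? (S z)) (UniqueP.allFin⁺ v)

  ∉-unique : {A : Set} {x y : A} {xs : List A} → Unique (x ∷ xs) → y ∈ xs → x ≢ y
  ∉-unique (px ∷ _) y∈ = All.lookup px y∈

  -- The head of `xs` is cut out of `ys` at one occurrence; the tail of `xs` avoids it and so still
  -- lies in what remains of `ys`.
  length-⊆ : {A : Set} {xs ys : List A} → Unique xs → (∀ {x} → x ∈ xs → x ∈ ys) → length xs ≤ length ys
  length-⊆ {xs = []} u f = z≤n
  length-⊆ {xs = x ∷ xs} {ys} u@(_ ∷ u′) f with ∈-∃++ (f (here refl))
  ... | as , bs , refl = begin
      suc (length xs)                 ≤⟨ s≤s (length-⊆ {ys = as ++ bs} u′ g) ⟩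
      suc (length (as ++ bs))         ≡⟨ cong suc (length-++ as) ⟩
      suc (length as + length bs)     ≡⟨ +-suc (length as) (length bs) ⟨
      length as + length (x ∷ bs)     ≡⟨ length-++ as ⟨
      length (as ++ x ∷ bs)           ∎
    where
    open ≤-Reasoning
    g : ∀ {z} → z ∈ xs → z ∈ as ++ bs
    g z∈ with ∈-++⁻ as (f (there z∈))
    ... | inj₁ p = ∈-++⁺ˡ p
    ... | inj₂ (here refl) = ⊥-elim (∉-unique u z∈ refl)
    ... | inj₂ (there p) = ∈-++⁺ʳ as p

  count-≤-length : (S : Subset v) (ys : List (Fin v)) → (∀ x → S x ≡ true → x ∈ ys) → count S ≤ length ys
  count-≤-length S ys f = length-⊆ (elems-unique S) (λ {x} x∈ → f x (∈-elems⁻¹ S x∈))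

  length-≤-count : (S : Subset v) {xs : List (Fin v)} → Unique xs → (∀ x → x ∈ xs → S x ≡ true) → length xs ≤ count S
  length-≤-count S u f = length-⊆ u (λ {x} x∈ → ∈-elems S (f x x∈))

  count-mono : (S T : Subset v) → (∀ x → S x ≡ true → T x ≡ true) → count S ≤ count T
  count-mono S T f = count-≤-length S (elems T) (λ x e → ∈-elems T (f x e))

  bit : Bool → ℕ
  bit true = 1
  bit false = 0

  module _ {A : Set} where

    countIn : (A → Bool) → List A → ℕ
    countIn p xs = length (filter (λ z → T? (p z)) xs)

    countIn-∷ : (p : A → Bool) (x : A) (xs : List A) → countIn p (x ∷ xs) ≡ bit (p x) + countIn p xs
    countIn-∷ p x xs with p x
    ... | true = refl
    ... | false = refl

    countIn-mono₂ : (p q r s : A → Bool) → (∀ x → bit (p x) + bit (q x) ≤ bit (r x) + bit (s x)) →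
                    ∀ xs → countIn p xs + countIn q xs ≤ countIn r xs + countIn s xs
    countIn-mono₂ p q r s h [] = z≤n
    countIn-mono₂ p q r s h (x ∷ xs)
      rewrite countIn-∷ p x xs | countIn-∷ q x xs | countIn-∷ r x xs | countIn-∷ s x xs = begin
        (bit (p x) + countIn p xs) + (bit (q x) + countIn q xs) ≡⟨ +-middle (bit (p x)) _ _ _ ⟩
        (bit (p x) + bit (q x)) + (countIn p xs + countIn q xs) ≤⟨ +-mono-≤ (h x) (countIn-mono₂ p q r s h xs) ⟩
        (bit (r x) + bit (s x)) + (countIn r xs + countIn s xs) ≡⟨ +-middle (bit (r x)) _ _ _ ⟩
        (bit (r x) + countIn r xs) + (bit (s x) + countIn s xs) ∎
      where
      open ≤-Reasoning
      +-middle : ∀ a b c d → (a + b) + (c + d) ≡ (a + c) + (b + d)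
      +-middle a b c d = begin-equality
        (a + b) + (c + d) ≡⟨ +-assoc a b (c + d) ⟩
        a + (b + (c + d)) ≡⟨ cong (a +_) (trans (sym (+-assoc b c d)) (trans (cong (_+ d) (+-comm b c))
          (+-assoc c b d))) ⟩
        a + (c + (b + d)) ≡⟨ +-assoc a c (b + d) ⟨
        (a + c) + (b + d) ∎

  -- With two counts on either side, the rules for unions, intersections and complements reduce to a
  -- check on truth values.
  count-mono₂ : (P Q R S : Subset v) → (∀ x → bit (P x) + bit (Q x) ≤ bit (R x) + bit (S x)) →
                count P + count Q ≤ count R + count S
  count-mono₂ {v} P Q R S h = countIn-mono₂ P Q R S h (allFin v)

  full ∅ : Subset v
  full _ = true
  ∅ _ = false

  count-∅ : count (∅ {v}) ≡ 0
  count-∅ {v} = n≤0⇒n≡0 (count-≤-length (∅ {v}) [] (λ x ()))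

  count-full : count (full {v}) ≡ v
  count-full {v} = ≤-antisym
    (≤-trans (count-≤-length (full {v}) (allFin v) (λ x _ → ∈-allFin x)) (≤-reflexive (length-tabulate id)))
    (≤-trans (≤-reflexive (sym (length-tabulate {n = v} id))) (length-≤-count (full {v}) (UniqueP.allFin⁺ v)
      (λ _ _ → refl)))

  count-∪ : (S T : Subset v) → count (S ∪ T) ≤ count S + count T
  count-∪ {v} S T = begin
    count (S ∪ T)                 ≡⟨ +-identityʳ _ ⟨
    count (S ∪ T) + 0             ≡⟨ cong (count (S ∪ T) +_) (sym (count-∅ {v})) ⟩
    count (S ∪ T) + count (∅ {v}) ≤⟨ count-mono₂ (S ∪ T) ∅ S T (λ x → h (S x) (T x)) ⟩
    count S + count T             ∎
    where
    open ≤-Reasoning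
    h : ∀ a b → bit (a ∨ b) + 0 ≤ bit a + bit b
    h true b = s≤s z≤n
    h false b = ≤-reflexive (+-identityʳ _)

  count-∪-∩ : (S T : Subset v) → count S + count T ≤ count (S ∪ T) + count (S ∩ T)
  count-∪-∩ S T = count-mono₂ S T (S ∪ T) (S ∩ T) (λ x → h (S x) (T x))
    where
    h : ∀ a b → bit a + bit b ≤ bit (a ∨ b) + bit (a ∧ b)
    h true b = ≤-refl
    h false b = ≤-reflexive (sym (+-identityʳ _))

  count-∁ : (S : Subset v) → count S + count (∁ S) ≡ v
  count-∁ {v} S = ≤-antisym
    (≤-trans (count-mono₂ S (∁ S) full ∅ (λ x → ≤-reflexive (h (S x))))
      (≤-reflexive (trans (cong₂ _+_ (count-full {v}) (count-∅ {v})) (+-identityʳ v))))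
    (≤-trans (≤-reflexive (sym (trans (cong₂ _+_ (count-full {v}) (count-∅ {v})) (+-identityʳ v))))
      (count-mono₂ full ∅ S (∁ S) (λ x → ≤-reflexive (sym (h (S x))))))
    where
    h : ∀ a → bit a + bit (not a) ≡ 1
    h true = refl
    h false = refl

  ∈-singleton⇒≤1 : (S : Subset v) (y : Fin v) → (∀ x → S x ≡ true → x ≡ y) → count S ≤ 1
  ∈-singleton⇒≤1 S y f = count-≤-length S (y ∷ []) (λ x e → here (f x e))

  count-pos : (S : Subset v) (x : Fin v) → S x ≡ true → 1 ≤ count S
  count-pos S x e = length-≤-count S {x ∷ []} ([] ∷ []) (λ { .x (here refl) → e })

  count-witness : (S : Subset v) → 1 ≤ count S → ∃ λ x → S x ≡ true
  count-witness S h with elems S in eq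
  ... | x ∷ xs = x , ∈-elems⁻¹ S (subst (x ∈_) (sym eq) (here refl))

  count-< : (S T : Subset v) → count T < count S → ∃ λ x → S x ≡ true × T x ≡ false
  count-< {v} S T lt with ≡true? (∃ᵇ (S ∩ ∁ T))
  ... | inj₁ e = let x , p = ∃ᵇ-elim (S ∩ ∁ T) e in x , ∧-trueˡ (S x) p , not-true⁻¹ (∧-trueʳ (S x) p)
  ... | inj₂ e = ⊥-elim (<⇒≱ lt (count-mono S T λ x sx → f x sx (≡true? (T x))))
    where
    f : ∀ x → S x ≡ true → T x ≡ true ⊎ T x ≡ false → T x ≡ true
    f x sx (inj₁ t) = t
    f x sx (inj₂ t) = ⊥-elim (true≢false (∃ᵇ-intro (S ∩ ∁ T) x (∧-true sx (not-true t))) e)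

  length-concatMap : {A B : Set} (f : A → List B) (c : ℕ) → (∀ x → length (f x) ≡ c) →
                     ∀ xs → length (concatMap f xs) ≡ length xs * c
  length-concatMap f c h [] = refl
  length-concatMap f c h (x ∷ xs) = trans (length-++ (f x)) (cong₂ _+_ (h x) (length-concatMap f c h xs))

  ∈-concatMap : {A B : Set} (f : A → List B) {x : A} {y : B} {xs : List A} → x ∈ xs → y ∈ f x → y ∈ concatMap f xs
  ∈-concatMap f {xs = xs} x∈ y∈ = ∈-concat⁺′ y∈ (∈-map⁺ f x∈)

-- Paths and closed sequences as lists of vertices.

module Paths where

  open import Defs using (Graph; adj; irrefl; symmetric; Walk; []; _∷_; Connected; nextIdx; HamiltonianCycle)
  open FiniteSets using (∉-unique; length-⊆)
  open import Data.Nat using (ℕ; zero; suc; _≤_; _≤?_; _<?_)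
  open import Data.Nat.Properties as ℕP using (≤-trans; ≤-reflexive; ≮⇒≥; ≤-antisym)
  open import Data.Fin using (cast)
  open import Data.Fin.Properties using (_≟_; toℕ-cast; toℕ-fromℕ<; toℕ-injective; toℕ<n; all?; any?)
  import Data.Bool.Properties as BoolP
  open import Data.List using (lookup)
  open import Data.List.Membership.Propositional.Properties
  open import Data.List.Relation.Unary.All as All using (All; []; _∷_)
  import Data.List.Relation.Unary.All.Properties as AllP
  open AllP using (¬Any⇒All¬)
  import Data.List.Relation.Unary.Unique.Propositional.Properties as UniqueP
  import Data.List.Relation.Binary.Permutation.Setoid.Properties as PermutationS
  open import Data.Vec as Vec using (Vec; []; _∷_)
  open import Data.Vec.Properties using (lookup∘tabulate)
  open import Function.Definitions using (Injective)
  open import Relation.Nullary.Decidable using (map′; _×-dec_; _→-dec_)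

  module _ {A : Set} where

    data Consec : List A → A → A → Set where
      here  : ∀ {a b xs} → Consec (a ∷ b ∷ xs) a b
      there : ∀ {x a b xs} → Consec xs a b → Consec (x ∷ xs) a b

    data Last : List A → A → Set where
      here  : ∀ {a} → Last (a ∷ []) a
      there : ∀ {x a xs} → Last xs a → Last (x ∷ xs) a

    Neighbouring : List A → A → A → Set
    Neighbouring xs a b = Consec xs a b ⊎ Consec xs b a

    last-++ : ∀ xs {ys a} → Last ys a → Last (xs ++ ys) a
    last-++ [] l = l
    last-++ (x ∷ xs) l = there (last-++ xs l)

    last-unique : ∀ {xs a b} → Last xs a → Last xs b → a ≡ b
    last-unique here here = refl
    last-unique (there p) (there q) = last-unique p q
    last-unique here (there ())
    last-unique (there ()) here

    last-∈ : ∀ {xs a} → Last xs a → a ∈ xs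
    last-∈ here = here refl
    last-∈ (there l) = there (last-∈ l)

    consec-++ˡ : ∀ {xs ys a b} → Consec xs a b → Consec (xs ++ ys) a b
    consec-++ˡ here = here
    consec-++ˡ (there c) = there (consec-++ˡ c)

    consec-++ʳ : ∀ xs {ys a b} → Consec ys a b → Consec (xs ++ ys) a b
    consec-++ʳ [] c = c
    consec-++ʳ (x ∷ xs) c = there (consec-++ʳ xs c)

    consec-join : ∀ {xs a b ys} → Last xs a → Consec (xs ++ b ∷ ys) a b
    consec-join here = here
    consec-join (there l) = there (consec-join l)

    consec-split : ∀ xs {b ys a c} → Consec (xs ++ b ∷ ys) a c →
                   Consec xs a c ⊎ (Last xs a × b ≡ c) ⊎ Consec (b ∷ ys) a c
    consec-split [] c = inj₂ (inj₂ c)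
    consec-split (x ∷ []) here = inj₂ (inj₁ (here , refl))
    consec-split (x ∷ []) (there c) = inj₂ (inj₂ c)
    consec-split (x ∷ x′ ∷ xs) here = inj₁ here
    consec-split (x ∷ x′ ∷ xs) (there c) with consec-split (x′ ∷ xs) c
    ... | inj₁ c′ = inj₁ (there c′)
    ... | inj₂ (inj₁ (l , e)) = inj₂ (inj₁ (there l , e))
    ... | inj₂ (inj₂ c′) = inj₂ (inj₂ c′)

    consec-∈ˡ : ∀ {xs a b} → Consec xs a b → a ∈ xs
    consec-∈ˡ here = here refl
    consec-∈ˡ (there c) = there (consec-∈ˡ c)

    consec-∈ʳ : ∀ {xs a b} → Consec xs a b → b ∈ xs
    consec-∈ʳ here = there (here refl)
    consec-∈ʳ (there c) = there (consec-∈ʳ c)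

    consec-reverse : ∀ {xs a b} → Consec xs a b → Consec (reverse xs) b a
    consec-reverse (here {a} {b} {xs})
      rewrite unfold-reverse a (b ∷ xs) | unfold-reverse b xs = consec-join (last-++ (reverse xs) here)
    consec-reverse (there {x} {xs = xs} c) rewrite unfold-reverse x xs = consec-++ˡ (consec-reverse c)

    neighbouring-reverse : ∀ {xs a b} → Neighbouring xs a b → Neighbouring (reverse xs) a b
    neighbouring-reverse (inj₁ c) = inj₂ (consec-reverse c)
    neighbouring-reverse (inj₂ c) = inj₁ (consec-reverse c)

    neighbouring-++ˡ : ∀ {xs ys a b} → Neighbouring xs a b → Neighbouring (xs ++ ys) a b
    neighbouring-++ˡ (inj₁ c) = inj₁ (consec-++ˡ c)
    neighbouring-++ˡ (inj₂ c) = inj₂ (consec-++ˡ c)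

    neighbouring-++ʳ : ∀ xs {ys a b} → Neighbouring ys a b → Neighbouring (xs ++ ys) a b
    neighbouring-++ʳ xs (inj₁ c) = inj₁ (consec-++ʳ xs c)
    neighbouring-++ʳ xs (inj₂ c) = inj₂ (consec-++ʳ xs c)

    private
      ∈-tail : ∀ {x a : A} {xs} → Consec (x ∷ xs) a x → x ∈ xs
      ∈-tail here = here refl
      ∈-tail (there c) = consec-∈ʳ c

    consec-pred-unique : ∀ {xs a b c} → Unique xs → Consec xs a c → Consec xs b c → a ≡ b
    consec-pred-unique u here here = refl
    consec-pred-unique (_ ∷ u) here (there c) = ⊥-elim (∉-unique u (∈-tail c) refl)
    consec-pred-unique (_ ∷ u) (there c) here = ⊥-elim (∉-unique u (∈-tail c) refl)
    consec-pred-unique (_ ∷ u) (there c) (there d) = consec-pred-unique u c d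

    consec-succ-unique : ∀ {xs a b c} → Unique xs → Consec xs a b → Consec xs a c → b ≡ c
    consec-succ-unique u here here = refl
    consec-succ-unique u here (there c) = ⊥-elim (∉-unique u (consec-∈ˡ c) refl)
    consec-succ-unique u (there c) here = ⊥-elim (∉-unique u (consec-∈ˡ c) refl)
    consec-succ-unique (_ ∷ u) (there c) (there d) = consec-succ-unique u c d

    consec-irrefl : ∀ {xs a b} → Unique xs → Consec xs a b → a ≢ b
    consec-irrefl u here = ∉-unique u (here refl)
    consec-irrefl (_ ∷ u) (there c) = consec-irrefl u c

    consec-asym : ∀ {xs a b} → Unique xs → Consec xs a b → Consec xs b a → ⊥
    consec-asym u here (there c) = ∉-unique u (consec-∈ʳ c) refl
    consec-asym u (there c) here = ∉-unique u (consec-∈ʳ c) refl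
    consec-asym u here here = ∉-unique u (here refl) refl
    consec-asym (_ ∷ u) (there c) (there d) = consec-asym u c d

    split-unique : ∀ us {us′ vs vs′ : List A} {b} → Unique (us ++ b ∷ vs) →
                   us ++ b ∷ vs ≡ us′ ++ b ∷ vs′ → us ≡ us′ × vs ≡ vs′
    split-unique [] {[]} u refl = refl , refl
    split-unique [] {x ∷ us′} u refl = ⊥-elim (∉-unique u (∈-++⁺ʳ us′ (here refl)) refl)
    split-unique (x ∷ us) {[]} u refl = ⊥-elim (∉-unique u (∈-++⁺ʳ us (here refl)) refl)
    split-unique (x ∷ us) {x′ ∷ us′} (_ ∷ u) e with ∷-injective e
    ... | refl , e′ with split-unique us u e′
    ... | refl , refl = refl , refl

    unique-++ˡ : ∀ xs {ys : List A} → Unique (xs ++ ys) → Unique xs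
    unique-++ˡ [] u = []
    unique-++ˡ (x ∷ xs) (px ∷ u) = AllP.++⁻ˡ xs px ∷ unique-++ˡ xs u

    unique-++ʳ : ∀ xs {ys : List A} → Unique (xs ++ ys) → Unique ys
    unique-++ʳ [] u = u
    unique-++ʳ (x ∷ xs) (_ ∷ u) = unique-++ʳ xs u

    Unique-↭ : {xs ys : List A} → xs ↭ ys → Unique xs → Unique ys
    Unique-↭ p u = PermutationS.Unique-resp-↭ (setoid A) (↭⇒↭ₛ p) u

    unique-++ : {xs ys : List A} → Unique xs → Unique ys → (∀ {z} → z ∈ xs → z ∈ ys → ⊥) → Unique (xs ++ ys)
    unique-++ u w d = UniqueP.++⁺ u w (λ { (p , q) → d p q })

  module GraphPaths {v : ℕ} (G : Graph v) where

    open import Data.List.Membership.DecPropositional (FinP._≟_ {v}) using (_∈?_)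

    R : Fin v → Fin v → Set
    R x y = adj G x y ≡ true

    R-sym : ∀ {x y} → R x y → R y x
    R-sym {x} {y} e = trans (symmetric G y x) e

    R-irrefl : ∀ {x y} → R x y → x ≢ y
    R-irrefl {x} e refl with trans (sym e) (irrefl G x)
    ... | ()

    infixr 5 _∷_
    -- The vertex list is an index, so that uniqueness and permutations can be stated for it while
    -- the path is cut, reversed and rejoined.
    data Seg : Fin v → Fin v → List (Fin v) → Set where
      [-] : ∀ {x} → Seg x x (x ∷ [])
      _∷_ : ∀ {x y z xs} → R x y → Seg y z xs → Seg x z (x ∷ xs)

    seg-join : ∀ {x y z w xs zs} → Seg x y xs → R y z → Seg z w zs → Seg x w (xs ++ zs)
    seg-join [-] r t = r ∷ t
    seg-join (r′ ∷ s) r t = r′ ∷ seg-join s r t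

    seg-reverse : ∀ {x y xs} → Seg x y xs → Seg y x (reverse xs)
    seg-reverse [-] = [-]
    seg-reverse (_∷_ {x} {xs = xs} r s) rewrite unfold-reverse x xs = seg-join (seg-reverse s) (R-sym r) [-]

    seg-head : ∀ {x y z xs} → Seg x y (z ∷ xs) → x ≡ z
    seg-head [-] = refl
    seg-head (_ ∷ _) = refl

    seg-last : ∀ {x y xs} → Seg x y xs → Last xs y
    seg-last [-] = here
    seg-last (_ ∷ s) = there (seg-last s)

    seg-first-∈ : ∀ {x y xs} → Seg x y xs → x ∈ xs
    seg-first-∈ [-] = here refl
    seg-first-∈ (_ ∷ _) = here refl

    seg-last-∈ : ∀ {x y xs} → Seg x y xs → y ∈ xs
    seg-last-∈ s = last-∈ (seg-last s)

    seg-split : ∀ {x y} a as {b bs} → Seg x y ((a ∷ as) ++ b ∷ bs) →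
                ∃ λ z → Seg x z (a ∷ as) × R z b × Seg b y (b ∷ bs)
    seg-split a [] (r ∷ s) with seg-head s
    ... | refl = a , [-] , r , s
    seg-split a (a′ ∷ as) (r ∷ s) with seg-split a′ as s
    ... | z , s₁ , r′ , s₂ = z , r ∷ s₁ , r′ , s₂

    seg-trans : ∀ {x y z xs ys} → Seg x y xs → Seg y z ys →
                ∃ λ zs → Seg x z zs × (∀ {w} → w ∈ zs → w ∈ xs ⊎ w ∈ ys)
    seg-trans {xs = xs} s [-] = xs , s , inj₁
    seg-trans {xs = xs} s (_∷_ {xs = ys} r t) = xs ++ ys , seg-join s r t , λ w∈ → f (∈-++⁻ xs w∈)
      where
      f : ∀ {w u} → w ∈ xs ⊎ w ∈ ys → w ∈ xs ⊎ w ∈ u ∷ ys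
      f (inj₁ p) = inj₁ p
      f (inj₂ p) = inj₂ (there p)

    seg-suffix : ∀ {x y z zs} → Seg x y zs → z ∈ zs → Unique zs →
                 ∃ λ ws → Seg z y ws × Unique ws × (∀ {w} → w ∈ ws → w ∈ zs)
    seg-suffix s@[-] (here refl) u = _ , s , u , id
    seg-suffix s@(_ ∷ _) (here refl) u = _ , s , u , id
    seg-suffix (_ ∷ s) (there z∈) (_ ∷ u) with seg-suffix s z∈ u
    ... | ws , t , u′ , sub = ws , t , u′ , there ∘ sub

    -- Loop erasure: if the new first vertex already occurs later on, the path starts at that
    -- occurrence instead.
    seg-simplify : ∀ {x y xs} → Seg x y xs →
                   ∃ λ zs → Seg x y zs × Unique zs × (∀ {w} → w ∈ zs → w ∈ xs)
    seg-simplify ([-] {x}) = x ∷ [] , [-] , [] ∷ [] , id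
    seg-simplify {y = y} (_∷_ {x} {xs = xs} r s) with seg-simplify s
    ... | zs , t , u , sub with x ∈? zs
    ... | no x∉ = x ∷ zs , r ∷ t , ¬Any⇒All¬ zs x∉ ∷ u , λ { (here e) → here e ; (there p) → there (sub p) }
    ... | yes x∈ with seg-suffix t x∈ u
    ... | ws , t′ , u′ , sub′ = ws , t′ , u′ , there ∘ sub ∘ sub′

    -- A single edge, traversed back and forth, also counts as closed; it is the cycle from which
    -- the Chvátal-Erdős argument starts to grow.
    Closed : List (Fin v) → Set
    Closed xs = ∃₂ λ x y → Seg x y xs × R y x

    seg-lookup : ∀ {x y xs} → Seg x y xs → (i j : Fin (length xs)) → toℕ j ≡ suc (toℕ i) →
                 R (lookup xs i) (lookup xs j)
    seg-lookup [-] zero zero ()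
    seg-lookup (r ∷ [-]) zero (suc zero) e = r
    seg-lookup (r ∷ (_ ∷ _)) zero (suc zero) e = r
    seg-lookup (r ∷ s) (suc i) (suc j) e = seg-lookup s i j (ℕP.suc-injective e)

    lookup-first : ∀ {x y xs} → Seg x y xs → (i : Fin (length xs)) → toℕ i ≡ 0 → lookup xs i ≡ x
    lookup-first [-] zero e = refl
    lookup-first (r ∷ s) zero e = refl

    lookup-last : ∀ {x y xs} → Seg x y xs → (i : Fin (length xs)) → suc (toℕ i) ≡ length xs → lookup xs i ≡ y
    lookup-last [-] zero e = refl
    lookup-last (r ∷ [-]) zero ()
    lookup-last (r ∷ _ ∷ _) zero ()
    lookup-last (_∷_ r s) (suc i) e = lookup-last s i (ℕP.suc-injective e)

    data NextView : {n : ℕ} (i j : Fin n) → Set where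
      next : ∀ {n} {i j : Fin n} → toℕ j ≡ suc (toℕ i) → NextView i j
      wrap : ∀ {n} {i j : Fin n} → suc (toℕ i) ≡ n → toℕ j ≡ 0 → NextView i j

    nextView : ∀ {n} (i : Fin n) → NextView i (nextIdx i)
    nextView {suc n} i with toℕ i <? n
    ... | yes i<n = next (cong suc (toℕ-fromℕ< i<n))
    ... | no i≮n = wrap (cong suc (≤-antisym (ℕP.≤-pred (toℕ<n i)) (≮⇒≥ i≮n))) refl

    lookup-injective : {xs : List (Fin v)} → Unique xs → ∀ {i j} → lookup xs i ≡ lookup xs j → i ≡ j
    lookup-injective {x ∷ xs} u {zero} {zero} e = refl
    lookup-injective {x ∷ xs} u {zero} {suc j} e = ⊥-elim (∉-unique u (∈-lookup j) e)
    lookup-injective {x ∷ xs} u {suc i} {zero} e = ⊥-elim (∉-unique u (∈-lookup i) (sym e))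
    lookup-injective {x ∷ xs} (_ ∷ u) {suc i} {suc j} e = cong suc (lookup-injective u e)

    closed⇒hamiltonian : 3 ≤ v → ∀ {xs} → Closed xs → Unique xs → v ≡ length xs → HamiltonianCycle G
    closed⇒hamiltonian 3≤v {xs} (x , y , s , r) u e = 3≤v , c , c-injective , step
      where
      c : Fin v → Fin v
      c i = lookup xs (cast e i)
      c-injective : Injective _≡_ _≡_ c
      c-injective {i} {j} eq = toℕ-injective (trans (sym (toℕ-cast e i))
        (trans (cong toℕ (lookup-injective u eq)) (toℕ-cast e j)))
      step : ∀ i → R (c i) (c (nextIdx i))
      step i with nextIdx i | nextView i
      ... | j | next q = seg-lookup s (cast e i) (cast e j)
                  (trans (toℕ-cast e j) (trans q (cong suc (sym (toℕ-cast e i)))))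
      ... | j | wrap q q′ = subst₂ R
                  (sym (lookup-last s (cast e i) (trans (cong suc (toℕ-cast e i)) (trans q e))))
                  (sym (lookup-first s (cast e j) (trans (toℕ-cast e j) q′))) r

    ∃-vec? : ∀ {m} n (P : Vec (Fin m) n → Set) → (∀ xs → Dec (P xs)) → Dec (∃ P)
    ∃-vec? zero P P? = map′ (λ p → [] , p) (λ { ([] , p) → p }) (P? [])
    ∃-vec? (suc n) P P? = map′ (λ { (x , xs , p) → x ∷ xs , p }) (λ { (x ∷ xs , p) → x , xs , p })
      (any? λ x → ∃-vec? n (λ xs → P (x ∷ xs)) (λ xs → P? (x ∷ xs)))

    -- Exhaustive search. It ranges over vectors, which can be enumerated entry by entry.
    -- Decidability is what permits every other argument to end in ⊥.
    hamiltonian? : Dec (HamiltonianCycle G)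
    hamiltonian? = (3 ≤? v) ×-dec map′ to from
      (∃-vec? v Tour (λ c → all? (λ i → all? λ j → (Vec.lookup c i ≟ Vec.lookup c j) →-dec (i ≟ j))
        ×-dec all? (λ i → adj G (Vec.lookup c i) (Vec.lookup c (nextIdx i)) BoolP.≟ true)))
      where
      Tour : Vec (Fin v) v → Set
      Tour c = (∀ i j → Vec.lookup c i ≡ Vec.lookup c j → i ≡ j) × (∀ i → R (Vec.lookup c i) (Vec.lookup c (nextIdx i)))
      to : ∃ Tour → _
      to (c , inj , step) = Vec.lookup c , (λ {i} {j} → inj i j) , step
      from : (Σ (Fin v → Fin v) λ c → Injective _≡_ _≡_ c × (∀ i → R (c i) (c (nextIdx i)))) → ∃ Tour
      from (c , inj , step) = Vec.tabulate c
        , (λ i j e → inj (trans (sym (lookup∘tabulate c i)) (trans e (lookup∘tabulate c j))))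
        , λ i → subst₂ R (sym (lookup∘tabulate c i)) (sym (lookup∘tabulate c (nextIdx i))) (step i)

    length-≤-v : {xs : List (Fin v)} → Unique xs → length xs ≤ v
    length-≤-v u = ≤-trans (length-⊆ u (λ {x} _ → ∈-allFin x)) (≤-reflexive (length-tabulate id))

    covers : {xs : List (Fin v)} → Unique xs → (∀ x → x ∈ xs) → v ≡ length xs
    covers {xs} u all = ≤-antisym
      (≤-trans (≤-reflexive (sym (length-tabulate {n = v} id))) (length-⊆ (UniqueP.allFin⁺ v) (λ {x} _ → all x)))
      (length-≤-v u)

    exit-edge : Connected G → ∀ {xs x y} → x ∈ xs → y ∉ xs → ∃₂ λ a b → a ∈ xs × b ∉ xs × R a b
    exit-edge conn {xs} {x} {y} x∈ y∉ = go (conn x y) x∈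
      where
      go : ∀ {a} → Walk G a y → a ∈ xs → ∃₂ λ a b → a ∈ xs × b ∉ xs × R a b
      go [] a∈ = ⊥-elim (y∉ a∈)
      go (_∷_ {y = b} r w) a∈ with b ∈? xs
      ... | yes b∈ = go w b∈
      ... | no b∉ = _ , b , a∈ , b∉ , r

    closed-from : ∀ {xs a} → Closed xs → a ∈ xs → ∃₂ λ z ys → Seg a z ys × R z a × ys ↭ xs
    closed-from (x , y , s , r) a∈ with ∈-∃++ a∈
    ... | [] , bs , refl with seg-head s
    ... | refl = y , _ , s , r , ↭-refl
    closed-from (x , y , s , r) a∈ | c ∷ as , bs , refl with seg-split c as s
    ... | z , s₁ , r′ , s₂ = z , _ , seg-join s₂ r s₁ , r′ , ++-comm (_ ∷ bs) (c ∷ as)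

-- Longest cycles and separating sets after Chvátal and Erdős.

module ChvatalErdos where

  open import Defs using (Graph; HamiltonianCycle; count)
  open FiniteSets
  open Paths
  open import Data.Nat using (ℕ; zero; suc; _+_; _≤_; _<_; s≤s)
  open import Data.Nat.Properties as ℕP using (≤-trans; ≤-reflexive; <⇒≱)
  open import Data.List.Membership.Propositional.Properties
  open import Data.List.Relation.Unary.All.Properties using (¬Any⇒All¬)

  module Separation {v : ℕ} (G : Graph v) where

    open GraphPaths G
    open import Data.List.Membership.DecPropositional (FinP._≟_ {v}) using (_∈?_)

    -- What a longest but not Hamiltonian cycle leaves behind: `H` is a component off the cycle, `S`
    -- its neighbours on the cycle, `F` all remaining vertices, and `I` consists of the successors
    -- of `S` together with `h`.
    record Separator : Set where
      field
        H F S I        : Subset v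
        cover          : ∀ x → H x ≡ true ⊎ F x ≡ true ⊎ S x ≡ true
        H∩F            : ∀ x → H x ≡ true → F x ≡ true → ⊥
        S∩H            : ∀ x → S x ≡ true → H x ≡ true → ⊥
        S∩F            : ∀ x → S x ≡ true → F x ≡ true → ⊥
        separated      : ∀ {x y} → H x ≡ true → F y ≡ true → R x y → ⊥
        h f            : Fin v
        h∈H            : H h ≡ true
        f∈F            : F f ≡ true
        independent    : ∀ {x y} → I x ≡ true → I y ≡ true → R x y → ⊥
        S<I            : count S < count I

    seg-cut : ∀ {x y a b us vs} → Last us a → Seg x y (us ++ b ∷ vs) → Seg x a us × R a b × Seg b y (b ∷ vs)
    seg-cut here (r ∷ s) with seg-head s
    ... | refl = [-] , r , s
    seg-cut (there {xs = _ ∷ _} l) (r ∷ s) with seg-cut l s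
    ... | s₁ , r′ , s₂ = r ∷ s₁ , r′ , s₂

    -- The cyclic predecessor of b in the closed sequence xs is a.
    Pred : List (Fin v) → Fin v → Fin v → Set
    Pred xs b a = ∃₂ λ us vs → xs ≡ us ++ b ∷ vs × Seg b a (b ∷ vs ++ us) × R a b

    pred-∈ : ∀ {xs b a} → Pred xs b a → b ∈ xs
    pred-∈ (us , vs , refl , _) = ∈-++⁺ʳ us (here refl)

    pred-unique : ∀ {xs b a a′} → Unique xs → Pred xs b a → Pred xs b a′ → a ≡ a′
    pred-unique u (us , vs , refl , s , _) (us′ , vs′ , e , s′ , _) with split-unique us u e
    ... | refl , refl = last-unique (seg-last s) (seg-last s′)

    pred-of-first : ∀ {x y xs} → Seg x y xs → R y x → Pred xs x y
    pred-of-first [-] r = [] , [] , refl , [-] , r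
    pred-of-first (_∷_ {xs = xs} r′ s) r = [] , xs , refl , r′ ∷ subst (Seg _ _) (sym (++-identityʳ xs)) s , r

    pred-of : ∀ {xs a} → Closed xs → a ∈ xs → ∃ λ b → Pred xs b a
    pred-of {a = a} (x , y , s , r) a∈ with ∈-∃++ a∈
    ... | us , [] , refl with last-unique (seg-last s) (last-++ us here)
    ... | refl = x , pred-of-first s r
    pred-of {a = a} (x , y , s , r) a∈ | us , b ∷ vs , refl
      with e ← sym (++-assoc us (a ∷ []) (b ∷ vs))
      with seg-cut (last-++ us here) (subst (Seg x y) e s)
    ... | s₁ , r′ , s₂ = b , us ++ a ∷ [] , vs , e , seg-join s₂ r s₁ , r′

    -- Cutting the cycle just before b₁ and just before b₂ leaves two arcs. The two cases are the
    -- two orders in which b₁ and b₂ occur in the list.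
    split-at-two : ∀ {xs b₁ b₂ a₁ a₂} → Unique xs → b₁ ≢ b₂ → Pred xs b₁ a₁ → Pred xs b₂ a₂ →
             ∃₂ λ X Y → Seg b₁ a₂ X × Seg b₂ a₁ Y × X ++ Y ↭ xs
    split-at-two {b₁ = b₁} {b₂} {a₁} {a₂} u b≢ (us , vs , refl , s , _) p₂@(us₂ , vs₂ , e , s₂ , _)
      with ∈-++⁻ us (pred-∈ p₂)
    ... | inj₂ (here refl) = ⊥-elim (b≢ refl)
    ... | inj₂ (there b∈) with ∈-∃++ b∈
    ... | c , d , refl
      with seg-split b₁ c (subst (Seg b₁ a₁ ∘ (b₁ ∷_)) (++-assoc c (b₂ ∷ d) us) s)
         | split-unique (us ++ b₁ ∷ c) (subst Unique (sym (++-assoc us (b₁ ∷ c) (b₂ ∷ d))) u)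
             (trans (++-assoc us (b₁ ∷ c) (b₂ ∷ d)) e)
    ... | z , t₁ , _ , t₂ | refl , refl with last-unique (seg-last s₂) (last-++ (b₂ ∷ d) (last-++ us (seg-last t₁)))
    ... | refl = b₁ ∷ c , b₂ ∷ d ++ us , t₁ , t₂ ,
          ↭-trans (↭-reflexive (sym (++-assoc (b₁ ∷ c) (b₂ ∷ d) us))) (++-comm (b₁ ∷ c ++ b₂ ∷ d) us)
    split-at-two {b₁ = b₁} {b₂} {a₁} {a₂} u b≢ (us , vs , refl , s , _) p₂@(us₂ , vs₂ , e , s₂ , _)
        | inj₁ b∈ with ∈-∃++ b∈
    ... | c , d , refl
      with seg-split b₁ (vs ++ c) (subst (Seg b₁ a₁ ∘ (b₁ ∷_)) (sym (++-assoc vs c (b₂ ∷ d))) s)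
         | split-unique c (subst Unique (++-assoc c (b₂ ∷ d) (b₁ ∷ vs)) u)
             (trans (sym (++-assoc c (b₂ ∷ d) (b₁ ∷ vs))) e)
    ... | z , t₁ , _ , t₂ | refl , refl
      with last-unique (seg-last s₂)
             (subst (λ l → Last l z) (sym (++-assoc (b₂ ∷ d) (b₁ ∷ vs) c)) (last-++ (b₂ ∷ d) (seg-last t₁)))
    ... | refl = b₁ ∷ vs ++ c , b₂ ∷ d , t₁ , t₂ ,
          ↭-trans (↭-reflexive (++-assoc (b₁ ∷ vs) c (b₂ ∷ d))) (++-comm (b₁ ∷ vs) (c ++ b₂ ∷ d))

    module _ {xs : List (Fin v)} (closed : Closed xs) (uniq : Unique xs) {h : Fin v} (h∉ : h ∉ xs)
             (longest : ∀ ys → Closed ys → Unique ys → length xs < length ys → ⊥) where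

      Reachable : Fin v → Set
      Reachable z = ∃ λ L → Seg h z L × (∀ {w} → w ∈ L → w ∉ xs)

      Attached : Fin v → Set
      Attached a = a ∈ xs × ∃ λ z → Reachable z × R z a

      Chosen : Fin v → Set
      Chosen b = b ≡ h ⊎ ∃ λ a → Attached a × Pred xs b a

      reachable-h : Reachable h
      reachable-h = h ∷ [] , [-] , λ { (here refl) → h∉ }

      reachable-∉ : ∀ {z} → Reachable z → z ∉ xs
      reachable-∉ (L , s , out) = out (seg-last-∈ s)

      detour : ∀ {y z} → Reachable y → Reachable z → ∃ λ L → Seg y z L × Unique L × (∀ {w} → w ∈ L → w ∉ xs)
      detour (L , s , out) (L′ , s′ , out′) with seg-trans (seg-reverse s) s′
      ... | M , t , sub with seg-simplify t
      ... | N , t′ , u , sub′ = N , t′ , u , λ w∈ → f (sub (sub′ w∈))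
        where
        f : ∀ {w} → w ∈ reverse L ⊎ w ∈ L′ → w ∉ xs
        f (inj₁ w∈) = out (∈-resp-↭ (↭-reverse L) w∈)
        f (inj₂ w∈) = out′ w∈

      longer : ∀ {y z ys L} → ys ↭ xs ++ L → Seg y z L → Unique L → (∀ {w} → w ∈ L → w ∉ xs) → Closed ys → ⊥
      longer {ys = ys} {L} p t u out c = longest ys c
        (Unique-↭ (↭-sym p) (unique-++ uniq u (λ w∈ w∈′ → out w∈′ w∈)))
        (≤-trans (len t) (≤-reflexive (sym (↭-length p))))
        where
        len : ∀ {y z L} → Seg y z L → length xs < length (xs ++ L)
        len {L = _ ∷ L} _ = ≤-trans (≤-trans (s≤s (ℕP.m≤m+n (length xs) (length L)))
          (≤-reflexive (sym (ℕP.+-suc (length xs) (length L))))) (≤-reflexive (sym (length-++ xs)))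

      -- Otherwise the edge from a to b could be replaced by a path through the component, giving a
      -- longer cycle.
      successor-unattached : ∀ {a b} → Attached a → Pred xs b a → Attached b → ⊥
      successor-unattached (_ , y , ry , ya) (us , vs , refl , s , _) (_ , z , rz , zb)
        with detour ry rz
      ... | L , t , u , out = longer (++⁺ʳ L (++-comm (_ ∷ vs) us)) t u out
                                (_ , _ , seg-join s (R-sym ya) t , zb)

      -- Given an edge between b₁ and b₂, the longer cycle runs from b₁ along its arc to a₂, through
      -- the component to a₁, backwards along the other arc to b₂, and over the edge back to b₁.
      successors-independent : ∀ {a₁ a₂ b₁ b₂} → Attached a₁ → Pred xs b₁ a₁ → Attached a₂ → Pred xs b₂ a₂ →
                               R b₁ b₂ → ⊥
      successors-independent (_ , y , ry , ya) p₁ (_ , z , rz , za) p₂ r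
        with split-at-two uniq (R-irrefl r) p₁ p₂ | detour rz ry
      ... | X , Y , s₁ , s₂ , p | L , t , u , out =
        longer (↭-trans (++⁺ˡ X (↭-trans (++⁺ˡ L (↭-reverse Y)) (++-comm L Y)))
                 (↭-trans (↭-reflexive (sym (++-assoc X Y L))) (++⁺ʳ L p)))
               t u out
               (_ , _ , seg-join s₁ (R-sym za) (seg-join t ya (seg-reverse s₂)) , R-sym r)

      chosen-independent : ∀ {x y} → Chosen x → Chosen y → R x y → ⊥
      chosen-independent (inj₁ refl) (inj₁ refl) r = R-irrefl r refl
      chosen-independent (inj₁ refl) (inj₂ (a , at , p)) r =
        successor-unattached at p (pred-∈ p , h , reachable-h , r)
      chosen-independent (inj₂ (a , at , p)) (inj₁ refl) r =
        successor-unattached at p (pred-∈ p , h , reachable-h , R-sym r)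
      chosen-independent (inj₂ (_ , at₁ , p₁)) (inj₂ (_ , at₂ , p₂)) r = successors-independent at₁ p₁ at₂ p₂ r

      successors : ∀ {as} → Unique as → (∀ {a} → a ∈ as → Attached a) →
                   ∃ λ bs → length bs ≡ length as × Unique bs × (∀ {b} → b ∈ bs → ∃ λ a → a ∈ as × Pred xs b a)
      successors {[]} [] f = [] , refl , [] , λ ()
      successors {a ∷ as} u@(_ ∷ u′) f with successors u′ (f ∘ there) | pred-of closed (proj₁ (f (here refl)))
      ... | bs , len , ub , g | b , p = b ∷ bs , cong suc len , ¬Any⇒All¬ bs fresh ∷ ub , g′
        where
        fresh : b ∉ bs
        fresh b∈ with g b∈
        ... | a′ , a′∈ , p′ = ∉-unique u a′∈ (pred-unique uniq p p′)
        g′ : ∀ {b′} → b′ ∈ b ∷ bs → ∃ λ a′ → a′ ∈ a ∷ as × Pred xs b′ a′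
        g′ (here refl) = a , here refl , p
        g′ (there b∈) = let a′ , a′∈ , p′ = g b∈ in a′ , there a′∈ , p′

      module Build (H S I : Subset v)
        (H⇒ : ∀ x → H x ≡ true → Reachable x) (⇒H : ∀ x → Reachable x → H x ≡ true)
        (S⇒ : ∀ x → S x ≡ true → Attached x) (⇒S : ∀ x → Attached x → S x ≡ true)
        (I⇒ : ∀ x → I x ≡ true → Chosen x) (⇒I : ∀ x → Chosen x → I x ≡ true) where

        F : Subset v
        F = ∁ H ∩ ∁ S

        F-¬H : ∀ x → H x ≡ true → F x ≡ true → ⊥
        F-¬H x hx fx = true≢false hx (not-true⁻¹ (∧-trueˡ (not (H x)) fx))

        F-¬S : ∀ x → S x ≡ true → F x ≡ true → ⊥
        F-¬S x sx fx = true≢false sx (not-true⁻¹ (∧-trueʳ (not (H x)) fx))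

        ⇒F : ∀ x → ¬ Reachable x → ¬ Attached x → F x ≡ true
        ⇒F x nr na = ∧-true (not-true (¬true⇒false (nr ∘ H⇒ x))) (not-true (¬true⇒false (na ∘ S⇒ x)))

        cover : ∀ x → H x ≡ true ⊎ F x ≡ true ⊎ S x ≡ true
        cover x with ≡true? (H x) | ≡true? (S x)
        ... | inj₁ hx | _ = inj₁ hx
        ... | inj₂ _ | inj₁ sx = inj₂ (inj₂ sx)
        ... | inj₂ hx | inj₂ sx = inj₂ (inj₁ (∧-true (not-true hx) (not-true sx)))

        separated : ∀ {x y} → H x ≡ true → F y ≡ true → R x y → ⊥
        separated {x} {y} hx fy r with H⇒ x hx | y ∈? xs
        ... | rx | yes y∈ = F-¬S y (⇒S y (y∈ , x , rx , r)) fy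
        ... | L , s , out | no y∉ = F-¬H y (⇒H y (L ++ y ∷ [] , seg-join s r [-] , out′)) fy
          where
          out′ : ∀ {w} → w ∈ L ++ y ∷ [] → w ∉ xs
          out′ w∈ with ∈-++⁻ L w∈
          ... | inj₁ w∈L = out w∈L
          ... | inj₂ (here refl) = y∉

        -- Of a cycle vertex and its successor, at most one is attached to the component; the other
        -- lies in `F`.
        far : ∃ λ f → F f ≡ true
        far = far-from (seg-first-∈ (proj₁ (proj₂ (proj₂ closed))))
          where
          far-from : ∀ {x} → x ∈ xs → ∃ λ f → F f ≡ true
          far-from {x} x∈ with ≡true? (S x)
          ... | inj₂ sx = x , ⇒F x (λ r → reachable-∉ r x∈) (λ a → true≢false (⇒S x a) sx)
          ... | inj₁ sx with pred-of closed x∈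
          ... | b , p = b , ⇒F b (λ r → reachable-∉ r (pred-∈ p)) (successor-unattached (S⇒ x sx) p)

        S<I : count S < count I
        S<I with successors (elems-unique S) (λ {a} a∈ → S⇒ a (∈-elems⁻¹ S a∈))
        ... | bs , len , u , g = subst (λ n → suc n ≤ count I) len (length-≤-count I (¬Any⇒All¬ bs fresh ∷ u) chosen)
          where
          fresh : h ∉ bs
          fresh h∈ = h∉ (pred-∈ (proj₂ (proj₂ (g h∈))))
          chosen : ∀ x → x ∈ h ∷ bs → I x ≡ true
          chosen x (here refl) = ⇒I x (inj₁ refl)
          chosen x (there x∈) = let a , a∈ , p = g x∈ in ⇒I x (inj₂ (a , S⇒ a (∈-elems⁻¹ S a∈) , p))

        result : Separator
        result = record
          { H = H ; F = F ; S = S ; I = I ; cover = cover ; H∩F = F-¬H ; S∩F = F-¬S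
          ; S∩H = λ x sx hx → reachable-∉ (H⇒ x hx) (proj₁ (S⇒ x sx)) ; separated = separated
          ; h = h ; f = proj₁ far ; h∈H = ⇒H h reachable-h ; f∈F = proj₂ far
          ; independent = λ {x} {y} ix iy → chosen-independent (I⇒ x ix) (I⇒ y iy) ; S<I = S<I }

      separator : (Separator → ⊥) → ⊥
      separator k =
        classify Reachable λ H H⇒ ⇒H →
        classify Attached λ S S⇒ ⇒S →
        classify Chosen λ I I⇒ ⇒I →
        k (Build.result H S I H⇒ ⇒H S⇒ ⇒S I⇒ ⇒I)

    -- The closed sequence is replaced by longer ones while n bounds the number of vertices still
    -- off it. A sequence whose extension leads to ⊥ is as good as a longest one.
    nonhamiltonian⇒separator : 3 ≤ v → ¬ HamiltonianCycle G → ∀ {x y} → R x y → (Separator → ⊥) → ⊥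
    nonhamiltonian⇒separator 3≤v ¬ham {x} {y} r k =
      extend v (x ∷ y ∷ []) (x , y , r ∷ [-] , R-sym r) ((R-irrefl r ∷ []) ∷ [] ∷ []) (ℕP.m≤m+n v 2)
      where
      extend : ∀ n xs → Closed xs → Unique xs → v ≤ n + length xs → ⊥
      extend n xs c u le with FinP.all? (λ z → z ∈? xs)
      ... | yes all = ¬ham (closed⇒hamiltonian 3≤v c u (covers u all))
      ... | no ¬all with FinP.¬∀⟶∃¬ v _ (λ z → z ∈? xs) ¬all
      extend zero xs c u le | no ¬all | h , h∉ = <⇒≱ (length-≤-v (¬Any⇒All¬ xs h∉ ∷ u)) le
      extend (suc n) xs c u le | no ¬all | h , h∉ = separator c u h∉
        (λ ys c′ u′ lt → extend n ys c′ u′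
          (≤-trans le (≤-trans (≤-reflexive (sym (ℕP.+-suc n (length xs)))) (ℕP.+-monoʳ-≤ n lt)))) k

-- Integer sums, the Cauchy-Schwarz inequality and indicator functions.

module IntegerSums where

  open import Defs using (count)
  open FiniteSets using (Subset; bit; countIn; countIn-∷)
  open import Data.Nat as ℕ using (ℕ; zero; suc)
  open import Data.Integer using (ℤ; +_; -[1+_]; _+_; _*_; -_; _-_; _≤_; 0ℤ; 1ℤ; +≤+)
  open import Data.Integer.Properties as ℤP
  open import Data.Integer.Tactic.RingSolver using (solve-∀)
  open import Data.List using (tabulate)
  open import Relation.Nullary.Decidable using (dec-true; dec-false)
  import Algebra.Properties.Semiring.Sum ℤP.+-*-semiring as S

  private
    variable
      n m : ℕ

  infixl 10 ∑

  abstract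
    ∑ : ∀ n → (Fin n → ℤ) → ℤ
    ∑ n f = S.sum f

  syntax ∑ n (λ i → x) = ∑[ i < n ] x

  abstract
    sum-cong : {f g : Fin n → ℤ} → (∀ i → f i ≡ g i) → ∑ n f ≡ ∑ n g
    sum-cong = S.sum-cong-≗

    sum-+ : (f g : Fin n → ℤ) → ∑[ i < n ] (f i + g i) ≡ ∑ n f + ∑ n g
    sum-+ = S.∑-distrib-+

    sum-swap : (f : Fin n → Fin m → ℤ) → ∑[ i < n ] ∑[ j < m ] f i j ≡ ∑[ j < m ] ∑[ i < n ] f i j
    sum-swap = S.∑-comm

    sum-*ˡ : ∀ c (f : Fin n → ℤ) → ∑[ i < n ] (c * f i) ≡ c * ∑ n f
    sum-*ˡ c f = sym (S.*-distribˡ-sum c f)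

    sum-*ʳ : ∀ c (f : Fin n → ℤ) → ∑[ i < n ] (f i * c) ≡ ∑ n f * c
    sum-*ʳ c f = sym (S.*-distribʳ-sum c f)

    sum-empty : (f : Fin zero → ℤ) → ∑ zero f ≡ 0ℤ
    sum-empty f = refl

    sum-step : (f : Fin (suc n) → ℤ) → ∑ (suc n) f ≡ f zero + ∑ n (f ∘ suc)
    sum-step f = refl

  square-nonneg : ∀ i → 0ℤ ≤ i * i
  square-nonneg (+ zero) = ≤-refl
  square-nonneg (+ suc n) = +≤+ ℕ.z≤n
  square-nonneg -[1+ n ] = +≤+ ℕ.z≤n

  *-nonneg : ∀ {i j} → 0ℤ ≤ i → 0ℤ ≤ j → 0ℤ ≤ i * j
  *-nonneg {+ a} {+ b} _ _ = subst (0ℤ ≤_) (pos-* a b) (+≤+ ℕ.z≤n)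

  +-nonneg : ∀ {i j} → 0ℤ ≤ i → 0ℤ ≤ j → 0ℤ ≤ i + j
  +-nonneg p q = +-mono-≤ p q

  ≤⇒0≤- : ∀ {i j} → i ≤ j → 0ℤ ≤ j - i
  ≤⇒0≤- = i≤j⇒0≤j-i

  0≤-⇒≤ : ∀ {i j} → 0ℤ ≤ j - i → i ≤ j
  0≤-⇒≤ = 0≤i-j⇒j≤i

  ≤-from-difference : ∀ {i j d} → 0ℤ ≤ d → j - i ≡ d → i ≤ j
  ≤-from-difference 0≤d e = 0≤-⇒≤ (subst (0ℤ ≤_) (sym e) 0≤d)

  sum-mono-≤ : {f g : Fin n → ℤ} → (∀ i → f i ≤ g i) → ∑ n f ≤ ∑ n g
  sum-mono-≤ {zero} {f} {g} h = ≤-reflexive (trans (sum-empty f) (sym (sum-empty g)))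
  sum-mono-≤ {suc n} {f} {g} h = subst₂ _≤_ (sym (sum-step f)) (sym (sum-step g))
    (+-mono-≤ (h zero) (sum-mono-≤ (h ∘ suc)))

  sum-zero : ∀ n → ∑[ i < n ] 0ℤ ≡ 0ℤ
  sum-zero n = trans (sum-*ˡ {n = n} 0ℤ (λ _ → 0ℤ)) (*-zeroˡ (∑[ i < n ] 0ℤ))

  sum-nonneg : {f : Fin n → ℤ} → (∀ i → 0ℤ ≤ f i) → 0ℤ ≤ ∑ n f
  sum-nonneg {n} {f} h = subst (λ t → t ≤ ∑ n f) (sum-zero n) (sum-mono-≤ h)

  sum-const : ∀ n c → ∑[ i < n ] c ≡ + n * c
  sum-const zero c = trans (sum-empty (λ _ → c)) (sym (*-zeroˡ c))
  sum-const (suc n) c = trans (sum-step (λ _ → c)) (trans (cong (λ t → c + t) (sum-const n c)) (sym (suc-* (+ n) c)))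

  sum-linear₂ : ∀ a b (f g : Fin n → ℤ) → ∑[ i < n ] (a * f i + b * g i) ≡ a * ∑ n f + b * ∑ n g
  sum-linear₂ a b f g = trans (sum-+ _ _) (cong₂ _+_ (sum-*ˡ a f) (sum-*ˡ b g))

  sum-linear₃ : ∀ a b c (f g h : Fin n → ℤ) →
                ∑[ i < n ] (a * f i + b * g i + c * h i) ≡ a * ∑ n f + b * ∑ n g + c * ∑ n h
  sum-linear₃ a b c f g h = trans (sum-+ _ _) (cong₂ _+_ (sum-linear₂ a b f g) (sum-*ˡ c h))

  sum-product : (f : Fin n → ℤ) (g : Fin m → ℤ) → ∑ n f * ∑ m g ≡ ∑[ i < n ] ∑[ j < m ] (f i * g j)
  sum-product f g = trans (sym (sum-*ʳ (∑ _ g) f)) (sum-cong (λ i → sym (sum-*ˡ (f i) g)))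

  -- The scalar product of Bu and Bw written through the Gram matrix BᵀB.
  gram-expansion : (B : Fin n → Fin m → ℤ) (u w : Fin m → ℤ) →
    ∑[ x < n ] ((∑[ y < m ] (B x y * u y)) * (∑[ z < m ] (B x z * w z)))
      ≡ ∑[ y < m ] ∑[ z < m ] (u y * w z * ∑[ x < n ] (B x y * B x z))
  gram-expansion {n} {m} B u w = begin
    ∑[ x < n ] ((∑[ y < m ] (B x y * u y)) * (∑[ z < m ] (B x z * w z)))
      ≡⟨ sum-cong (λ x → sum-product (λ y → B x y * u y) (λ z → B x z * w z)) ⟩
    ∑[ x < n ] ∑[ y < m ] ∑[ z < m ] (B x y * u y * (B x z * w z))
      ≡⟨ sum-swap (λ x y → ∑[ z < m ] (B x y * u y * (B x z * w z))) ⟩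
    ∑[ y < m ] ∑[ x < n ] ∑[ z < m ] (B x y * u y * (B x z * w z))
      ≡⟨ sum-cong (λ y → sum-swap (λ x z → B x y * u y * (B x z * w z))) ⟩
    ∑[ y < m ] ∑[ z < m ] ∑[ x < n ] (B x y * u y * (B x z * w z))
      ≡⟨ sum-cong (λ y → sum-cong (λ z → trans
           (sum-cong (λ x → rearrange (B x y) (u y) (B x z) (w z))) (sum-*ˡ (u y * w z) _))) ⟩
    ∑[ y < m ] ∑[ z < m ] (u y * w z * ∑[ x < n ] (B x y * B x z)) ∎
    where
    open ≡-Reasoning
    rearrange : ∀ a b c d → a * b * (c * d) ≡ b * d * (a * c)
    rearrange = solve-∀

  -- Lagrange's identity: the double sum of the squares (fᵢgⱼ - fⱼgᵢ)² is twice the difference of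
  -- the two sides.
  cauchy-schwarz : (f g : Fin n → ℤ) →
    (∑[ i < n ] (f i * g i)) * (∑[ i < n ] (f i * g i)) ≤ (∑[ i < n ] (f i * f i)) * (∑[ i < n ] (g i * g i))
  cauchy-schwarz {n} f g = halve (≤-from-difference
    (sum-nonneg (λ i → sum-nonneg (λ j → square-nonneg (f i * g j - f j * g i)))) eq)
    where
    open ≡-Reasoning
    P Q : ℤ
    P = (∑[ i < n ] (f i * g i)) * (∑[ i < n ] (f i * g i))
    Q = (∑[ i < n ] (f i * f i)) * (∑[ i < n ] (g i * g i))
    expand : ∀ a b c d → (a * d - c * b) * (a * d - c * b) ≡ (1ℤ * (a * a * (d * d)) + 1ℤ * (b * b * (c * c)) +
      (- (+ 2)) * ((a * b) * (c * d)))
    expand = solve-∀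
    collect : ∀ q p → 1ℤ * q + 1ℤ * q + (- (+ 2)) * p ≡ + 2 * q - + 2 * p
    collect = solve-∀
    total : ∑[ i < n ] ∑[ j < n ] ((f i * g j - f j * g i) * (f i * g j - f j * g i)) ≡ + 2 * Q - + 2 * P
    total = begin
      _ ≡⟨ sum-cong (λ i → trans (sum-cong (λ j → expand (f i) (g i) (f j) (g j)))
             (sum-linear₃ 1ℤ 1ℤ (- (+ 2)) (λ j → f i * f i * (g j * g j)) (λ j → g i * g i * (f j * f j))
               (λ j → f i * g i * (f j * g j)))) ⟩
      _ ≡⟨ sum-linear₃ 1ℤ 1ℤ (- (+ 2)) (λ i → ∑[ j < n ] (f i * f i * (g j * g j)))
        (λ i → ∑[ j < n ] (g i * g i * (f j * f j))) (λ i → ∑[ j < n ] (f i * g i * (f j * g j))) ⟩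
      _ ≡⟨ cong₂ _+_ (cong₂ (λ a b → 1ℤ * a + 1ℤ * b) (sym (sum-product (λ i → f i * f i) (λ i → g i * g i)))
                  (trans (sym (sum-product (λ i → g i * g i) (λ i → f i * f i))) (*-comm (∑[ i < n ] (g i * g i))
                    (∑[ i < n ] (f i * f i)))))
                (cong ((- (+ 2)) *_) (sym (sum-product (λ i → f i * g i) (λ i → f i * g i)))) ⟩
      1ℤ * Q + 1ℤ * Q + (- (+ 2)) * P ≡⟨ collect Q P ⟩
      + 2 * Q - + 2 * P ∎
    eq : + 2 * Q - + 2 * P ≡ ∑[ i < n ] ∑[ j < n ] ((f i * g j - f j * g i) * (f i * g j - f j * g i))
    eq = sym total
    halve : + 2 * P ≤ + 2 * Q → P ≤ Q
    halve = *-cancelˡ-≤-pos P Q (+ 2)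

  𝟙 : Bool → ℤ
  𝟙 b = + bit b

  𝟙-idem : ∀ b → 𝟙 b * 𝟙 b ≡ 𝟙 b
  𝟙-idem true = refl
  𝟙-idem false = refl

  𝟙-∧ : ∀ a b → 𝟙 (a ∧ b) ≡ 𝟙 a * 𝟙 b
  𝟙-∧ true true = refl
  𝟙-∧ true false = refl
  𝟙-∧ false true = refl
  𝟙-∧ false false = refl

  count-sum : (S : Subset n) → + count S ≡ ∑[ x < n ] 𝟙 (S x)
  count-sum {n} S = go n id
    where
    go : ∀ k (f : Fin k → Fin n) → + countIn S (tabulate f) ≡ ∑[ x < k ] 𝟙 (S (f x))
    go zero f = sym (sum-empty _)
    go (suc k) f = trans (trans (cong +_ (countIn-∷ S (f zero) (tabulate (f ∘ suc))))
      (trans (pos-+ (bit (S (f zero))) _) (cong (λ t → 𝟙 (S (f zero)) + t) (go k (f ∘ suc))))) (sym (sum-step _))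

  δ : Fin n → Fin n → ℤ
  δ x y = 𝟙 (does (x FinP.≟ y))

  δ-same : (x : Fin n) → δ x x ≡ 1ℤ
  δ-same x = cong 𝟙 (dec-true (x FinP.≟ x) refl)

  δ-diff : {x y : Fin n} → x ≢ y → δ x y ≡ 0ℤ
  δ-diff {x = x} {y} x≢y = cong 𝟙 (dec-false (x FinP.≟ y) x≢y)

  δ-sym : (x y : Fin n) → δ x y ≡ δ y x
  δ-sym x y with x FinP.≟ y
  ... | yes refl = sym (δ-same x)
  ... | no x≢y = sym (δ-diff (x≢y ∘ sym))

  δ-suc : (x y : Fin n) → δ (suc x) (suc y) ≡ δ x y
  δ-suc x y with x FinP.≟ y
  ... | yes refl = refl
  ... | no _ = refl

  sum-δ : (x : Fin n) (f : Fin n → ℤ) → ∑[ y < n ] (δ x y * f y) ≡ f x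
  sum-δ {suc n} zero f = trans (sum-step _) (trans (cong₂ _+_ (*-identityˡ (f zero))
    (trans (sum-cong (λ i → *-zeroˡ (f (suc i)))) (sum-zero n))) (+-identityʳ (f zero)))
  sum-δ {suc n} (suc x) f = trans (sum-step _) (trans (cong₂ _+_ (*-zeroˡ (f zero))
    (trans (sum-cong (λ y → cong (_* f (suc y)) (δ-suc x y))) (sum-δ x (f ∘ suc)))) (+-identityˡ _))

  term≤sum : {f : Fin n → ℤ} → (∀ i → 0ℤ ≤ f i) → ∀ x → f x ≤ ∑ n f
  term≤sum {f = f} h x = subst (λ t → t ≤ _) (sum-δ x f) (sum-mono-≤ λ y → bound y (does (x FinP.≟ y)))
    where
    bound : ∀ y b → 𝟙 b * f y ≤ f y
    bound y true = ≤-reflexive (*-identityˡ (f y))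
    bound y false = h y

-- The adjacency matrix of a strongly regular graph and its quadratic forms.

module SRG where

  open import Defs
  open FiniteSets using (Subset; bit; ¬true⇒false; count-pos)
  open IntegerSums
  open ChvatalErdos using (module Separation)
  open import Data.Nat as ℕ using (ℕ; suc)
  open import Data.Integer using (ℤ; +_; _+_; _*_; -_; _-_; _≤_; _<_; 0ℤ; 1ℤ; +≤+; +<+)
  open import Data.Integer.Properties as ℤP using (≤-trans; ≤-reflexive; module ≤-Reasoning)
  open import Data.Integer.Tactic.RingSolver using (solve-∀)

  module AdjacencyMatrix {v : ℕ} (G : Graph v) {k ℓ μ : ℕ} (srg : IsStronglyRegular G k ℓ μ) where

    open IsStronglyRegular srg

    A : Fin v → Fin v → ℤ
    A x y = 𝟙 (adj G x y)

    A-sym : ∀ x y → A x y ≡ A y x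
    A-sym x y = cong 𝟙 (symmetric G x y)

    -- Eigenvalues on vectors orthogonal to 1 are roots of X² = τX + κ.
    τ κ : ℤ
    τ = + ℓ - + μ
    κ = + k - + μ

    row-sum : ∀ x → ∑[ y < v ] A x y ≡ + k
    row-sum x = trans (sym (count-sum (λ z → adj G x z))) (cong +_ (regular x))

    codegree-sum : ∀ x y → ∑[ z < v ] (A z x * A z y) ≡ + commonNeighbours G x y
    codegree-sum x y = trans
      (sum-cong (λ z → trans (cong₂ _*_ (A-sym z x) (A-sym z y)) (sym (𝟙-∧ (adj G x z) (adj G y z)))))
      (sym (count-sum (λ z → adj G x z ∧ adj G y z)))

    square : ∀ x y → ∑[ z < v ] (A z x * A z y) ≡ τ * A x y + κ * δ x y + + μ
    square x y with x FinP.≟ y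
    ... | yes refl = begin
        ∑[ z < v ] (A z x * A z x)                ≡⟨ sum-cong (λ z → trans (𝟙-idem (adj G z x)) (A-sym z x)) ⟩
        ∑[ z < v ] A x z                          ≡⟨ row-sum x ⟩
        + k                                       ≡⟨ diagonal (+ k) (+ μ) τ ⟩
        τ * 0ℤ + κ * 1ℤ + + μ                     ≡⟨ cong (λ a → τ * 𝟙 a + κ * 1ℤ + + μ) (irrefl G x) ⟨
        τ * A x x + κ * 1ℤ + + μ                  ∎
      where
      open ≡-Reasoning
      diagonal : ∀ a b t → a ≡ t * 0ℤ + (a - b) * 1ℤ + b
      diagonal = solve-∀
    ... | no x≢y with adj G x y in eq
    ... | true = trans (codegree-sum x y) (trans (cong +_ (adjacentλ x y eq)) (adjacent (+ ℓ) (+ μ) κ))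
      where
      adjacent : ∀ a b d → a ≡ (a - b) * 1ℤ + d * 0ℤ + b
      adjacent = solve-∀
    ... | false = trans (codegree-sum x y) (trans (cong +_ (nonadjμ x y x≢y eq)) (nonadjacent τ κ (+ μ)))
      where
      nonadjacent : ∀ t d b → b ≡ t * 0ℤ + d * 0ℤ + b
      nonadjacent = solve-∀

    infixr 8 A·_
    A·_ : (Fin v → ℤ) → Fin v → ℤ
    (A· u) x = ∑[ y < v ] (A x y * u y)

    total norm² form : (Fin v → ℤ) → ℤ
    total u = ∑ v u
    norm² u = ∑[ x < v ] (u x * u x)
    form u = ∑[ x < v ] (u x * (A· u) x)

    total-A· : ∀ u → total (A· u) ≡ + k * total u
    total-A· u = begin
      ∑[ x < v ] ∑[ y < v ] (A x y * u y)  ≡⟨ sum-swap (λ x y → A x y * u y) ⟩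
      ∑[ y < v ] ∑[ x < v ] (A x y * u y)  ≡⟨ sum-cong (λ y → trans (sum-*ʳ (u y) (λ x → A x y))
                                                (cong (_* u y) (trans (sum-cong (λ x → A-sym x y)) (row-sum y)))) ⟩
      ∑[ y < v ] (+ k * u y)               ≡⟨ sum-*ˡ (+ k) u ⟩
      + k * total u                        ∎
      where open ≡-Reasoning

    -- This is uᵀA²u with A² taken from `square`; the all-ones matrix contributes the squared total.
    norm²-A· : ∀ u → norm² (A· u) ≡ τ * form u + κ * norm² u + + μ * (total u * total u)
    norm²-A· u = begin
      norm² (A· u)
        ≡⟨ gram-expansion A u u ⟩
      ∑[ y < v ] ∑[ z < v ] (u y * u z * ∑[ x < v ] (A x y * A x z))
        ≡⟨ sum-cong (λ y → sum-cong (λ z → trans (cong (u y * u z *_) (square y z))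
             (distribute (u y) (u z) τ κ (+ μ) (A y z) (δ y z)))) ⟩
      ∑[ y < v ] ∑[ z < v ] ((τ * u y) * (A y z * u z) + (κ * u y) * (δ y z * u z) + (+ μ * u y) * u z)
        ≡⟨ sum-cong (λ y → trans (sum-linear₃ (τ * u y) (κ * u y) (+ μ * u y) (λ z → A y z * u z) (λ z → δ y z * u z) u)
             (cong (λ t → (τ * u y) * (A· u) y + (κ * u y) * t + (+ μ * u y) * total u) (sum-δ y u))) ⟩
      ∑[ y < v ] ((τ * u y) * (A· u) y + (κ * u y) * u y + (+ μ * u y) * total u)
        ≡⟨ sum-cong (λ y → reassociate (u y) ((A· u) y) τ κ (+ μ) (total u)) ⟩
      ∑[ y < v ] (τ * (u y * (A· u) y) + κ * (u y * u y) + + μ * (u y * total u))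
        ≡⟨ sum-linear₃ τ κ (+ μ) (λ y → u y * (A· u) y) (λ y → u y * u y) (λ y → u y * total u) ⟩
      τ * form u + κ * norm² u + + μ * (∑[ y < v ] (u y * total u))
        ≡⟨ cong (λ t → τ * form u + κ * norm² u + + μ * t) (sum-*ʳ (total u) u) ⟩
      τ * form u + κ * norm² u + + μ * (total u * total u) ∎
      where
      open ≡-Reasoning
      distribute : ∀ a b t d m e f → a * b * (t * e + d * f + m) ≡ (t * a) * (e * b) + (d * a) * (f * b) + (m * a) * b
      distribute = solve-∀
      reassociate : ∀ a b t d m s → (t * a) * b + (d * a) * a + (m * a) * s ≡ t * (a * b) + d * (a * a) + m * (a * s)
      reassociate = solve-∀

    -- The all-ones vector is an eigenvector of A² = τA + κI + μJ.
    parameter-identity : Fin v → + k * + k ≡ τ * + k + κ + + μ * + v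
    parameter-identity x = begin
      + k * + k                                              ≡⟨ cong (+ k *_) (sym (row-sum x)) ⟩
      + k * ∑[ z < v ] A x z                                 ≡⟨ sum-*ˡ (+ k) (λ z → A x z) ⟨
      ∑[ z < v ] (+ k * A x z)
        ≡⟨ sum-cong (λ z → cong₂ _*_ (sym (row-sum z)) (A-sym x z)) ⟩
      ∑[ z < v ] ((∑[ y < v ] A z y) * A z x)                ≡⟨ sum-cong (λ z → sum-*ʳ (A z x) (A z)) ⟨
      ∑[ z < v ] ∑[ y < v ] (A z y * A z x)                  ≡⟨ sum-swap (λ z y → A z y * A z x) ⟩
      ∑[ y < v ] ∑[ z < v ] (A z y * A z x)                  ≡⟨ sum-cong (λ y → trans (square y x)
                                                                  (cong₂ (λ a e → τ * a + κ * e + + μ) (A-sym y x)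
                                                                    (δ-sym y x))) ⟩
      ∑[ y < v ] (τ * A x y + κ * δ x y + + μ)               ≡⟨ sum-cong (λ y → one (τ * A x y + κ * δ x y) (+ μ)
        (δ x y) κ (τ * A x y)) ⟩
      ∑[ y < v ] (τ * A x y + κ * (δ x y * 1ℤ) + + μ * 1ℤ)   ≡⟨ sum-linear₃ τ κ (+ μ) (A x) (λ y → δ x y * 1ℤ)
        (λ y → 1ℤ) ⟩
      τ * ∑[ y < v ] A x y + κ * ∑[ y < v ] (δ x y * 1ℤ) + + μ * ∑[ y < v ] 1ℤ
        ≡⟨ cong₂ _+_ (cong₂ (λ a b → τ * a + κ * b) (row-sum x) (sum-δ x (λ _ → 1ℤ))) (cong (+ μ *_) (sum-const v 1ℤ)) ⟩
      τ * + k + κ * 1ℤ + + μ * (+ v * 1ℤ)                    ≡⟨ cong₂ (λ a b → τ * + k + a + + μ * b)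
        (ℤP.*-identityʳ κ) (ℤP.*-identityʳ (+ v)) ⟩
      τ * + k + κ + + μ * + v                                ∎
      where
      open ≡-Reasoning
      one : ∀ s m e d t → t + d * e + m ≡ t + d * (e * 1ℤ) + m * 1ℤ
      one = solve-∀

    norm²-shift : ∀ c u → ∑[ x < v ] (((A· u) x + c * u x) * ((A· u) x + c * u x))
                          ≡ norm² (A· u) + (c + c) * form u + c * c * norm² u
    norm²-shift c u = trans (sum-cong (λ x → expand c (u x) ((A· u) x)))
      (trans (sum-linear₃ 1ℤ (c + c) (c * c) (λ x → (A· u) x * (A· u) x) (λ x → u x * (A· u) x) (λ x → u x * u x))
        (cong (λ t → t + (c + c) * form u + c * c * norm² u) (ℤP.*-identityˡ (norm² (A· u)))))
      where
      expand : ∀ c a b → (b + c * a) * (b + c * a) ≡ 1ℤ * (b * b) + (c + c) * (a * b) + c * c * (a * a)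
      expand = solve-∀

    -- The stand-in for the spectral theorem. The expression is ‖(A + c)u‖², and taking -c to be an
    -- eigenvalue gives the bound on Rayleigh quotients by the other eigenvalue or by itself.
    shift-nonneg : ∀ c u → 0ℤ ≤ norm² (A· u) + (c + c) * form u + c * c * norm² u
    shift-nonneg c u = subst (0ℤ ≤_) (norm²-shift c u) (sum-nonneg (λ x → square-nonneg ((A· u) x + c * u x)))

    norm²-nonneg : ∀ u → 0ℤ ≤ norm² u
    norm²-nonneg u = sum-nonneg (λ x → square-nonneg (u x))

    indicator : Subset v → Fin v → ℤ
    indicator S x = 𝟙 (S x)

    total-indicator : ∀ S → total (indicator S) ≡ + count S
    total-indicator S = sym (count-sum S)

    norm²-indicator : ∀ S → norm² (indicator S) ≡ + count S
    norm²-indicator S = trans (sum-cong (λ x → 𝟙-idem (S x))) (total-indicator S)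

    -- Cauchy–Schwarz for the vector (A + c)1_I, whose entries sum to (k + c)|I|.
    independent-bound : ∀ c (I : Subset v) → (∀ {x y} → I x ≡ true → I y ≡ true → adj G x y ≡ true → ⊥) →
      ((+ k + c) * + count I) * ((+ k + c) * + count I) ≤ + v * (κ * + count I + + μ * (+ count I * + count I) + c * c
        * + count I)
    independent-bound c I indep = begin
      ((+ k + c) * a) * ((+ k + c) * a)          ≡⟨ cong (λ t → t * t) (sym total-f) ⟩
      total f * total f                          ≡⟨ cong (λ t → t * t) (sum-cong (λ x → sym (ℤP.*-identityˡ (f x)))) ⟩
      (∑[ x < v ] (1ℤ * f x)) * (∑[ x < v ] (1ℤ * f x)) ≤⟨ cauchy-schwarz (λ _ → 1ℤ) f ⟩
      (∑[ x < v ] (1ℤ * 1ℤ)) * norm² f           ≡⟨ cong₂ _*_ (trans (sum-const v 1ℤ) (ℤP.*-identityʳ (+ v))) norm²-f ⟩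
      + v * (κ * a + + μ * (a * a) + c * c * a)  ∎
      where
      open ≤-Reasoning
      a : ℤ
      a = + count I
      u f : Fin v → ℤ
      u = indicator I
      f x = (A· u) x + c * u x
      total-f : total f ≡ (+ k + c) * a
      total-f = trans (sum-+ (A· u) (λ x → c * u x)) (trans (cong₂ _+_ (total-A· u) (sum-*ˡ c u))
        (trans (cong (λ t → + k * t + c * t) (total-indicator I)) (sym (ℤP.*-distribʳ-+ a (+ k) c))))
      form-zero : form u ≡ 0ℤ
      form-zero = trans (sum-cong (λ x → trans (sym (sum-*ˡ (u x) (λ y → A x y * u y)))
        (trans (sum-cong (λ y → vanish x y)) (sum-zero v)))) (sum-zero v)
        where
        vanish : ∀ x y → u x * (A x y * u y) ≡ 0ℤ
        vanish x y with I x in ex | adj G x y in ea | I y in ey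
        ... | false | _ | _ = refl
        ... | true | false | _ = refl
        ... | true | true | false = refl
        ... | true | true | true = ⊥-elim (indep ex ey ea)
      simplify : ∀ t b d m e → t * 0ℤ + d * b + m * (b * b) + (e + e) * 0ℤ + e * e * b ≡ d * b + m * (b * b) + e * e * b
      simplify = solve-∀
      norm²-f : norm² f ≡ κ * a + + μ * (a * a) + c * c * a
      norm²-f = trans (norm²-shift c u) (trans (cong (λ t → t + (c + c) * form u + c * c * norm² u) (norm²-A· u))
        (trans (cong (λ q → τ * q + κ * norm² u + + μ * (total u * total u) + (c + c) * q + c * c * norm² u) form-zero)
        (trans (cong₂ (λ n t → τ * 0ℤ + κ * n + + μ * (t * t) + (c + c) * 0ℤ + c * c * n) (norm²-indicator I)
          (total-indicator I))
          (simplify τ a κ (+ μ) c))))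

    -- On a separator, the vector |F|·1_H − |H|·1_F has Rayleigh quotient at least k − |S|,
    -- since every vertex of H (of F) has at least k − |S| neighbours in H (in F).
    module SeparatorVector (sep : Separation.Separator G) where

      open Separation.Separator sep

      a b s : ℤ
      a = + count H
      b = + count F
      s = + count S

      w : Fin v → ℤ
      w x = b * 𝟙 (H x) - a * 𝟙 (F x)

      total-w : total w ≡ 0ℤ
      total-w = trans (sum-cong (λ x → minus b a (𝟙 (H x)) (𝟙 (F x))))
        (trans (sum-linear₂ b (- a) (indicator H) (indicator F))
        (trans (cong₂ (λ p q → b * p + (- a) * q) (total-indicator H) (total-indicator F)) (cancel a b)))
        where
        minus : ∀ b a p q → b * p - a * q ≡ b * p + (- a) * q
        minus = solve-∀
        cancel : ∀ a b → b * a + (- a) * b ≡ 0ℤ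
        cancel = solve-∀

      w-H : ∀ {x} → H x ≡ true → w x ≡ b
      w-H {x} hx with F x in fx
      ... | true = ⊥-elim (H∩F x hx fx)
      ... | false = trans (cong (λ t → b * 𝟙 t - a * 0ℤ) hx) (value b a)
        where
        value : ∀ b a → b * 1ℤ - a * 0ℤ ≡ b
        value = solve-∀

      w-F : ∀ {x} → F x ≡ true → w x ≡ - a
      w-F {x} fx with H x in hx
      ... | true = ⊥-elim (H∩F x hx fx)
      ... | false = trans (cong (λ t → b * 0ℤ - a * 𝟙 t) fx) (value b a)
        where
        value : ∀ b a → b * 0ℤ - a * 1ℤ ≡ - a
        value = solve-∀

      w-S : ∀ {x} → S x ≡ true → w x ≡ 0ℤ
      w-S {x} sx with H x in hx | F x in fx
      ... | true | _ = ⊥-elim (S∩H x sx hx)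
      ... | false | true = ⊥-elim (S∩F x sx fx)
      ... | false | false = value b a
        where
        value : ∀ b a → b * 0ℤ - a * 0ℤ ≡ 0ℤ
        value = solve-∀

      -- Each of the k neighbours of x contributes c, apart from those in `S`, which contribute 0;
      -- at most |S| terms are lost.
      neighbours-bound : ∀ x c u → 0ℤ ≤ c →
        (∀ y → adj G x y ≡ false ⊎ u y ≡ c ⊎ (S y ≡ true × u y ≡ 0ℤ)) → c * (+ k - s) ≤ (A· u) x
      neighbours-bound x c u c≥0 h = subst (_≤ (A· u) x) eq (sum-mono-≤ λ y → pointwise y (h y))
        where
        minus : ∀ p q → p - q ≡ 1ℤ * p + (- 1ℤ) * q
        minus = solve-∀
        eq : ∑[ y < v ] (c * (A x y - 𝟙 (S y))) ≡ c * (+ k - s)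
        eq = trans (sum-*ˡ c (λ y → A x y - 𝟙 (S y))) (cong (c *_) (trans (sum-cong (λ y → minus (A x y) (𝟙 (S y))))
          (trans (sum-linear₂ 1ℤ (- 1ℤ) (A x) (indicator S)) (trans (cong₂ (λ p q → 1ℤ * p + (- 1ℤ) * q) (row-sum x)
            (total-indicator S)) (sym (minus (+ k) s))))))
        drop : ∀ p q → c * (p - 𝟙 q) ≤ c * p
        drop p q = ≤-from-difference (*-nonneg c≥0 (+≤+ (ℕ.z≤n {bit q}))) (value c p (𝟙 q))
          where
          value : ∀ c p q → c * p - c * (p - q) ≡ c * q
          value = solve-∀
        nonpos : ∀ p → c * (𝟙 p - 1ℤ) ≤ 0ℤ
        nonpos true = ≤-reflexive (ℤP.*-zeroʳ c)
        nonpos false = ≤-from-difference c≥0 (value c)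
          where
          value : ∀ c → 0ℤ - c * (0ℤ - 1ℤ) ≡ c
          value = solve-∀
        pointwise : ∀ y → adj G x y ≡ false ⊎ u y ≡ c ⊎ (S y ≡ true × u y ≡ 0ℤ) → c * (A x y - 𝟙 (S y)) ≤ A x y * u y
        pointwise y (inj₁ e) = subst (λ t → c * (𝟙 t - 𝟙 (S y)) ≤ 𝟙 t * u y) (sym e)
          (≤-trans (drop 0ℤ (S y)) (≤-reflexive (trans (ℤP.*-zeroʳ c) (sym (ℤP.*-zeroˡ (u y))))))
        pointwise y (inj₂ (inj₁ e)) = subst (λ t → c * (A x y - 𝟙 (S y)) ≤ A x y * t) (sym e)
          (≤-trans (drop (A x y) (S y)) (≤-reflexive (ℤP.*-comm c (A x y))))
        pointwise y (inj₂ (inj₂ (sy , e))) = subst₂ (λ t t′ → c * (A x y - 𝟙 t) ≤ A x y * t′) (sym sy) (sym e)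
          (≤-trans (nonpos (adj G x y)) (≤-reflexive (sym (ℤP.*-zeroʳ (A x y)))))

      bound-H : ∀ {x} → H x ≡ true → b * (+ k - s) ≤ (A· w) x
      bound-H {x} hx = neighbours-bound x b w (+≤+ ℕ.z≤n) λ y → side y (cover y)
        where
        side : ∀ y → H y ≡ true ⊎ F y ≡ true ⊎ S y ≡ true → adj G x y ≡ false ⊎ w y ≡ b ⊎ (S y ≡ true × w y ≡ 0ℤ)
        side y (inj₁ hy) = inj₂ (inj₁ (w-H hy))
        side y (inj₂ (inj₁ fy)) = inj₁ (¬true⇒false (separated hx fy))
        side y (inj₂ (inj₂ sy)) = inj₂ (inj₂ (sy , w-S sy))

      bound-F : ∀ {x} → F x ≡ true → a * (+ k - s) ≤ - (A· w) x
      bound-F {x} fx = subst (a * (+ k - s) ≤_) A·-neg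
        (neighbours-bound x a (λ y → - w y) (+≤+ ℕ.z≤n) λ y → side y (cover y))
        where
        A·-neg : (A· (λ y → - w y)) x ≡ - (A· w) x
        A·-neg = trans (sum-cong (λ y → neg (A x y) (w y))) (trans (sum-*ˡ (- 1ℤ) (λ y → A x y * w y)) (ℤP.-1*i≡-i _))
          where
          neg : ∀ p q → p * (- q) ≡ (- 1ℤ) * (p * q)
          neg = solve-∀
        side : ∀ y → H y ≡ true ⊎ F y ≡ true ⊎ S y ≡ true → adj G x y ≡ false ⊎ - w y ≡ a ⊎ (S y ≡ true × - w y ≡ 0ℤ)
        side y (inj₁ hy) = inj₁ (¬true⇒false (λ e → separated hy fx (trans (symmetric G y x) e)))
        side y (inj₂ (inj₁ fy)) = inj₂ (inj₁ (trans (cong -_ (w-F fy)) (ℤP.neg-involutive a)))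
        side y (inj₂ (inj₂ sy)) = inj₂ (inj₂ (sy , cong -_ (w-S sy)))

      rayleigh : (+ k - s) * norm² w ≤ form w
      rayleigh = subst (_≤ form w) (sum-*ˡ (+ k - s) (λ x → w x * w x)) (sum-mono-≤ λ x → pointwise x (cover x))
        where
        square-b : ∀ b d → d * (b * b) ≡ b * (b * d)
        square-b = solve-∀
        square-a : ∀ a d → d * ((- a) * (- a)) ≡ a * (a * d)
        square-a = solve-∀
        flip : ∀ a t → a * (- t) ≡ (- a) * t
        flip = solve-∀
        pointwise : ∀ x → H x ≡ true ⊎ F x ≡ true ⊎ S x ≡ true → (+ k - s) * (w x * w x) ≤ w x * (A· w) x
        pointwise x (inj₁ hx) = subst (λ t → (+ k - s) * (t * t) ≤ t * (A· w) x) (sym (w-H hx))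
          (≤-trans (≤-reflexive (square-b b (+ k - s))) (ℤP.*-monoˡ-≤-nonNeg b (bound-H hx)))
        pointwise x (inj₂ (inj₁ fx)) = subst (λ t → (+ k - s) * (t * t) ≤ t * (A· w) x) (sym (w-F fx))
          (≤-trans (≤-reflexive (square-a a (+ k - s)))
            (≤-trans (ℤP.*-monoˡ-≤-nonNeg a (bound-F fx)) (≤-reflexive (flip a ((A· w) x)))))
        pointwise x (inj₂ (inj₂ sx)) = subst (λ t → (+ k - s) * (t * t) ≤ t * (A· w) x) (sym (w-S sx))
          (≤-reflexive (trans (ℤP.*-zeroʳ (+ k - s)) (sym (ℤP.*-zeroˡ ((A· w) x)))))

      norm²-positive : 0ℤ < norm² w
      norm²-positive = ℤP.<-≤-trans (subst (λ t → 0ℤ < t * t) (sym (w-H h∈H)) (b-square (count F) (count-pos F f f∈F)))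
        (term≤sum (λ x → square-nonneg (w x)) h)
        where
        b-square : ∀ n → 1 ℕ.≤ n → 0ℤ < + n * + n
        b-square (suc n) _ = +<+ (ℕ.s≤s ℕ.z≤n)

-- The ring generated by a root of X² = τX + κ.

module QuadraticIntegers where

  open import Algebra.Bundles using (CommutativeRing)
  open import Algebra.Structures using (IsCommutativeRing)
  open import Level using (0ℓ)
  open import Data.Nat as ℕ using (ℕ; zero; suc)
  open import Data.Nat.Induction using (<-wellFounded)
  open import Induction.WellFounded using (Acc; acc)
  open import Data.Integer using (ℤ; +_; -[1+_]; _+_; _*_; -_; _-_; 0ℤ; 1ℤ; _≟_)
  open import Data.Integer.DivMod using (_/ℕ_; _%ℕ_; a≡a%ℕn+[a/ℕn]*n; n%ℕd<d)
  import Data.Integer.Properties as ℤP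
  open import Data.Integer.Tactic.RingSolver using (solve-∀)
  open import Data.Product.Properties using (≡-dec)

  *-cancelˡ-0 : ∀ {i j} → i ≢ 0ℤ → i * j ≡ 0ℤ → j ≡ 0ℤ
  *-cancelˡ-0 {i} i≢0 e with ℤP.i*j≡0⇒i≡0∨j≡0 i e
  ... | inj₁ z = ⊥-elim (i≢0 z)
  ... | inj₂ z = z

  -- The ring ℤ[ρ] with ρ² = τρ + κ; the pair (a , b) stands for a + bρ.
  module _ (τ κ : ℤ) where

    infixl 6 _⊕_
    infixl 7 _⊗_

    _⊕_ _⊗_ : ℤ × ℤ → ℤ × ℤ → ℤ × ℤ
    (a , b) ⊕ (c , d) = a + c , b + d
    (a , b) ⊗ (c , d) = a * c + κ * (b * d) , a * d + b * c + τ * (b * d)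

    ⊖_ : ℤ × ℤ → ℤ × ℤ
    ⊖ (a , b) = - a , - b

    isCommutativeRing : IsCommutativeRing _≡_ _⊕_ _⊗_ ⊖_ (0ℤ , 0ℤ) (1ℤ , 0ℤ)
    isCommutativeRing = record
      { isRing = record
        { +-isAbelianGroup = record
          { isGroup = record
            { isMonoid = record
              { isSemigroup = record
                { isMagma = record { isEquivalence = isEquivalence ; ∙-cong = cong₂ _⊕_ }
                ; assoc = λ { (a , b) (c , d) (e , f) → cong₂ _,_ (ℤP.+-assoc a c e) (ℤP.+-assoc b d f) } }
              ; identity = (λ { (a , b) → cong₂ _,_ (ℤP.+-identityˡ a) (ℤP.+-identityˡ b) })
                         , (λ { (a , b) → cong₂ _,_ (ℤP.+-identityʳ a) (ℤP.+-identityʳ b) }) }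
            ; inverse = (λ { (a , b) → cong₂ _,_ (ℤP.+-inverseˡ a) (ℤP.+-inverseˡ b) })
                      , (λ { (a , b) → cong₂ _,_ (ℤP.+-inverseʳ a) (ℤP.+-inverseʳ b) })
            ; ⁻¹-cong = cong ⊖_ }
          ; comm = λ { (a , b) (c , d) → cong₂ _,_ (ℤP.+-comm a c) (ℤP.+-comm b d) } }
        ; *-cong = cong₂ _⊗_
        ; *-assoc = λ { (a , b) (c , d) (e , f) → cong₂ _,_ (assoc₁ a b c d e f τ κ) (assoc₂ a b c d e f τ κ) }
        ; *-identity = (λ { (a , b) → cong₂ _,_ (identityˡ₁ a b κ) (identityˡ₂ a b τ) })
                     , (λ { (a , b) → cong₂ _,_ (identityʳ₁ a b κ) (identityʳ₂ a b τ) })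
        ; distrib = (λ { (a , b) (c , d) (e , f) → cong₂ _,_ (distribˡ₁ a b c d e f κ) (distribˡ₂ a b c d e f τ) })
                  , (λ { (a , b) (c , d) (e , f) → cong₂ _,_ (distribʳ₁ a b c d e f κ) (distribʳ₂ a b c d e f τ) }) }
      ; *-comm = λ { (a , b) (c , d) → cong₂ _,_ (comm₁ a b c d κ) (comm₂ a b c d τ) } }
      where
      assoc₁ : ∀ a b c d e f t k → (a * c + k * (b * d)) * e + k * ((a * d + b * c + t * (b * d)) * f)
                                 ≡ a * (c * e + k * (d * f)) + k * (b * (c * f + d * e + t * (d * f)))
      assoc₁ = solve-∀
      assoc₂ : ∀ a b c d e f t k → (a * c + k * (b * d)) * f + (a * d + b * c + t * (b * d)) * e + t *
        ((a * d + b * c + t * (b * d)) * f)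
                                 ≡ a * (c * f + d * e + t * (d * f)) + b * (c * e + k * (d * f)) + t *
                                   (b * (c * f + d * e + t * (d * f)))
      assoc₂ = solve-∀
      identityˡ₁ : ∀ a b k → 1ℤ * a + k * (0ℤ * b) ≡ a
      identityˡ₁ = solve-∀
      identityˡ₂ : ∀ a b t → 1ℤ * b + 0ℤ * a + t * (0ℤ * b) ≡ b
      identityˡ₂ = solve-∀
      identityʳ₁ : ∀ a b k → a * 1ℤ + k * (b * 0ℤ) ≡ a
      identityʳ₁ = solve-∀
      identityʳ₂ : ∀ a b t → a * 0ℤ + b * 1ℤ + t * (b * 0ℤ) ≡ b
      identityʳ₂ = solve-∀
      distribˡ₁ : ∀ a b c d e f k → a * (c + e) + k * (b * (d + f)) ≡ a * c + k * (b * d) + (a * e + k * (b * f))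
      distribˡ₁ = solve-∀
      distribˡ₂ : ∀ a b c d e f t → a * (d + f) + b * (c + e) + t * (b * (d + f))
                                  ≡ a * d + b * c + t * (b * d) + (a * f + b * e + t * (b * f))
      distribˡ₂ = solve-∀
      distribʳ₁ : ∀ a b c d e f k → (c + e) * a + k * ((d + f) * b) ≡ c * a + k * (d * b) + (e * a + k * (f * b))
      distribʳ₁ = solve-∀
      distribʳ₂ : ∀ a b c d e f t → (c + e) * b + (d + f) * a + t * ((d + f) * b)
                                  ≡ c * b + d * a + t * (d * b) + (e * b + f * a + t * (f * b))
      distribʳ₂ = solve-∀
      comm₁ : ∀ a b c d k → a * c + k * (b * d) ≡ c * a + k * (d * b)
      comm₁ = solve-∀
      comm₂ : ∀ a b c d t → a * d + b * c + t * (b * d) ≡ c * b + d * a + t * (d * b)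
      comm₂ = solve-∀

    ℤ[ρ] : CommutativeRing 0ℓ 0ℓ
    ℤ[ρ] = record { isCommutativeRing = isCommutativeRing }

    -- Descent on the denominator: if x = a/b is a root, so is the same x written with
    -- denominator b·(x − ⌊x⌋) = a mod b.
    rational-root⇒integer-root : ∀ n → Acc ℕ._<_ n → ∀ a → n ≢ 0 → a * a ≡ τ * (a * + n) + κ * (+ n * + n) →
                                 ∃ λ t → t * t ≡ τ * t + κ
    rational-root⇒integer-root zero _ a n≢0 e = ⊥-elim (n≢0 refl)
    rational-root⇒integer-root (suc n) (acc rs) a _ e with a %ℕ suc n in eq
    ... | r with a≡a%ℕn+[a/ℕn]*n a (suc n) | n%ℕd<d a (suc n)
    ... | division | r<b rewrite eq = root r refl
      where
      b q : ℤ
      b = + suc n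
      q = a /ℕ suc n
      b²-cancel : ∀ {i j} → b * b * i ≡ b * b * j → i ≡ j
      b²-cancel {i} {j} = ℤP.*-cancelˡ-≡ (b * b) i j
      root : ∀ r′ → r ≡ r′ → ∃ λ t → t * t ≡ τ * t + κ
      root zero refl = q , b²-cancel (trans (scale b q) (trans (subst (λ a → a * a ≡ τ * (a * b) + κ * (b * b))
        (trans division (ℤP.+-identityˡ (q * b))) e) (unscale b q τ κ)))
        where
        scale : ∀ b q → b * b * (q * q) ≡ q * b * (q * b)
        scale = solve-∀
        unscale : ∀ b q t k → t * (q * b * b) + k * (b * b) ≡ b * b * (t * q + k)
        unscale = solve-∀
      root (suc r″) refl = rational-root⇒integer-root r (rs r<b) a₁ (λ ()) (b²-cancel eq₁)
        where
        a₁ : ℤ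
        a₁ = τ * a + κ * b - q * a
        rem : + r ≡ a - q * b
        rem = trans (add (+ r) (q * b)) (cong (_- q * b) (sym division))
          where
          add : ∀ r s → r ≡ r + s - s
          add = solve-∀
        proportion : a₁ * b ≡ + r * a
        proportion = trans (split a b q τ κ) (trans (cong (_- q * a * b) (sym e))
          (trans (factor a b q) (cong (_* a) (sym rem))))
          where
          split : ∀ a b q t k → (t * a + k * b - q * a) * b ≡ t * (a * b) + k * (b * b) - q * a * b
          split = solve-∀
          factor : ∀ a b q → a * a - q * a * b ≡ (a - q * b) * a
          factor = solve-∀
        eq₁ : b * b * (a₁ * a₁) ≡ b * b * (τ * (a₁ * + r) + κ * (+ r * + r))
        eq₁ = trans (regroup a₁ b) (trans (cong (λ t → t * t) proportion)
          (trans (square (+ r) a) (trans (cong (+ r * + r *_) e) (trans (regroup′ (+ r) a b τ κ)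
            (trans (cong (λ t → τ * (t * (+ r * b)) + κ * (+ r * + r * (b * b))) (sym proportion))
              (regroup″ (+ r) a₁ b τ κ))))))
          where
          regroup : ∀ c b → b * b * (c * c) ≡ c * b * (c * b)
          regroup = solve-∀
          square : ∀ r a → r * a * (r * a) ≡ r * r * (a * a)
          square = solve-∀
          regroup′ : ∀ r a b t k → r * r * (t * (a * b) + k * (b * b)) ≡ t * (r * a * (r * b)) + k * (r * r * (b * b))
          regroup′ = solve-∀
          regroup″ : ∀ r c b t k → t * (c * b * (r * b)) + k * (r * r * (b * b)) ≡ b * b * (t * (c * r) + k * (r * r))
          regroup″ = solve-∀

    module _ (no-root : ∀ t → t * t ≡ τ * t + κ → ⊥) where

      -- The product of a + bρ and its conjugate a + b(τ - ρ).
      norm : ℤ × ℤ → ℤ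
      norm (a , b) = a * a + τ * (a * b) - κ * (b * b)

      -- If the norm of a + bρ vanishes and b ≠ 0, then -a/b is a rational root of the quadratic,
      -- and descent turns it into an integer root. The sign of b decides which fraction with
      -- positive denominator is used.
      norm≢0 : ∀ x → x ≢ (0ℤ , 0ℤ) → norm x ≢ 0ℤ
      norm≢0 (a , b) x≢0 e with b ≟ 0ℤ
      ... | yes refl with ℤP.i*j≡0⇒i≡0∨j≡0 a (trans (reduce a τ κ) e)
        where
        reduce : ∀ a t k → a * a ≡ a * a + t * (a * 0ℤ) - k * (0ℤ * 0ℤ)
        reduce = solve-∀
      ... | inj₁ refl = x≢0 refl
      ... | inj₂ refl = x≢0 refl
      norm≢0 (a , b) x≢0 e | no b≢0 with b in eq
      ... | + n = case-root (- a) n (λ { refl → b≢0 refl }) (to-root a (+ n) τ κ e)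
        where
        case-root : ∀ a n → n ≢ 0 → a * a ≡ τ * (a * + n) + κ * (+ n * + n) → ⊥
        case-root a n n≢0 e′ = let t , r = rational-root⇒integer-root n (<-wellFounded n) a n≢0 e′ in no-root t r
        to-root : ∀ a b t k → a * a + t * (a * b) - k * (b * b) ≡ 0ℤ → (- a) * (- a) ≡ t * ((- a) * b) + k * (b * b)
        to-root a b t k e = trans (expand a b t k) (trans (cong (_+ (t * ((- a) * b) + k * (b * b))) e)
          (ℤP.+-identityˡ _))
          where
          expand : ∀ a b t k → (- a) * (- a) ≡ a * a + t * (a * b) - k * (b * b) + (t * ((- a) * b) + k * (b * b))
          expand = solve-∀
      ... | -[1+ n ] = let t , r = rational-root⇒integer-root (suc n) (<-wellFounded (suc n)) a (λ ()) (to-root a (+ suc n) τ κ e) in no-root t r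
        where
        to-root : ∀ a b t k → a * a + t * (a * (- b)) - k * ((- b) * (- b)) ≡ 0ℤ → a * a ≡ t * (a * b) + k * (b * b)
        to-root a b t k e = trans (expand a b t k) (trans (cong (_+ (t * (a * b) + k * (b * b))) e) (ℤP.+-identityˡ _))
          where
          expand : ∀ a b t k → a * a ≡ a * a + t * (a * (- b)) - k * ((- b) * (- b)) + (t * (a * b) + k * (b * b))
          expand = solve-∀

      ⊗-cancel : ∀ {x y} → x ≢ (0ℤ , 0ℤ) → x ⊗ y ≡ (0ℤ , 0ℤ) → y ≡ (0ℤ , 0ℤ)
      ⊗-cancel {x@(a , b)} {c , d} x≢0 e = cong₂ _,_
        (*-cancelˡ-0 (norm≢0 x x≢0) (trans (first a b c d τ κ) (vanish₁ (cong proj₁ e) (cong proj₂ e))))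
        (*-cancelˡ-0 (norm≢0 x x≢0) (trans (second a b c d τ κ) (vanish₂ (cong proj₁ e) (cong proj₂ e))))
        where
        -- Multiplying by the conjugate (a + τb) − bρ.
        first : ∀ a b c d t k → (a * a + t * (a * b) - k * (b * b)) * c
              ≡ (a + t * b) * (a * c + k * (b * d)) - k * (b * (a * d + b * c + t * (b * d)))
        first = solve-∀
        second : ∀ a b c d t k → (a * a + t * (a * b) - k * (b * b)) * d
               ≡ a * (a * d + b * c + t * (b * d)) - b * (a * c + k * (b * d))
        second = solve-∀
        vanish₁ : ∀ {p q} → p ≡ 0ℤ → q ≡ 0ℤ → (a + τ * b) * p - κ * (b * q) ≡ 0ℤ
        vanish₁ refl refl = zero₁ (a + τ * b) κ b
          where
          zero₁ : ∀ s k b → s * 0ℤ - k * (b * 0ℤ) ≡ 0ℤ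
          zero₁ = solve-∀
        vanish₂ : ∀ {p q} → p ≡ 0ℤ → q ≡ 0ℤ → a * q - b * p ≡ 0ℤ
        vanish₂ refl refl = zero₂ a b
          where
          zero₂ : ∀ a b → a * 0ℤ - b * 0ℤ ≡ 0ℤ
          zero₂ = solve-∀

      zero? : ∀ x → Dec (x ≡ (0ℤ , 0ℤ))
      zero? x = ≡-dec _≟_ _≟_ x (0ℤ , 0ℤ)

-- Irrational eigenvalues force conference parameters.

module Eigenvalues where

  open import Defs
  open FiniteSets using (∈-elems⁻¹; elems; elems-unique; length-≤-count; count-mono; ∧-trueˡ; ∧-trueʳ; true≢false)
  open IntegerSums
  open SRG
  open TraceOfIdempotent using (trace-of-scaled-idempotent)
  open QuadraticIntegers
  open import Algebra.Bundles using (CommutativeRing)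
  open import Data.Nat as ℕ using (ℕ; zero; suc)
  open import Data.Integer using (ℤ; +_; _+_; _*_; -_; _-_; _≤_; _<_; 0ℤ; 1ℤ; +<+; positive)
  import Data.Integer.Properties as ℤP
  open import Data.Integer.Tactic.RingSolver using (solve-∀)
  open import Data.List.Relation.Unary.All using (tabulate)

  *-cancel-pos-≤ : ∀ {c i j} → 0ℤ < c → c * i ≤ c * j → i ≤ j
  *-cancel-pos-≤ {c} {i} {j} p h = ℤP.*-cancelˡ-≤-pos i j c {{positive p}} h

  *-cancel-pos-nonneg : ∀ {c i} → 0ℤ < c → 0ℤ ≤ c * i → 0ℤ ≤ i
  *-cancel-pos-nonneg {c} {i} p h = *-cancel-pos-≤ p (subst (_≤ c * i) (sym (ℤP.*-zeroʳ c)) h)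

  *-pos : ∀ {i j} → 0ℤ < i → 0ℤ < j → 0ℤ < i * j
  *-pos {+ suc m} {+ suc n} _ _ = +<+ (ℕ.s≤s ℕ.z≤n)
  *-pos {+ suc m} {+ zero} _ (+<+ ())
  *-pos {+ zero} (+<+ ())

  pos-nonneg : ∀ {i} → 0ℤ ≤ i → 0ℤ < 1ℤ + i
  pos-nonneg {+ n} _ = +<+ (ℕ.s≤s ℕ.z≤n)

  ¬0≤neg : ∀ {i} → 0ℤ < i → 0ℤ ≤ - i → ⊥
  ¬0≤neg {+ suc n} _ ()
  ¬0≤neg {+ zero} (+<+ ()) _

  module Parameters {v : ℕ} (G : Graph v) {k ℓ μ : ℕ} (srg : IsStronglyRegular G k ℓ μ) where

    open IsStronglyRegular srg
    open AdjacencyMatrix G srg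

    μ≤k : μ ℕ.≤ k
    μ≤k with notComplete
    ... | x , y , x≢y , e = subst₂ ℕ._≤_ (nonadjμ x y x≢y e) (regular x)
      (count-mono (λ z → adj G x z ∧ adj G y z) (adj G x) (λ z → ∧-trueˡ (adj G x z)))

    ℓ<k : ℓ ℕ.< k
    ℓ<k with notEmpty
    ... | x , y , e = subst₂ ℕ._<_ (adjacentλ x y e) (regular x)
      (length-≤-count (adj G x) (tabulate fresh ∷ elems-unique C) λ { z (here refl) → e ; z (there z∈) → ∧-trueˡ
        (adj G x z) (∈-elems⁻¹ C z∈) })
      where
      C = λ z → adj G x z ∧ adj G y z
      fresh : ∀ {z} → z ∈ elems C → y ≢ z
      fresh z∈ refl = true≢false (∧-trueʳ (adj G x y) (∈-elems⁻¹ C z∈)) (irrefl G y)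

    -- If the quadratic X² − τX − κ has no integer root, the trace of the projection
    -- (A − ρ) − (k−ρ)/v·J onto an eigenspace is a natural number only when its ρ-part vanishes.
    irrational⇒conference : (∀ t → t * t ≡ τ * t + κ → ⊥) → ∃ λ t → + k ≡ + t * (+ μ - + ℓ) × + v ≡ 1ℤ + (+ t + + t)
    irrational⇒conference no-root = t , k-eq , v-eq
      where
      x₀ : Fin v
      x₀ = proj₁ notEmpty
      open CommutativeRing (ℤ[ρ] τ κ) using (semiring; Carrier)
      open import Algebra.Properties.Semiring.Sum semiring using (sum)
      open import Algebra.Properties.Semiring.Mult semiring using () renaming (_×_ to _×ʳ_)
      sum-pairs : ∀ n (f : Fin n → Carrier) → sum f ≡ (∑ n (proj₁ ∘ f) , ∑ n (proj₂ ∘ f))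
      sum-pairs zero f = cong₂ _,_ (sym (sum-empty _)) (sym (sum-empty _))
      sum-pairs (suc n) f = trans (cong (_⊕_ τ κ (f zero)) (sum-pairs n (f ∘ suc))) (cong₂ _,_ (sym (sum-step _))
        (sym (sum-step _)))
      K V : ℤ
      K = + k
      V = + v
      p q : Fin v → Fin v → ℤ
      p x y = V * A x y - K
      q x y = 1ℤ - V * δ x y
      -- In ring notation this is v(A - ρ) - (k - ρ)J, the matrix of the projection argument with
      -- its denominator v cleared.
      M : Fin v → Fin v → Carrier
      M x y = p x y , q x y
      -- This is v(ρ̄ - ρ), where ρ̄ = τ - ρ is the conjugate root: the value of v(A - ρ) on the
      -- eigenspace of ρ̄.
      c : Carrier
      c = V * τ , - (V + V)
      V≢0 : V ≢ 0ℤ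
      V≢0 = inhabited x₀
        where
        inhabited : ∀ {n} → Fin n → + n ≢ 0ℤ
        inhabited {suc n} _ ()
      c≢0 : c ≢ (0ℤ , 0ℤ)
      c≢0 e = V≢0 (halve v (cong proj₂ e))
        where
        halve : ∀ n → - (+ n + + n) ≡ 0ℤ → + n ≡ 0ℤ
        halve zero _ = refl
      pp : ∀ x y → ∑[ z < v ] (p x z * p z y) ≡ V * V * (τ * A x y + κ * δ x y + + μ) - V * K * K
      pp x y = begin
        _ ≡⟨ sum-cong (λ z → trans (cong (λ a → (V * a - K) * p z y) (A-sym x z)) (expand V K (A z x) (A z y))) ⟩
        ∑[ z < v ] (V * V * (A z x * A z y) + (- (V * K)) * A z x + ((- (V * K)) * A z y + K * K * 1ℤ))
          ≡⟨ sum-+ _ _ ⟩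
        _ ≡⟨ cong₂ _+_ (sum-linear₂ (V * V) (- (V * K)) (λ z → A z x * A z y) (λ z → A z x)) (sum-linear₂ (- (V * K))
          (K * K) (λ z → A z y) (λ _ → 1ℤ)) ⟩
        V * V * ∑[ z < v ] (A z x * A z y) + (- (V * K)) * ∑[ z < v ] A z x + ((- (V * K)) * ∑[ z < v ] A z y + K * K
          * ∑[ z < v ] 1ℤ)
          ≡⟨ cong₂ _+_ (cong₂ (λ a b → V * V * a + (- (V * K)) * b) (square x y) (col x))
            (cong₂ (λ a b → (- (V * K)) * a + K * K * b) (col y) (sum-const v 1ℤ)) ⟩
        _ ≡⟨ simplify V K (τ * A x y + κ * δ x y + + μ) ⟩
        _ ∎
        where
        open ≡-Reasoning
        col : ∀ x → ∑[ z < v ] A z x ≡ K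
        col x = trans (sum-cong (λ z → A-sym z x)) (row-sum x)
        expand : ∀ V K a b → (V * a - K) * (V * b - K) ≡ V * V * (a * b) + (- (V * K)) * a + ((- (V * K)) * b + K * K
          * 1ℤ)
        expand = solve-∀
        simplify : ∀ V K m → V * V * m + (- (V * K)) * K + ((- (V * K)) * K + K * K * (V * 1ℤ)) ≡ V * V * m - V * K * K
        simplify = solve-∀
      δ-total : ∀ x → ∑[ z < v ] δ x z ≡ 1ℤ
      δ-total x = trans (sum-cong (λ z → sym (ℤP.*-identityʳ (δ x z)))) (sum-δ x (λ _ → 1ℤ))
      sum-q : ∀ (f : Fin v → ℤ) y → ∑[ z < v ] (f z * q z y) ≡ ∑ v f - V * f y
      sum-q f y = trans (sum-cong (λ z → trans (cong (λ d → f z * (1ℤ - V * d)) (δ-sym z y)) (expand (f z) V (δ y z))))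
        (trans (sum-linear₂ 1ℤ (- V) f (λ z → δ y z * f z))
          (trans (cong (λ t → 1ℤ * ∑ v f + (- V) * t) (sum-δ y f)) (simplify (∑ v f) V (f y))))
        where
        expand : ∀ a V d → a * (1ℤ - V * d) ≡ 1ℤ * a + (- V) * (d * a)
        expand = solve-∀
        simplify : ∀ s V a → 1ℤ * s + (- V) * a ≡ s - V * a
        simplify = solve-∀
      sum-p : ∀ x → ∑[ z < v ] p x z ≡ 0ℤ
      sum-p x = trans (sum-cong (λ z → expand V K (A x z))) (trans (sum-linear₂ V (- K) (A x) (λ _ → 1ℤ))
        (trans (cong₂ (λ a b → V * a + (- K) * b) (row-sum x) (sum-const v 1ℤ)) (simplify V K)))
        where
        expand : ∀ V K a → V * a - K ≡ V * a + (- K) * 1ℤ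
        expand = solve-∀
        simplify : ∀ V K → V * K + (- K) * (V * 1ℤ) ≡ 0ℤ
        simplify = solve-∀
      sum-q-row : ∀ x → ∑[ z < v ] q x z ≡ 0ℤ
      sum-q-row x = trans (sum-cong (λ z → expand V (δ x z))) (trans (sum-linear₂ 1ℤ (- V) (λ _ → 1ℤ) (δ x))
        (trans (cong₂ (λ a b → 1ℤ * a + (- V) * b) (sum-const v 1ℤ) (δ-total x)) (simplify V)))
        where
        expand : ∀ V d → 1ℤ - V * d ≡ 1ℤ * 1ℤ + (- V) * d
        expand = solve-∀
        simplify : ∀ V → 1ℤ * (V * 1ℤ) + (- V) * 1ℤ ≡ 0ℤ
        simplify = solve-∀
      q-sym : ∀ x y → q x y ≡ q y x
      q-sym x y = cong (λ d → 1ℤ - V * d) (δ-sym x y)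
      p-sym : ∀ x y → p x y ≡ p y x
      p-sym x y = cong (λ a → V * a - K) (A-sym x y)
      qp : ∀ x y → ∑[ z < v ] (q x z * p z y) ≡ - (V * p x y)
      qp x y = trans (sum-cong (λ z → trans (ℤP.*-comm (q x z) (p z y)) (cong₂ _*_ (p-sym z y) (q-sym x z))))
        (trans (sum-q (p y) x) (trans (cong (_- V * p y x) (sum-p y)) (trans (ℤP.+-identityˡ _)
          (cong (λ t → - (V * t)) (p-sym y x)))))
      idem : ∀ x y → sum (λ z → _⊗_ τ κ (M x z) (M z y)) ≡ _⊗_ τ κ c (M x y)
      idem x y = trans (sum-pairs v _) (cong₂ _,_ first second)
        where
        open ≡-Reasoning
        first : ∑[ z < v ] (p x z * p z y + κ * (q x z * q z y)) ≡ V * τ * p x y + κ * (- (V + V) * q x y)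
        first = begin
          _ ≡⟨ sum-+ _ _ ⟩
          _ ≡⟨ cong₂ _+_ (pp x y) (trans (sum-*ˡ κ (λ z → q x z * q z y))
            (cong (κ *_) (trans (sum-q (q x) y) (cong (_- V * q x y) (sum-q-row x))))) ⟩
          V * V * (τ * A x y + κ * δ x y + + μ) - V * K * K + κ * (0ℤ - V * (1ℤ - V * δ x y))
            ≡⟨ isolate V K τ κ (+ μ) (A x y) (δ x y) ⟩
          V * τ * p x y + κ * (- (V + V) * q x y) + V * (τ * K + κ + + μ * V - K * K)
            ≡⟨ cong (λ t → V * τ * p x y + κ * (- (V + V) * q x y) + V * (t - K * K)) (parameter-identity x) ⟨
          V * τ * p x y + κ * (- (V + V) * q x y) + V * (K * K - K * K)
            ≡⟨ drop (V * τ * p x y + κ * (- (V + V) * q x y)) V (K * K) ⟩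
          _ ∎
          where
          isolate : ∀ V K t d m a e → V * V * (t * a + d * e + m) - V * K * K + d * (0ℤ - V * (1ℤ - V * e))
            ≡ V * t * (V * a - K) + d * (- (V + V) * (1ℤ - V * e)) + V * (t * K + d + m * V - K * K)
          isolate = solve-∀
          drop : ∀ s V k → s + V * (k - k) ≡ s
          drop = solve-∀
        second : ∑[ z < v ] (p x z * q z y + q x z * p z y + τ * (q x z * q z y)) ≡ V * τ * q x y + - (V + V) * p x y
          + τ * (- (V + V) * q x y)
        second = begin
          _ ≡⟨ sum-cong (λ z → unit (p x z * q z y) (q x z * p z y) τ (q x z * q z y)) ⟩
          _ ≡⟨ sum-linear₃ 1ℤ 1ℤ τ (λ z → p x z * q z y) (λ z → q x z * p z y) (λ z → q x z * q z y) ⟩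
          _ ≡⟨ cong₂ _+_ (cong₂ (λ a b → 1ℤ * a + 1ℤ * b) (trans (sum-q (p x) y) (cong (_- V * p x y) (sum-p x)))
            (qp x y))
                 (cong (τ *_) (trans (sum-q (q x) y) (cong (_- V * q x y) (sum-q-row x)))) ⟩
          _ ≡⟨ simplify V τ (p x y) (q x y) ⟩
          _ ∎
          where
          unit : ∀ a b t c → a + b + t * c ≡ 1ℤ * a + 1ℤ * b + t * c
          unit = solve-∀
          simplify : ∀ V t p q → 1ℤ * (0ℤ - V * p) + 1ℤ * (- (V * p)) + t * (0ℤ - V * q)
                               ≡ V * t * q + - (V + V) * p + t * (- (V + V) * q)
          simplify = solve-∀
      traced : ∃ λ t → sum (λ x → M x x) ≡ t ×ʳ c
      traced = trace-of-scaled-idempotent (ℤ[ρ] τ κ) (zero? τ κ no-root) (⊗-cancel τ κ no-root) M c c≢0 idem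
      t : ℕ
      t = proj₁ traced
      multiple : ∀ n (x : Carrier) → n ×ʳ x ≡ (+ n * proj₁ x , + n * proj₂ x)
      multiple zero x = cong₂ _,_ (sym (ℤP.*-zeroˡ (proj₁ x))) (sym (ℤP.*-zeroˡ (proj₂ x)))
      multiple (suc n) (a , b) = trans (cong (_⊕_ τ κ (a , b)) (multiple n (a , b)))
        (cong₂ _,_ (sym (ℤP.suc-* (+ n) a)) (sym (ℤP.suc-* (+ n) b)))
      -- An equation in ℤ[ρ] is two equations in ℤ: the rational part determines k and the ρ-part
      -- determines v.
      trace-eq : (∑[ x < v ] p x x , ∑[ x < v ] q x x) ≡ (+ t * (V * τ) , + t * (- (V + V)))
      trace-eq = trans (sym (sum-pairs v (λ x → M x x))) (trans (proj₂ traced) (multiple t c))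
      V-cancel : ∀ {i j} → V * i ≡ V * j → i ≡ j
      V-cancel {i} {j} e = ℤP.i-j≡0⇒i≡j i j (*-cancelˡ-0 V≢0 (trans (distrib V i j) (ℤP.i≡j⇒i-j≡0 e)))
        where
        distrib : ∀ V i j → V * (i - j) ≡ V * i - V * j
        distrib = solve-∀
      k-eq : K ≡ + t * (+ μ - + ℓ)
      k-eq = V-cancel (trans (sym (ℤP.neg-involutive (V * K)))
        (trans (cong -_ (trans (sym diagonal) (cong proj₁ trace-eq))) (negate V (+ t) (+ ℓ) (+ μ))))
        where
        diagonal : ∑[ x < v ] p x x ≡ - (V * K)
        diagonal = trans (sum-cong (λ x → trans (cong (λ b → V * 𝟙 b - K) (irrefl G x)) (simplify V K)))
          (trans (sum-const v (- K)) (neg V K))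
          where
          simplify : ∀ V K → V * 0ℤ - K ≡ - K
          simplify = solve-∀
          neg : ∀ V K → V * (- K) ≡ - (V * K)
          neg = solve-∀
        negate : ∀ V t l m → - (t * (V * (l - m))) ≡ V * (t * (m - l))
        negate = solve-∀
      v-eq : V ≡ 1ℤ + (+ t + + t)
      v-eq = V-cancel (trans (add V) (trans (cong (λ t → V - t) (trans (sym diagonal) (cong proj₂ trace-eq)))
        (collect V (+ t))))
        where
        diagonal : ∑[ x < v ] q x x ≡ V - V * V
        diagonal = trans (sum-cong (λ x → cong (λ d → 1ℤ - V * d) (δ-same x))) (trans (sum-const v (1ℤ - V * 1ℤ))
          (simplify V))
          where
          simplify : ∀ V → V * (1ℤ - V * 1ℤ) ≡ V - V * V
          simplify = solve-∀
        add : ∀ V → V * V ≡ V - (V - V * V)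
        add = solve-∀
        collect : ∀ V t → V - t * (- (V + V)) ≡ V * (1ℤ + (t + t))
        collect = solve-∀

-- Eigenvalue bounds and the exclusion of separators.

module Spectrum where

  open import Defs
  open IntegerSums
  open SRG
  open Eigenvalues
  open ChvatalErdos using (module Separation)
  open import Data.Nat as ℕ using (ℕ; zero; suc)
  import Data.Nat.Properties as ℕP
  open import Data.Integer using (ℤ; +_; -[1+_]; _+_; _*_; -_; _-_; _≤_; _<_; 0ℤ; 1ℤ; +≤+; +<+; nonNegative)
  open import Data.Integer.Properties as ℤP using (≤-trans; ≤-reflexive; pos-+; pos-*)
  open import Data.Integer.Tactic.RingSolver using (solve-∀)

  0≤pos : ∀ n → 0ℤ ≤ + n
  0≤pos n = +≤+ ℕ.z≤n

  0<pos : ∀ {n} → 1 ℕ.≤ n → 0ℤ < + n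
  0<pos h = +<+ h

  module Restricted {v : ℕ} (G : Graph v) {k ℓ μ : ℕ} (srg : IsStronglyRegular G k ℓ μ) where

    open IsStronglyRegular srg
    open AdjacencyMatrix G srg
    open Parameters G srg

    k≥1 : 1 ℕ.≤ k
    k≥1 = ℕP.≤-trans (ℕ.s≤s ℕ.z≤n) ℓ<k

    -- The other root is τ - t, and the product of the roots is μ - k ≤ 0, so one root is r ≥ 0 and
    -- the other -s ≤ 0. That s does not vanish rests on ℓ < k.
    integer-root⇒eigenvalues : ∀ t → t * t ≡ τ * t + κ → ∃₂ λ r s → τ ≡ + r - + s × κ ≡ + r * + s × 1 ℕ.≤ s
    integer-root⇒eigenvalues (+ zero) e = 0 , μ ℕ.∸ ℓ , τ≡ , κ≡0 , ℕP.m<n⇒0<n∸m (ℕP.<-≤-trans ℓ<k (ℕP.≤-reflexive k≡μ))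
      where
      κ≡0 : κ ≡ 0ℤ
      κ≡0 = trans (sym (ℤP.+-identityˡ κ)) (trans (cong (_+ κ) (sym (ℤP.*-zeroʳ τ))) (sym e))
      k≡μ : k ≡ μ
      k≡μ = ℤP.+-injective (ℤP.i-j≡0⇒i≡j (+ k) (+ μ) κ≡0)
      τ≡ : τ ≡ 0ℤ - + (μ ℕ.∸ ℓ)
      τ≡ = trans (ℤP.m-n≡m⊖n ℓ μ) (trans (ℤP.⊖-≤ (ℕP.≤-trans (ℕP.<⇒≤ ℓ<k) (ℕP.≤-reflexive k≡μ)))
        (sym (ℤP.+-identityˡ _)))
    integer-root⇒eigenvalues (+ suc n) e with other-root-nonneg
      where
      T : ℤ
      T = + suc n
      κ≡ : κ ≡ T * (T - τ)
      κ≡ = trans (solve-κ τ κ T) (trans (cong (_- τ * T) (sym e)) (factor T τ))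
        where
        solve-κ : ∀ t d x → d ≡ t * x + d - t * x
        solve-κ = solve-∀
        factor : ∀ x t → x * x - t * x ≡ x * (x - t)
        factor = solve-∀
      other-root-nonneg : ∃ λ s → T - τ ≡ + s × κ ≡ T * + s
      other-root-nonneg with T - τ in eq
      ... | + s = s , refl , trans κ≡ (cong (T *_) eq)
      ... | -[1+ s ] = ⊥-elim (¬neg (subst (0ℤ ≤_) (trans κ≡ (cong (T *_) eq)) (≤⇒0≤- (+≤+ μ≤k))))
        where
        ¬neg : 0ℤ ≤ T * -[1+ s ] → ⊥
        ¬neg ()
    ... | zero , d≡ , κ≡ = ⊥-elim (ℕP.<⇒≱ ℓ<k (ℤP.drop‿+≤+ bound))
      where
      bound : + k ≤ + ℓ
      bound = ≤-from-difference (0≤pos (suc n)) (trans (split (+ ℓ) (+ k) (+ μ))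
        (trans (cong₂ (λ a b → a - b) (τ-value (+ suc n) τ d≡) (trans κ≡ (ℤP.*-zeroʳ (+ suc n)))) (ℤP.+-identityʳ _)))
        where
        split : ∀ l k m → l - k ≡ (l - m) - (k - m)
        split = solve-∀
        τ-value : ∀ x t → x - t ≡ 0ℤ → t ≡ x
        τ-value x t e = sym (ℤP.i-j≡0⇒i≡j x t e)
    ... | suc s , d≡ , κ≡ = suc n , suc s , trans (shift (+ suc n) τ) (cong (λ t → + suc n - t) d≡) , κ≡ , ℕ.s≤s ℕ.z≤n
      where
      shift : ∀ x t → t ≡ x - (x - t)
      shift = solve-∀
    integer-root⇒eigenvalues (-[1+ n ]) e with other-root-nonneg
      where
      T : ℤ
      T = + suc n
      κ≡ : κ ≡ T * (T + τ)
      κ≡ = trans (solve-κ τ κ T) (trans (cong (λ q → q + τ * T) (sym e)) (factor T τ))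
        where
        solve-κ : ∀ t d x → d ≡ t * (- x) + d + t * x
        solve-κ = solve-∀
        factor : ∀ x t → (- x) * (- x) + t * x ≡ x * (x + t)
        factor = solve-∀
      other-root-nonneg : ∃ λ r → T + τ ≡ + r × κ ≡ T * + r
      other-root-nonneg with T + τ in eq
      ... | + s = s , refl , trans κ≡ (cong (T *_) eq)
      ... | -[1+ s ] = ⊥-elim (¬neg (subst (0ℤ ≤_) (trans κ≡ (cong (T *_) eq)) (≤⇒0≤- (+≤+ μ≤k))))
        where
        ¬neg : 0ℤ ≤ T * -[1+ s ] → ⊥
        ¬neg ()
    ... | r , d≡ , κ≡ = r , suc n , trans (shift (+ suc n) τ) (cong (_- + suc n) d≡) , trans κ≡
      (ℤP.*-comm (+ suc n) (+ r)) , ℕ.s≤s ℕ.z≤n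
      where
      shift : ∀ x t → t ≡ x + t - x
      shift = solve-∀

    module Eigen (r s : ℕ) (τ≡ : τ ≡ + r - + s) (κ≡ : κ ≡ + r * + s) (s≥1 : 1 ℕ.≤ s) where

      private
        R S : ℤ
        R = + r
        S = + s
        0<R+S : 0ℤ < R + S
        0<R+S = subst (0ℤ <_) (pos-+ r s) (0<pos (ℕP.≤-trans s≥1 (ℕP.m≤n+m s r)))

      norm²-A·-restricted : ∀ u → total u ≡ 0ℤ → norm² (A· u) ≡ (R - S) * form u + R * S * norm² u
      norm²-A·-restricted u t0 = trans (norm²-A· u)
        (trans (cong₂ (λ t d → t * form u + d * norm² u + + μ * (total u * total u)) τ≡ κ≡)
        (trans (cong (λ t → (R - S) * form u + R * S * norm² u + + μ * (t * t)) t0) (drop _ (+ μ))))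
        where
        drop : ∀ a m → a + m * (0ℤ * 0ℤ) ≡ a
        drop = solve-∀

      -- For u orthogonal to 1, ‖(A - r)u‖² = (r + s)(r‖u‖² - uᵀAu). The lower bound below uses A +
      -- s in the same way.
      form-≤ : ∀ u → total u ≡ 0ℤ → form u ≤ R * norm² u
      form-≤ u t0 = 0≤-⇒≤ (*-cancel-pos-nonneg 0<R+S (subst (0ℤ ≤_)
        (trans (cong (λ n → n + (- R + - R) * form u + - R * - R * norm² u) (norm²-A·-restricted u t0))
          (factor R S (form u) (norm² u)))
        (shift-nonneg (- R) u)))
        where
        factor : ∀ R S q n → (R - S) * q + R * S * n + (- R + - R) * q + - R * - R * n ≡ (R + S) * (R * n - q)
        factor = solve-∀

      form-≥ : ∀ u → total u ≡ 0ℤ → 0ℤ ≤ form u + S * norm² u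
      form-≥ u t0 = *-cancel-pos-nonneg 0<R+S (subst (0ℤ ≤_)
        (trans (cong (λ n → n + (S + S) * form u + S * S * norm² u) (norm²-A·-restricted u t0))
          (factor R S (form u) (norm² u)))
        (shift-nonneg S u))
        where
        factor : ∀ R S q n → (R - S) * q + R * S * n + (S + S) * q + S * S * n ≡ (R + S) * (q + S * n)
        factor = solve-∀

      -- Here ‖Au‖² is linear in uᵀAu with coefficient r - s, so the sign of r - s decides whether
      -- the upper or the lower bound on uᵀAu is inserted.
      norm²-A·-≤ : ∀ {θ} → r ℕ.≤ θ → s ℕ.≤ θ → ∀ u → total u ≡ 0ℤ → norm² (A· u) ≤ + θ * + θ * norm² u
      norm²-A·-≤ {θ} r≤θ s≤θ u t0 with ℕP.≤-total s r
      ... | inj₁ s≤r = ≤-trans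
        (≤-from-difference (*-nonneg (≤⇒0≤- (+≤+ s≤r)) (≤⇒0≤- (form-≤ u t0)))
          (trans (cong (λ t → R * R * norm² u - t) (norm²-A·-restricted u t0)) (expand R S (form u) (norm² u))))
        (ℤP.*-monoʳ-≤-nonNeg (norm² u) {{nonNegative (norm²-nonneg u)}}
          (subst₂ _≤_ (pos-* r r) (pos-* θ θ) (+≤+ (ℕP.*-mono-≤ r≤θ r≤θ))))
        where
        expand : ∀ R S q n → R * R * n - ((R - S) * q + R * S * n) ≡ (R - S) * (R * n - q)
        expand = solve-∀
      ... | inj₂ r≤s = ≤-trans
        (≤-from-difference (*-nonneg (≤⇒0≤- (+≤+ r≤s)) (form-≥ u t0))
          (trans (cong (λ t → S * S * norm² u - t) (norm²-A·-restricted u t0)) (expand R S (form u) (norm² u))))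
        (ℤP.*-monoʳ-≤-nonNeg (norm² u) {{nonNegative (norm²-nonneg u)}}
          (subst₂ _≤_ (pos-* s s) (pos-* θ θ) (+≤+ (ℕP.*-mono-≤ s≤θ s≤θ))))
        where
        expand : ∀ R S q n → S * S * n - ((R - S) * q + R * S * n) ≡ (S - R) * (q + S * n)
        expand = solve-∀

      -- The quadratic X² - τX - κ = (X - r)(X + s), evaluated at X = k, takes the value μv by
      -- `parameter-identity`.
      vertex-count : Fin v → + μ * + v ≡ (+ k - R) * (+ k + S)
      vertex-count x = trans (isolate (+ k) τ κ (+ μ * + v))
        (trans (cong (λ t → t - τ * + k - κ) (sym (parameter-identity x)))
        (trans (cong₂ (λ t d → + k * + k - t * + k - d) τ≡ κ≡) (factor (+ k) R S)))
        where
        isolate : ∀ k t d w → w ≡ t * k + d + w - t * k - d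
        isolate = solve-∀
        factor : ∀ k R S → k * k - (R - S) * k - R * S ≡ (k - R) * (k + S)
        factor = solve-∀

      r≤k : r ℕ.≤ k
      r≤k = ℤP.drop‿+≤+ (≤-from-difference (+-nonneg (0≤pos μ) (*-nonneg (0≤pos r) (≤⇒0≤- (+≤+ s≥1))))
        (trans (split (+ k) (+ μ) R) (trans (cong (λ d → + μ + d - R) κ≡) (collect (+ μ) R S))))
        where
        split : ∀ k m R → k - R ≡ m + (k - m) - R
        split = solve-∀
        collect : ∀ m R S → m + R * S - R ≡ m + R * (S - 1ℤ)
        collect = solve-∀

      -- An independent set has at most v s / (k + s) ≤ k − r vertices when s ≤ μ, whereas
      -- k − |S| ≤ r for every separator S.
      no-separator : s ℕ.≤ μ → Separation.Separator G → ⊥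
      no-separator s≤μ sep = ¬0≤neg positive (subst (0ℤ ≤_) (sym (ℤP.neg-involutive x)) (*-cancel-pos-nonneg scale>0
        nonneg))
        where
        open Separation.Separator sep renaming (S to C; S<I to C<I) using (I; independent; h)
        open SeparatorVector sep using (w; total-w; rayleigh; norm²-positive)
        K M V a σ : ℤ
        K = + k
        M = + μ
        V = + v
        a = + count I
        σ = + count C
        few : K - σ ≤ R
        few = *-cancel-pos-≤ norm²-positive (subst₂ _≤_ (ℤP.*-comm (K - σ) _) (ℤP.*-comm R _)
          (≤-trans rayleigh (form-≤ w total-w)))
        scale : ℤ
        scale = (K + S) * a * (R + S)
        scale>0 : 0ℤ < scale
        scale>0 = *-pos (*-pos (subst (0ℤ <_) (pos-+ k s) (0<pos (ℕP.≤-trans k≥1 (ℕP.m≤m+n k s))))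
          (0<pos (ℕP.≤-trans (ℕ.s≤s ℕ.z≤n) C<I))) 0<R+S
        bound : 0ℤ ≤ V * (R * S * a + M * (a * a) + S * S * a) - ((K + S) * a) * ((K + S) * a)
        bound = ≤⇒0≤- (subst (λ d → ((K + S) * a) * ((K + S) * a) ≤ V * (d * a + M * (a * a) + S * S * a)) κ≡
          (independent-bound S I independent))
        -- Nonnegativity of x is the ratio bound μ|I| ≤ (k - r)s. It appears when the Cauchy-Schwarz
        -- bound is multiplied by μ and μv is replaced by (k - r)(k + s): all other factors are
        -- positive.
        x : ℤ
        x = (K - R) * S - M * a
        nonneg : 0ℤ ≤ scale * x
        nonneg = subst (0ℤ ≤_) (trans (distribute M V K R S a)
          (trans (cong (λ t → t * (R * S * a + M * (a * a) + S * S * a) - M * (((K + S) * a) * ((K + S) * a)))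
          (vertex-count h)) (factor M K R S a)))
          (*-nonneg (0≤pos μ) bound)
          where
          distribute : ∀ M V K R S a → M * (V * (R * S * a + M * (a * a) + S * S * a) - ((K + S) * a) * ((K + S) * a))
                     ≡ M * V * (R * S * a + M * (a * a) + S * S * a) - M * (((K + S) * a) * ((K + S) * a))
          distribute = solve-∀
          factor : ∀ M K R S a → (K - R) * (K + S) * (R * S * a + M * (a * a) + S * S * a) - M *
            (((K + S) * a) * ((K + S) * a))
                 ≡ (K + S) * a * (R + S) * ((K - R) * S - M * a)
          factor = solve-∀
        -- The slack in |C| < |I|, in k - |C| ≤ r (together `D`) and in s ≤ μ (`E`). Thus |I| = k -
        -- r + 1 + D and μ = s + E, and -x becomes a sum of nonnegative terms and s.
        D E : ℤ
        D = (a - (σ + 1ℤ)) + (R - (K - σ))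
        E = M - S
        D≥0 : 0ℤ ≤ D
        D≥0 = +-nonneg (≤⇒0≤- (subst (_≤ a) (trans (cong +_ (ℕP.+-comm 1 (count C))) (pos-+ (count C) 1)) (+≤+ C<I)))
          (≤⇒0≤- few)
        y : ℤ
        y = S + (S * D + E * (1ℤ + ((K - R) + D)))
        y>0 : 0ℤ < y
        y>0 = ℤP.<-≤-trans (0<pos s≥1) (≤-from-difference (+-nonneg (*-nonneg (0≤pos s) D≥0)
            (*-nonneg (≤⇒0≤- (+≤+ s≤μ)) (+-nonneg (0≤pos 1) (+-nonneg (≤⇒0≤- (+≤+ r≤k)) D≥0)))) (cancel S _))
          where
          cancel : ∀ s t → s + t - s ≡ t
          cancel = solve-∀
        positive : 0ℤ < - x
        positive = subst (0ℤ <_) (identity K R S M a σ) y>0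
          where
          identity : ∀ K R S M a σ → S + (S * ((a - (σ + 1ℤ)) + (R - (K - σ))) + (M - S) *
            (1ℤ + ((K - R) + ((a - (σ + 1ℤ)) + (R - (K - σ))))))
                   ≡ - ((K - R) * S - M * a)
          identity = solve-∀

    -- The eigenvalues (-1 ± √v)/2 need not be integers, so crude integer bounds take their place:
    -- 2(k - |C|) ≤ μ gives |C| ≥ 3μ/2, whereas (3μ + 1)|I| ≤ (4μ + 1)(μ + 1) keeps |I| near 4μ/3.
    -- With |C| < |I| this is contradictory once μ ≥ 2, which v ≥ 6 ensures.
    no-conference-separator : 6 ℕ.≤ v → v ≡ 1 ℕ.+ 4 ℕ.* μ → k ≡ 2 ℕ.* μ → 1 ℕ.+ ℓ ≡ μ → Separation.Separator G → ⊥
    no-conference-separator 6≤v v≡ k≡ ℓ≡ sep = ¬0≤neg m²-m>0 (subst (0ℤ ≤_) final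
        (+-nonneg (*-nonneg (0≤pos 2) (subst (0ℤ ≤_) (eliminate m σ a) a-bound))
          (*-nonneg (+-nonneg (*-nonneg (0≤pos 3) (0≤pos μ)) (0≤pos 1)) (+-nonneg (*-nonneg (0≤pos 2) D≥0)
            (≤⇒0≤- 2d≤m)))))
      where
      open Separation.Separator sep renaming (S to C; S<I to C<I) using (I; independent)
      open SeparatorVector sep using (w; total-w; rayleigh; norm²-positive)
      m a σ d n Q : ℤ
      m = + μ
      a = + count I
      σ = + count C
      d = + 2 * m - σ
      n = norm² w
      Q = form w
      K≡ : + k ≡ + 2 * m
      K≡ = trans (cong +_ k≡) (pos-* 2 μ)
      V≡ : + v ≡ 1ℤ + + 4 * m
      V≡ = trans (cong +_ v≡) (trans (pos-+ 1 (4 ℕ.* μ)) (cong (λ t → 1ℤ + t) (pos-* 4 μ)))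
      κ≡ : κ ≡ m
      κ≡ = trans (cong (_- m) K≡) (halve m)
        where
        halve : ∀ m → + 2 * m - m ≡ m
        halve = solve-∀
      τ≡ : τ ≡ - 1ℤ
      τ≡ = trans (cong (λ t → + ℓ - t) (trans (cong +_ (sym ℓ≡)) (pos-+ 1 ℓ))) (minus (+ ℓ))
        where
        minus : ∀ l → l - (1ℤ + l) ≡ - 1ℤ
        minus = solve-∀
      μ≥2 : 2 ℕ.≤ μ
      μ≥2 = ℕP.≰⇒> λ μ≤1 → ℕP.<⇒≱ 6≤v (ℕP.≤-trans (ℕP.≤-reflexive v≡) (ℕ.s≤s (ℕP.*-monoʳ-≤ 4 μ≤1)))
      m²-m>0 : 0ℤ < m * (m - 1ℤ)
      m²-m>0 = *-pos (0<pos (ℕP.≤-trans (ℕ.s≤s ℕ.z≤n) μ≥2)) (ℤP.<-≤-trans (0<pos (ℕ.s≤s ℕ.z≤n))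
        (≤-from-difference (≤⇒0≤- (+≤+ μ≥2)) (two m)))
        where
        two : ∀ m → m - 1ℤ - 1ℤ ≡ m - + 2
        two = solve-∀
      quotient : d * n ≤ Q
      quotient = subst (λ t → (t - σ) * n ≤ Q) K≡ rayleigh
      upper : 0ℤ ≤ (m + d * d) * n - (1ℤ + + 2 * d) * Q
      upper = subst (0ℤ ≤_) (trans (cong (λ t → t + (- d + - d) * Q + - d * - d * n)
          (trans (norm²-A· w) (trans (cong₂ (λ t c → t * Q + c * n + m * (total w * total w)) τ≡ κ≡)
            (cong (λ t → - 1ℤ * Q + m * n + m * (t * t)) total-w))))
        (collect m d n Q)) (shift-nonneg (- d) w)
        where
        collect : ∀ m d n Q → - 1ℤ * Q + m * n + m * (0ℤ * 0ℤ) + (- d + - d) * Q + - d * - d * n ≡ (m + d * d) * n -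
          (1ℤ + + 2 * d) * Q
        collect = solve-∀
      -- With d = k - |C| itself as the shift, ‖(A - d)w‖² ≥ 0 and the Rayleigh quotient d combine
      -- to d² + d ≤ μ. Then 2d > μ would make (2d - 1)² + 3 at most 0.
      2d≤m : + 2 * d ≤ m
      2d≤m with + 2 * d ℤP.≤? m
      ... | yes h = h
      ... | no h = ⊥-elim (¬0≤neg (pos-nonneg (+-nonneg (0≤pos 2) (square-nonneg (+ 2 * d - 1ℤ))))
          (subst (0ℤ ≤_) (combine m d) (*-nonneg (0≤pos 4) (+-nonneg (*-cancel-pos-nonneg norm²-positive small)
            (≤⇒0≤- m<2d)))))
        where
        m<2d : 1ℤ + m ≤ + 2 * d
        m<2d = ℤP.i<j⇒suc[i]≤j (ℤP.≰⇒> h)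
        small : 0ℤ ≤ n * (m - d - d * d)
        small = subst (0ℤ ≤_) (collect m d n Q) (+-nonneg upper
          (*-nonneg (+-nonneg (0≤pos 1) (≤-trans (0≤pos μ) (≤-trans (ℤP.i≤j+i m 1ℤ) m<2d))) (≤⇒0≤- quotient)))
          where
          collect : ∀ m d n Q → ((m + d * d) * n - (1ℤ + + 2 * d) * Q) + (1ℤ + + 2 * d) * (Q - d * n) ≡ n *
            (m - d - d * d)
          collect = solve-∀
        combine : ∀ m d → + 4 * ((m - d - d * d) + (+ 2 * d - (1ℤ + m))) ≡ -
          (1ℤ + (+ 2 + (+ 2 * d - 1ℤ) * (+ 2 * d - 1ℤ)))
        combine = solve-∀
      D≥0 : 0ℤ ≤ a - (σ + 1ℤ)
      D≥0 = ≤⇒0≤- (subst (_≤ a) (trans (cong +_ (ℕP.+-comm 1 (count C))) (pos-+ (count C) 1)) (+≤+ C<I))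
      -- The shift is c = 1: with c = 0 the coefficient of |I| after collecting terms would be -μ
      -- and the bound empty, while c = 1 makes it 3μ + 1.
      a-bound : 0ℤ ≤ (1ℤ + + 4 * m) * (m + m * a + 1ℤ) - (+ 2 * m + 1ℤ) * (+ 2 * m + 1ℤ) * a
      a-bound = *-cancel-pos-nonneg (0<pos (ℕP.≤-trans (ℕ.s≤s ℕ.z≤n) C<I)) (subst (0ℤ ≤_) (factor m a)
        (≤⇒0≤- (subst₂ _≤_ (cong (λ t → ((t + 1ℤ) * a) * ((t + 1ℤ) * a)) K≡)
          (cong₂ (λ V c → V * (c * a + m * (a * a) + 1ℤ * 1ℤ * a)) V≡ κ≡) (independent-bound 1ℤ I independent))))
        where
        factor : ∀ m a → (1ℤ + + 4 * m) * (m * a + m * (a * a) + 1ℤ * 1ℤ * a) - ((+ 2 * m + 1ℤ) * a) *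
          ((+ 2 * m + 1ℤ) * a)
               ≡ a * ((1ℤ + + 4 * m) * (m + m * a + 1ℤ) - (+ 2 * m + 1ℤ) * (+ 2 * m + 1ℤ) * a)
        factor = solve-∀
      -- Substituting a = σ + 1 + D and σ = 2m − d into the bound (3m + 1) a ≤ (4m + 1)(m + 1).
      eliminate : ∀ m σ a → (1ℤ + + 4 * m) * (m + m * a + 1ℤ) - (+ 2 * m + 1ℤ) * (+ 2 * m + 1ℤ) * a
                ≡ (1ℤ + + 4 * m) * (m + 1ℤ) - (+ 3 * m + 1ℤ) * ((a - (σ + 1ℤ)) + σ + 1ℤ)
      eliminate = solve-∀
      final : + 2 * ((1ℤ + + 4 * m) * (m + 1ℤ) - (+ 3 * m + 1ℤ) * ((a - (σ + 1ℤ)) + σ + 1ℤ))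
            + (+ 3 * m + 1ℤ) * (+ 2 * (a - (σ + 1ℤ)) + (m - + 2 * d)) ≡ - (m * (m - 1ℤ))
      final = identity m σ a
        where
        identity : ∀ m σ a → + 2 * ((1ℤ + + 4 * m) * (m + 1ℤ) - (+ 3 * m + 1ℤ) * ((a - (σ + 1ℤ)) + σ + 1ℤ))
            + (+ 3 * m + 1ℤ) * (+ 2 * (a - (σ + 1ℤ)) + (m - + 2 * (+ 2 * m - σ))) ≡ - (m * (m - 1ℤ))
        identity = solve-∀

-- The Krein condition from Hadamard powers of a projection.

module Krein where

  open import Defs
  open IntegerSums
  open SRG
  open Eigenvalues
  open Spectrum
  open import Data.Nat as ℕ using (ℕ; suc)
  import Data.Nat.Properties as ℕP
  open import Data.Integer using (ℤ; +_; _+_; _*_; -_; _-_; _≤_; _<_; 0ℤ; 1ℤ; +≤+)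
  open import Data.Integer.Properties as ℤP using (≤-trans; pos-+; pos-*)
  open import Data.Integer.Tactic.RingSolver using (solve-∀)

  PositiveSemidefinite : ∀ {n} → (Fin n → Fin n → ℤ) → Set
  PositiveSemidefinite {n} P = ∀ (u : Fin n → ℤ) → 0ℤ ≤ ∑[ x < n ] ∑[ y < n ] (P x y * (u x * u y))

  all-ones-psd : ∀ {n} → PositiveSemidefinite {n} (λ _ _ → 1ℤ)
  all-ones-psd {n} u = subst (0ℤ ≤_) (trans (sum-product u u)
    (sum-cong (λ x → sum-cong (λ y → sym (ℤP.*-identityˡ (u x * u y)))))) (square-nonneg (∑ n u))

  -- The Schur product theorem, for a factor H with HᵀH = cH.
  schur-product : ∀ {n} (H P : Fin n → Fin n → ℤ) {c} → 0ℤ < c → (∀ x y → ∑[ z < n ] (H z x * H z y) ≡ c * H x y) →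
                  PositiveSemidefinite P → PositiveSemidefinite (λ x y → H x y * P x y)
  schur-product {n} H P {c} c>0 gram psd u = *-cancel-pos-nonneg c>0
    (subst (0ℤ ≤_) eq (sum-nonneg (λ z → psd (λ x → H z x * u x))))
    where
    open ≡-Reasoning
    rearrange : ∀ p a b c d → p * (a * b * (c * d)) ≡ p * (b * d) * (a * c)
    rearrange = solve-∀
    regroup : ∀ p b d c h → p * (b * d) * (c * h) ≡ c * (h * p * (b * d))
    regroup = solve-∀
    eq : ∑[ z < n ] ∑[ x < n ] ∑[ y < n ] (P x y * (H z x * u x * (H z y * u y)))
       ≡ c * ∑[ x < n ] ∑[ y < n ] (H x y * P x y * (u x * u y))
    eq = begin
      _ ≡⟨ sum-swap (λ z x → ∑[ y < n ] (P x y * (H z x * u x * (H z y * u y)))) ⟩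
      _ ≡⟨ sum-cong (λ x → sum-swap (λ z y → P x y * (H z x * u x * (H z y * u y)))) ⟩
      _ ≡⟨ sum-cong (λ x → sum-cong (λ y → trans (sum-cong (λ z → rearrange (P x y) (H z x) (u x) (H z y) (u y)))
             (trans (sum-*ˡ (P x y * (u x * u y)) (λ z → H z x * H z y))
               (trans (cong (P x y * (u x * u y) *_) (gram x y))
               (regroup (P x y) (u x) (u y) c (H x y)))))) ⟩
      _ ≡⟨ sum-cong (λ x → sum-*ˡ c (λ y → H x y * P x y * (u x * u y))) ⟩
      _ ≡⟨ sum-*ˡ c (λ x → ∑[ y < n ] (H x y * P x y * (u x * u y))) ⟩
      _ ∎

  module KreinCondition {v : ℕ} (G : Graph v) {k ℓ μ : ℕ} (srg : IsStronglyRegular G k ℓ μ)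
    (r s : ℕ) (τ≡ : AdjacencyMatrix.τ G srg ≡ + r - + s) (κ≡ : AdjacencyMatrix.κ G srg ≡ + r * + s) (s≥1 : 1 ℕ.≤ s) (x₀ : Fin v) where

    open AdjacencyMatrix G srg
    open Restricted G srg
    open Eigen r s τ≡ κ≡ s≥1

    private
      R S K M V g : ℤ
      R = + r
      S = + s
      K = + k
      M = + μ
      V = + v
      g = K + S

    -- A positive multiple of the projection onto the eigenspace of −s.
    H : Fin v → Fin v → ℤ
    H x y = M + R * g * δ x y - g * A x y

    H-sym : ∀ x y → H x y ≡ H y x
    H-sym x y = cong₂ (λ d a → M + R * g * d - g * a) (δ-sym x y) (A-sym x y)

    contract : ∀ (f : Fin v → ℤ) y → ∑[ z < v ] (f z * H z y) ≡ M * ∑ v f + R * g * f y - g * (A· f) y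
    contract f y = trans (sum-cong (λ z → trans (cong (f z *_) (H-sym z y)) (expand (f z) M (R * g) g (δ y z) (A y z))))
      (trans (sum-linear₃ M (R * g) (- g) f (λ z → δ y z * f z) (λ z → A y z * f z))
        (trans (cong (λ t → M * ∑ v f + R * g * t + (- g) * (A· f) y) (sum-δ y f)) (minus (M * ∑ v f + R * g * f y) g
          ((A· f) y))))
      where
      expand : ∀ f m r g d a → f * (m + r * d - g * a) ≡ m * f + r * (d * f) + (- g) * (a * f)
      expand = solve-∀
      minus : ∀ s g a → s + (- g) * a ≡ s - g * a
      minus = solve-∀

    H-column-sum : ∀ x → ∑[ z < v ] H z x ≡ 0ℤ
    H-column-sum x = trans (sum-cong (λ z → sym (ℤP.*-identityˡ (H z x)))) (trans (contract (λ _ → 1ℤ) x)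
      (trans (cong₂ (λ a b → M * a + R * g * 1ℤ - g * b) (trans (sum-const v 1ℤ) (ℤP.*-identityʳ V))
          (trans (sum-cong (λ y → ℤP.*-identityʳ (A x y))) (row-sum x)))
        (trans (cong (λ t → t + R * g * 1ℤ - g * K) (vertex-count x)) (cancel K R S))))
      where
      cancel : ∀ K R S → (K - R) * (K + S) + R * (K + S) * 1ℤ - (K + S) * K ≡ 0ℤ
      cancel = solve-∀

    -- `H` = μJ + (k + s)(r - A) annihilates 1 and the eigenspace of r, and acts on that of -s as
    -- the scalar (k + s)(r + s). This makes it a legitimate factor for the Schur product theorem.
    H-gram : ∀ x y → ∑[ z < v ] (H z x * H z y) ≡ g * (R + S) * H x y
    H-gram x y = trans (contract (λ z → H z x) y) (trans (cong₂ (λ a b → M * a + R * g * H y x - g * b)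
      (H-column-sum x) AH)
      (trans (cong (λ t → M * 0ℤ + R * g * t - g * (M * K + R * g * A y x - g * ((R - S) * A y x + R * S * δ y x +
        M))) refl)
        (trans (identity M R S K (δ y x) (A y x)) (cong (g * (R + S) *_) (H-sym y x)))))
      where
      AH : (A· (λ z → H z x)) y ≡ M * K + R * g * A y x - g * ((R - S) * A y x + R * S * δ y x + M)
      AH = trans (contract (A y) x) (trans (cong (λ t → M * t + R * g * A y x - g * (A· (A y)) x) (row-sum y))
        (cong (λ t → M * K + R * g * A y x - g * t)
          (trans (sum-cong (λ z → trans (ℤP.*-comm (A x z) (A y z)) (cong₂ _*_ (A-sym y z) (A-sym x z))))
          (trans (square y x) (cong₂ (λ t d → t * A y x + d * δ y x + M) τ≡ κ≡)))))
      identity : ∀ M R S K d a → M * 0ℤ + R * (K + S) * (M + R * (K + S) * d - (K + S) * a) - (K + S) *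
        (M * K + R * (K + S) * a - (K + S) * ((R - S) * a + R * S * d + M))
               ≡ (K + S) * (R + S) * (M + R * (K + S) * d - (K + S) * a)
      identity = solve-∀

    -- A third power, written in the shape in which three Schur products, applied to the all-ones
    -- matrix and tested on the all-ones vector, produce it.
    cube : ℤ → ℤ
    cube t = t * (t * (t * 1ℤ)) * (1ℤ * 1ℤ)

    diag adjv : ℤ
    diag = M + R * g
    adjv = M - g

    H-cube : ∀ x y → cube (H x y) ≡ (cube diag - cube M) * (δ x y * 1ℤ) + (cube adjv - cube M) * A x y + cube M * 1ℤ
    H-cube x y with x FinP.≟ y
    ... | yes refl = trans (cong (λ a → cube (M + R * g * 1ℤ - g * 𝟙 a)) (irrefl G x))
        (trans (on-diagonal M R g) (cong (λ a → (cube diag - cube M) * (1ℤ * 1ℤ) + (cube adjv - cube M) * 𝟙 a + cube M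
          * 1ℤ) (sym (irrefl G x))))
      where
      on-diagonal : ∀ M R g → let cube = λ t → t * (t * (t * 1ℤ)) * (1ℤ * 1ℤ) in
        cube (M + R * g * 1ℤ - g * 0ℤ) ≡ (cube (M + R * g) - cube M) * (1ℤ * 1ℤ) + (cube (M - g) - cube M) * 0ℤ + cube
          M * 1ℤ
      on-diagonal = solve-∀
    ... | no x≢y with adj G x y
    ... | true = on-edge M R g
      where
      on-edge : ∀ M R g → let cube = λ t → t * (t * (t * 1ℤ)) * (1ℤ * 1ℤ) in
        cube (M + R * g * 0ℤ - g * 1ℤ) ≡ (cube (M + R * g) - cube M) * (0ℤ * 1ℤ) + (cube (M - g) - cube M) * 1ℤ + cube
          M * 1ℤ
      on-edge = solve-∀
    ... | false = off-edge M R g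
      where
      off-edge : ∀ M R g → let cube = λ t → t * (t * (t * 1ℤ)) * (1ℤ * 1ℤ) in
        cube (M + R * g * 0ℤ - g * 0ℤ) ≡ (cube (M + R * g) - cube M) * (0ℤ * 1ℤ) + (cube (M - g) - cube M) * 0ℤ + cube
          M * 1ℤ
      off-edge = solve-∀

    0<g : 0ℤ < g
    0<g = subst (0ℤ <_) (pos-+ k s) (0<pos (ℕP.≤-trans k≥1 (ℕP.m≤m+n k s)))

    0<R+S : 0ℤ < R + S
    0<R+S = subst (0ℤ <_) (pos-+ r s) (0<pos (ℕP.≤-trans s≥1 (ℕP.m≤n+m s r)))

    0<V : 0ℤ < V
    0<V = positive x₀
      where
      positive : ∀ {n} → Fin n → 0ℤ < + n
      positive {suc n} _ = 0<pos (ℕ.s≤s ℕ.z≤n)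

    -- The entrywise cube of `H` is positive semidefinite, so the sum of its entries is nonnegative.
    -- `H` has only three different entries, on the diagonal, on edges and on non-edges, which makes
    -- that sum explicit.
    cubes-nonneg : 0ℤ ≤ cube diag - cube M + (cube adjv - cube M) * K + cube M * V
    cubes-nonneg = *-cancel-pos-nonneg 0<V (subst (0ℤ ≤_) eq (psd³ (λ _ → 1ℤ)))
      where
      psd³ : PositiveSemidefinite (λ x y → H x y * (H x y * (H x y * 1ℤ)))
      psd³ = schur-product H _ c>0 H-gram (schur-product H _ c>0 H-gram (schur-product H _ c>0 H-gram all-ones-psd))
        where
        c>0 : 0ℤ < g * (R + S)
        c>0 = *-pos 0<g 0<R+S
      eq : ∑[ x < v ] ∑[ y < v ] cube (H x y) ≡ V * (cube diag - cube M + (cube adjv - cube M) * K + cube M * V)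
      eq = trans (sum-cong (λ x → trans (sum-cong (H-cube x))
        (trans (sum-linear₃ (cube diag - cube M) (cube adjv - cube M) (cube M) (λ y → δ x y * 1ℤ) (A x) (λ _ → 1ℤ))
          (trans (cong₂ _+_ (cong₂ (λ a b → (cube diag - cube M) * a + (cube adjv - cube M) * b) (sum-δ x (λ _ → 1ℤ))
            (row-sum x))
              (cong (cube M *_) (trans (sum-const v 1ℤ) (ℤP.*-identityʳ V))))
            (cong (λ t → t + (cube adjv - cube M) * K + cube M * V) (ℤP.*-identityʳ (cube diag - cube M)))))))
        (sum-const v _)

    K≡ : K ≡ M + R * S
    K≡ = trans (split K M) (cong (λ t → M + t) κ≡)
      where
      split : ∀ k m → k ≡ m + (k - m)
      split = solve-∀

    -- After eliminating v by `vertex-count` and k by k = μ + rs, the entry sum of the cube is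
    -- divisible by k(r + 1); this is the quotient.
    krein : 0ℤ ≤ (R + 1ℤ) * (R + 1ℤ) * (K * K) + (S - 1ℤ) * (M * M) - S * S * S * ((R + 1ℤ) * (R + 1ℤ))
    krein = *-cancel-pos-nonneg (*-pos (0<pos k≥1) (subst (0ℤ <_) (pos-+ r 1) (0<pos (ℕP.m≤n+m 1 r)))) (subst (0ℤ ≤_)
      (trans (isolate M R S K V) (trans (cong (λ w → cubes M R S K + M * M * (w - M * (1ℤ + K))) (vertex-count x₀))
        (trans (cong (λ t → cubes M R S t + M * M * ((t - R) * (t + S) - M * (1ℤ + t))) K≡)
          (trans (factor M R S) (cong (λ t → t * (R + 1ℤ) * ((R + 1ℤ) * (R + 1ℤ) * (t * t) + (S - 1ℤ) * (M * M) - S *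
            S * S * ((R + 1ℤ) * (R + 1ℤ)))) (sym K≡))))))
      cubes-nonneg)
      where
      cubes : ℤ → ℤ → ℤ → ℤ → ℤ
      cubes M R S K = (M + R * (K + S)) * (M + R * (K + S)) * (M + R * (K + S)) + (M - (K + S)) * (M - (K + S)) *
        (M - (K + S)) * K
      isolate : ∀ M R S K V → let cube = λ t → t * (t * (t * 1ℤ)) * (1ℤ * 1ℤ) in
        cube (M + R * (K + S)) - cube M + (cube (M - (K + S)) - cube M) * K + cube M * V
        ≡ (M + R * (K + S)) * (M + R * (K + S)) * (M + R * (K + S)) + (M - (K + S)) * (M - (K + S)) * (M - (K + S)) *
          K + M * M * (M * V - M * (1ℤ + K))
      isolate = solve-∀
      factor : ∀ M R S → let K = M + R * S in
        (M + R * (K + S)) * (M + R * (K + S)) * (M + R * (K + S)) + (M - (K + S)) * (M - (K + S)) * (M - (K + S)) * K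
          + M * M * ((K - R) * (K + S) - M * (1ℤ + K))
        ≡ K * (R + 1ℤ) * ((R + 1ℤ) * (R + 1ℤ) * (K * K) + (S - 1ℤ) * (M * M) - S * S * S * ((R + 1ℤ) * (R + 1ℤ)))
      factor = solve-∀

    -- Let P = (r + 1)². Raising μ to s in `krein`, hence k to (r + 1)s, and dividing by s² leaves
    -- s(P - 1) ≤ P². As r ≥ 1 gives P ≥ 4, s ≤ 2P follows.
    s-bound : μ ℕ.≤ s → 1 ℕ.≤ r → s ℕ.≤ 2 ℕ.* (suc r ℕ.* suc r)
    s-bound μ≤s r≥1 = ℤP.drop‿+≤+ (subst (S ≤_)
      (sym (trans (pos-* 2 (suc r ℕ.* suc r)) (cong (+ 2 *_) (trans (pos-* (suc r) (suc r)) (cong₂ _*_ R+1 R+1)))))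
      S≤2P)
      where
      R+1 : + suc r ≡ R + 1ℤ
      R+1 = trans (cong +_ (ℕP.+-comm 1 r)) (pos-+ r 1)
      P E : ℤ
      P = (R + 1ℤ) * (R + 1ℤ)
      E = S - M
      E≥0 : 0ℤ ≤ E
      E≥0 = ≤⇒0≤- (+≤+ μ≤s)
      0≤S = 0≤pos s
      0≤M = 0≤pos μ
      0≤R = 0≤pos r
      R+1≥0 : 0ℤ ≤ R + 1ℤ
      R+1≥0 = +-nonneg 0≤R (0≤pos 1)
      reduced : 0ℤ ≤ P * P + S - S * P
      reduced = *-cancel-pos-nonneg (*-pos (0<pos s≥1) (0<pos s≥1)) (subst (0ℤ ≤_)
        (trans (cong (λ t → (P * (t * t) + (S - 1ℤ) * (M * M) - S * S * S * P) + (P * E * (t + (R + 1ℤ) * S) +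
          (M * M + S * (E * (S + M))))) K≡) (identity R S M))
        (+-nonneg krein (+-nonneg (*-nonneg (*-nonneg (*-nonneg R+1≥0 R+1≥0) E≥0)
          (+-nonneg (0≤pos k) (*-nonneg R+1≥0 0≤S)))
          (+-nonneg (*-nonneg 0≤M 0≤M) (*-nonneg 0≤S (*-nonneg E≥0 (+-nonneg 0≤S 0≤M)))))))
        where
        identity : ∀ R S M → let K = M + R * S in let P = (R + 1ℤ) * (R + 1ℤ) in
          (P * (K * K) + (S - 1ℤ) * (M * M) - S * S * S * P) + (P * (S - M) * (K + (R + 1ℤ) * S) +
            (M * M + S * ((S - M) * (S + M))))
          ≡ S * S * (P * P + S - S * P)
        identity = solve-∀
      R-1≥0 : 0ℤ ≤ R - 1ℤ
      R-1≥0 = ≤⇒0≤- (+≤+ r≥1)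
      S≤2P : S ≤ + 2 * P
      S≤2P = 0≤-⇒≤ (*-cancel-pos-nonneg (*-pos (0<pos {2} (ℕ.s≤s ℕ.z≤n)) (*-pos 0<R+1 0<R+1))
        (subst (0ℤ ≤_) (identity R S)
        (+-nonneg (*-nonneg (0≤pos 4) reduced) (+-nonneg (*-nonneg 0≤S (*-nonneg (+-nonneg 0≤R (0≤pos 3)) R-1≥0))
          (*-nonneg (*-nonneg R+1≥0 R+1≥0) 0≤S)))))
        where
        0<R+1 : 0ℤ < R + 1ℤ
        0<R+1 = subst (0ℤ <_) R+1 (0<pos (ℕ.s≤s ℕ.z≤n))
        identity : ∀ R S → let P = (R + 1ℤ) * (R + 1ℤ) in
          + 4 * (P * P + S - S * P) + (S * ((R + + 3) * (R - 1ℤ)) + P * S) ≡ + 2 * P * (+ 2 * P - S)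
        identity = solve-∀

-- The claw bound for the largest restricted eigenvalue.

module Claw where

  open import Defs
  open FiniteSets
  open import Data.Nat using (ℕ; zero; suc; _+_; _*_; _≤_; _<_; z≤n)
  open import Data.Nat.Properties
  open import Data.Nat.Tactic.RingSolver using (solve-∀)
  open import Data.List.Relation.Unary.All using (tabulate)

  module ClawBound {v : ℕ} (G : Graph v) {k ℓ μ : ℕ} (srg : IsStronglyRegular G k ℓ μ) (x : Fin v) where

    open IsStronglyRegular srg

    singleton : Fin v → Subset v
    singleton y z = does (y FinP.≟ z)

    common : Fin v → Subset v
    common y z = adj G x z ∧ adj G y z

    -- For y adjacent to x, the closed neighbourhood of y inside the neighbourhood of x; it has
    -- exactly ℓ + 1 elements.
    star : Fin v → Subset v
    star y = common y ∪ singleton y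

    count-star-≤ : ∀ {y} → adj G x y ≡ true → count (star y) ≤ suc ℓ
    count-star-≤ {y} xy = ≤-trans (count-∪ (common y) (singleton y)) (≤-trans
      (+-mono-≤ (≤-reflexive (adjacentλ x y xy)) (∈-singleton⇒≤1 (singleton y) y
        (λ z e → sym (isTrue⁻¹ (y FinP.≟ z) e))))
      (≤-reflexive (+-comm ℓ 1)))

    count-star-≥ : ∀ {y} → adj G x y ≡ true → suc ℓ ≤ count (star y)
    count-star-≥ {y} xy = subst (λ n → suc n ≤ count (star y)) (adjacentλ x y xy)
      (length-≤-count (star y) (tabulate fresh ∷ elems-unique (common y)) λ where
        z (here refl) → ∨-trueʳ (common y z) (isTrue (z FinP.≟ z) refl)
        z (there z∈) → ∨-trueˡ (singleton y z) (∈-elems⁻¹ (common y) z∈))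
      where
      fresh : ∀ {z} → z ∈ elems (common y) → y ≢ z
      fresh z∈ refl = true≢false (∧-trueʳ (adj G x y) (∈-elems⁻¹ (common y) z∈)) (irrefl G y)

    -- U is the part of the neighbourhood of x covered by the stars of a coclique with j elements.
    record Covered (j : ℕ) : Set where
      field
        U     : Subset v
        upper : count U ≤ j * suc ℓ
        lower : j * suc ℓ ≤ count U + j * j * μ
        meets : ∀ y → adj G x y ≡ true → U y ≡ false → count (star y ∩ U) ≤ j * μ
        U⊆N   : ∀ z → U z ≡ true → adj G x z ≡ true

    empty : Covered 0
    empty = record
      { U = ∅ ; upper = ≤-reflexive (count-∅ {v}) ; lower = z≤n
      ; meets = λ y _ _ → ≤-trans (count-mono (star y ∩ ∅) ∅ (λ z → ∧-trueʳ (star y z))) (≤-reflexive (count-∅ {v}))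
      ; U⊆N = λ _ () }

    -- Since j stars cover fewer than k vertices, some neighbour y of x is uncovered, so it is not
    -- adjacent to the earlier centres. Stars of two non-adjacent centres share only common
    -- neighbours of these, at most μ, so the new star loses at most jμ vertices to overlap.
    extend : ∀ {j} → j * suc ℓ < k → Covered j → Covered (suc j)
    extend {j} small c = record { U = U′ ; upper = upper′ ; lower = lower′ ; meets = meets′ ; U⊆N = U′⊆N }
      where
      open Covered c
      new : ∃ λ y → adj G x y ≡ true × U y ≡ false
      new = count-< (adj G x) U (subst (count U <_) (sym (regular x)) (≤-<-trans upper small))
      y : Fin v
      y = proj₁ new
      xy : adj G x y ≡ true
      xy = proj₁ (proj₂ new)
      U′ : Subset v
      U′ = star y ∪ U
      star⊆N : ∀ {y} z → adj G x y ≡ true → star y z ≡ true → adj G x z ≡ true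
      star⊆N {y} z xy e with ∨-split (common y z) e
      ... | inj₁ h = ∧-trueˡ (adj G x z) h
      ... | inj₂ h with isTrue⁻¹ (y FinP.≟ z) h
      ... | refl = xy
      U′⊆N : ∀ z → U′ z ≡ true → adj G x z ≡ true
      U′⊆N z e with ∨-split (star y z) e
      ... | inj₁ h = star⊆N z xy h
      ... | inj₂ h = U⊆N z h
      upper′ : count U′ ≤ suc j * suc ℓ
      upper′ = ≤-trans (count-∪ (star y) U) (+-mono-≤ (count-star-≤ xy) upper)
      lower′ : suc j * suc ℓ ≤ count U′ + suc j * suc j * μ
      lower′ = begin
        suc ℓ + j * suc ℓ                          ≤⟨ +-mono-≤ (count-star-≥ xy) lower ⟩
        count (star y) + (count U + j * j * μ)     ≡⟨ +-assoc (count (star y)) (count U) _ ⟨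
        count (star y) + count U + j * j * μ       ≤⟨ +-monoˡ-≤ (j * j * μ) (count-∪-∩ (star y) U) ⟩
        count U′ + count (star y ∩ U) + j * j * μ  ≤⟨ +-monoˡ-≤ (j * j * μ)
          (+-monoʳ-≤ (count U′) (meets y xy (proj₂ (proj₂ new)))) ⟩
        count U′ + j * μ + j * j * μ               ≤⟨ m≤m+n _ (suc j * μ) ⟩
        count U′ + j * μ + j * j * μ + suc j * μ   ≡⟨ collect (count U′) j μ ⟩
        count U′ + suc j * suc j * μ               ∎
        where
        open ≤-Reasoning
        collect : ∀ a j m → a + j * m + j * j * m + (1 + j) * m ≡ a + (1 + j) * (1 + j) * m
        collect = solve-∀
      meets′ : ∀ y′ → adj G x y′ ≡ true → U′ y′ ≡ false → count (star y′ ∩ U′) ≤ suc j * μ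
      meets′ y′ xy′ out = begin
        count (star y′ ∩ U′)                             ≤⟨ count-mono (star y′ ∩ U′)
          ((star y′ ∩ star y) ∪ (star y′ ∩ U)) (λ z → distribute (star y′ z) (star y z) (U z)) ⟩
        count ((star y′ ∩ star y) ∪ (star y′ ∩ U))       ≤⟨ count-∪ (star y′ ∩ star y) (star y′ ∩ U) ⟩
        count (star y′ ∩ star y) + count (star y′ ∩ U)
          ≤⟨ +-mono-≤ new-overlap (meets y′ xy′ (∨-falseʳ (star y y′) out)) ⟩
        μ + j * μ                                        ∎
        where
        open ≤-Reasoning
        distribute : ∀ a b c → a ∧ (b ∨ c) ≡ true → (a ∧ b) ∨ (a ∧ c) ≡ true
        distribute true b c e = e
        outside : star y y′ ≡ true → ⊥
        outside e = true≢false (∨-trueˡ (U y′) e) out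
        nonadjacent : adj G y′ y ≡ false
        nonadjacent = ¬true⇒false λ e → outside (∨-trueˡ (singleton y y′) (∧-true xy′ (trans (symmetric G y y′) e)))
        new-overlap : count (star y′ ∩ star y) ≤ μ
        new-overlap = ≤-trans (count-mono (star y′ ∩ star y) (λ z → adj G y′ z ∧ adj G y z) both)
          (≤-reflexive (nonadjμ y′ y (λ { refl → outside (∨-trueʳ (common y y) (isTrue (y FinP.≟ y) refl)) })
            nonadjacent))
          where
          both : ∀ z → star y′ z ∧ star y z ≡ true → adj G y′ z ∧ adj G y z ≡ true
          both z e with ∨-split (common y′ z) (∧-trueˡ (star y′ z) e) | ∨-split (common y z) (∧-trueʳ (star y′ z) e)
          ... | inj₁ h′ | inj₁ h = ∧-true (∧-trueʳ (adj G x z) h′) (∧-trueʳ (adj G x z) h)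
          ... | inj₂ h′ | _ with isTrue⁻¹ (y′ FinP.≟ z) h′
          ... | refl = ⊥-elim (outside (∧-trueʳ (star y′ y′) e))
          both z e | inj₁ h′ | inj₂ h with isTrue⁻¹ (y FinP.≟ z) h
          ... | refl = ⊥-elim (true≢false (∧-trueʳ (adj G x y) h′) nonadjacent)

    cover : ∀ j → j * suc ℓ < k + suc ℓ → Covered j
    cover zero _ = empty
    cover (suc j) h = extend j<k (cover j (<-≤-trans j<k (m≤m+n k (suc ℓ))))
      where
      j<k : j * suc ℓ < k
      j<k = +-cancelˡ-< (suc ℓ) _ _ (subst (suc ℓ + j * suc ℓ <_) (+-comm k (suc ℓ)) h)

    -- A coclique with s + 1 vertices inside the neighbourhood of x: its stars have size ℓ + 1 and
    -- small overlaps, yet must fit into k vertices.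
    claw-bound : ∀ s → s * suc ℓ < k → suc s * suc ℓ ≤ k + suc s * suc s * μ
    claw-bound s h = ≤-trans (lower C) (+-monoˡ-≤ _ (subst (count (U C) ≤_) (regular x) (count-mono (U C) (adj G x)
      (U⊆N C))))
      where
      open Covered
      C : Covered (suc s)
      C = cover (suc s) (subst (_< k + suc ℓ) (+-comm (s * suc ℓ) (suc ℓ)) (+-monoˡ-< (suc ℓ) h))

  -- Integrality enters through k − s(ℓ + 1) = (s − 1)(s − μ): this is positive, so the claw bound applies with s + 1
  -- leaves, but it does not grow with r.
  largest-eigenvalue-bound : ∀ {k ℓ μ r s e} → s ≡ μ + e → 1 ≤ μ → 1 ≤ e → k ≡ μ + r * s → ℓ + s ≡ μ + r →
    (∀ t → t * suc ℓ < k → suc t * suc ℓ ≤ k + suc t * suc t * μ) → r ≤ 7 * (s * s * s)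
  largest-eigenvalue-bound {k} {ℓ} {μ} {r} {s} {e} s≡ μ≥1 e≥1 k≡ ℓ≡ claw = begin
    r                                             ≡⟨ r≡ ⟩
    ℓ + e                                         ≤⟨ +-monoˡ-≤ e (≤-trans (m≤n+m ℓ (suc s)) ℓ-bound) ⟩
    μ + e * s + suc s * suc s * μ + e
      ≤⟨ +-mono-≤ (+-mono-≤ (+-mono-≤ μ≤s³ (≤-trans (*-monoˡ-≤ s e≤s) s²≤s³)) (*-mono-≤ (*-mono-≤ s+1≤2s s+1≤2s) μ≤s))
      e≤s³ ⟩
    s * s * s + s * s * s + (2 * s) * (2 * s) * s + s * s * s  ≡⟨ collect s ⟩
    7 * (s * s * s)                               ∎
    where
    open ≤-Reasoning
    r≡ : r ≡ ℓ + e
    r≡ = +-cancelˡ-≡ μ r (ℓ + e) (trans (sym ℓ≡) (trans (cong (ℓ +_) s≡) (shuffle ℓ μ e)))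
      where
      shuffle : ∀ l m e → l + (m + e) ≡ m + (l + e)
      shuffle = solve-∀
    μ≤s : μ ≤ s
    μ≤s = subst (μ ≤_) (sym s≡) (m≤m+n μ e)
    e≤s : e ≤ s
    e≤s = subst (e ≤_) (sym s≡) (m≤n+m e μ)
    s≥1 : 1 ≤ s
    s≥1 = ≤-trans μ≥1 μ≤s
    s≤s² : s ≤ s * s
    s≤s² = subst (_≤ s * s) (*-identityʳ s) (*-monoʳ-≤ s s≥1)
    s²≤s³ : s * s ≤ s * s * s
    s²≤s³ = subst (_≤ s * s * s) (*-identityʳ (s * s)) (*-monoʳ-≤ (s * s) s≥1)
    μ≤s³ : μ ≤ s * s * s
    μ≤s³ = ≤-trans μ≤s (≤-trans s≤s² s²≤s³)
    e≤s³ : e ≤ s * s * s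
    e≤s³ = ≤-trans e≤s (≤-trans s≤s² s²≤s³)
    s+1≤2s : suc s ≤ 2 * s
    s+1≤2s = subst (suc s ≤_) (cong (s +_) (sym (+-identityʳ s))) (+-monoˡ-≤ s s≥1)
    collect : ∀ s → s * s * s + s * s * s + (2 * s) * (2 * s) * s + s * s * s ≡ 7 * (s * s * s)
    collect = solve-∀
    k-value : k ≡ μ + (ℓ + e) * s
    k-value = trans k≡ (cong (λ t → μ + t * s) r≡)
    few : s * suc ℓ < k
    few = subst₂ _<_ (sym (lhs s ℓ)) (sym (trans k-value (rhs μ ℓ e s))) (+-monoʳ-< (s * ℓ) gap)
      where
      lhs : ∀ s l → s * (1 + l) ≡ s * l + s
      lhs = solve-∀
      rhs : ∀ m l e s → m + (l + e) * s ≡ s * l + (m + e * s)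
      rhs = solve-∀
      gap : s < μ + e * s
      gap = subst (_< μ + e * s) (sym s≡) (+-monoʳ-< μ (begin-strict
        e          <⟨ m<n+m e (≤-trans (≤-reflexive refl) e≥1) ⟩
        e + e      ≡⟨ cong (e +_) (sym (+-identityʳ e)) ⟩
        2 * e      ≡⟨ *-comm 2 e ⟩
        e * 2      ≤⟨ *-monoʳ-≤ e (subst (2 ≤_) (sym s≡) (+-mono-≤ μ≥1 e≥1)) ⟩
        e * s      ∎))
    -- Subtracting sℓ from both sides of the claw bound removes the growing part of k = sℓ + μ + es,
    -- so ℓ is bounded in terms of s, μ and e alone.
    ℓ-bound : suc s + ℓ ≤ μ + e * s + suc s * suc s * μ
    ℓ-bound = +-cancelˡ-≤ (s * ℓ) _ _ (subst₂ _≤_ (lhs s ℓ) (trans (cong (_+ suc s * suc s * μ) k-value)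
      (rhs μ ℓ e s (suc s * suc s * μ))) (claw s few))
      where
      lhs : ∀ s l → (1 + s) * (1 + l) ≡ s * l + (1 + s + l)
      lhs = solve-∀
      rhs : ∀ m l e s t → m + (l + e) * s + t ≡ s * l + (m + e * s + t)
      rhs = solve-∀

-- Vertex expansion from the eigenvalue bound.

module Mixing where

  open import Defs
  open FiniteSets
  open IntegerSums
  open SRG
  open Eigenvalues
  open Spectrum
  open import Data.Nat as ℕ using (ℕ; suc)
  open import Data.Integer using (ℤ; +_; _+_; _*_; -_; _-_; _≤_; _<_; 0ℤ; 1ℤ; nonNegative)
  open import Data.Integer.Properties as ℤP using (≤-trans; pos-+; pos-*)
  open import Data.Integer.Tactic.RingSolver using (solve-∀)

  neighbourhood : ∀ {v} → Graph v → Subset v → Subset v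
  neighbourhood G S w = ∃ᵇ (λ x → S x ∧ adj G x w)

  module ExpanderMixing {v : ℕ} (G : Graph v) {k ℓ μ : ℕ} (srg : IsStronglyRegular G k ℓ μ)
    (r s : ℕ) (τ≡ : AdjacencyMatrix.τ G srg ≡ + r - + s) (κ≡ : AdjacencyMatrix.κ G srg ≡ + r * + s) (s≥1 : 1 ℕ.≤ s)
    {θ : ℕ} (r≤θ : r ℕ.≤ θ) (s≤θ : s ℕ.≤ θ) where

    open AdjacencyMatrix G srg
    open Restricted G srg
    open Eigen r s τ≡ κ≡ s≥1

    -- Let d(y) be the number of neighbours of y in S. The vector v·1_S - |S|·1 is orthogonal to 1,
    -- so the eigenvalue bound θ limits Σd². Since d has sum k|S| and vanishes outside the
    -- neighbourhood of S, Cauchy-Schwarz limits Σd² from below by (k|S|)²/N.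
    expansion : ∀ S x → S x ≡ true → let N = count (neighbourhood G S) in
      k ℕ.* k ℕ.* count S ℕ.* v ℕ.≤ N ℕ.* (θ ℕ.* θ ℕ.* v ℕ.+ k ℕ.* k ℕ.* count S)
    expansion S x x∈S = ℤP.drop‿+≤+ (subst₂ _≤_ (sym lhs) (sym rhs)
      (0≤-⇒≤ (*-cancel-pos-nonneg (*-pos 0<a 0<V) (subst (0ℤ ≤_) (combine K V N Θ a ∑d²)
        (+-nonneg (*-nonneg 0≤N variance) (*-nonneg (*-nonneg (0≤pos v) (0≤pos v)) cauchy))))))
      where
      N K V Θ a : ℤ
      N = + count (neighbourhood G S)
      K = + k
      V = + v
      Θ = + θ * + θ
      a = + count S
      lhs : + (k ℕ.* k ℕ.* count S ℕ.* v) ≡ K * K * a * V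
      lhs = trans (pos-* (k ℕ.* k ℕ.* count S) v)
        (cong (_* V) (trans (pos-* (k ℕ.* k) (count S)) (cong (_* a) (pos-* k k))))
      rhs : + (count (neighbourhood G S) ℕ.* (θ ℕ.* θ ℕ.* v ℕ.+ k ℕ.* k ℕ.* count S)) ≡ N * (Θ * V + K * K * a)
      rhs = trans (pos-* (count (neighbourhood G S)) _) (cong (N *_) (trans (pos-+ (θ ℕ.* θ ℕ.* v) _)
        (cong₂ _+_ (trans (pos-* (θ ℕ.* θ) v) (cong (_* V) (pos-* θ θ))) (trans (pos-* (k ℕ.* k) (count S))
          (cong (_* a) (pos-* k k))))))
      0<a : 0ℤ < a
      0<a = 0<pos (count-pos S x x∈S)
      0<V : 0ℤ < V
      0<V = inhabited x
        where
        inhabited : ∀ {n} → Fin n → 0ℤ < + n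
        inhabited {suc n} _ = 0<pos (ℕ.s≤s ℕ.z≤n)
      0≤N : 0ℤ ≤ N
      0≤N = 0≤pos (count (neighbourhood G S))
      1S d u : Fin v → ℤ
      1S = indicator S
      d = A· 1S
      u y = V * 1S y + (- a) * 1ℤ
      ∑d² : ℤ
      ∑d² = norm² d
      total-u : total u ≡ 0ℤ
      total-u = trans (sum-linear₂ V (- a) 1S (λ _ → 1ℤ))
        (trans (cong₂ (λ p q → V * p + (- a) * q) (total-indicator S) (sum-const v 1ℤ)) (cancel V a))
        where
        cancel : ∀ V a → V * a + (- a) * (V * 1ℤ) ≡ 0ℤ
        cancel = solve-∀
      norm²-u : norm² u ≡ V * a * (V - a)
      norm²-u = trans (sum-cong (λ y → expand V a (1S y))) (trans (sum-linear₃ (V * V) (- (V * a + V * a)) (a * a)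
        (λ y → 1S y * 1S y) 1S (λ _ → 1ℤ))
        (trans (cong₂ _+_ (cong₂ (λ p q → V * V * p + - (V * a + V * a) * q) (norm²-indicator S) (total-indicator S))
          (cong (a * a *_) (sum-const v 1ℤ))) (collect V a)))
        where
        expand : ∀ V a e → (V * e + (- a) * 1ℤ) * (V * e + (- a) * 1ℤ) ≡ V * V * (e * e) + - (V * a + V * a) * e + a *
          a * 1ℤ
        expand = solve-∀
        collect : ∀ V a → V * V * a + - (V * a + V * a) * a + a * a * (V * 1ℤ) ≡ V * a * (V - a)
        collect = solve-∀
      A·u : ∀ y → (A· u) y ≡ V * d y + (- (a * K)) * 1ℤ
      A·u y = trans (sum-cong (λ z → distribute (A y z) V (1S z) a)) (trans (sum-linear₂ V (- a) (λ z → A y z * 1S z)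
        (A y))
        (trans (cong (λ t → V * d y + (- a) * t) (row-sum y)) (collect (V * d y) a K)))
        where
        distribute : ∀ x V e a → x * (V * e + (- a) * 1ℤ) ≡ V * (x * e) + (- a) * x
        distribute = solve-∀
        collect : ∀ s a k → s + (- a) * k ≡ s + (- (a * k)) * 1ℤ
        collect = solve-∀
      total-d : total d ≡ K * a
      total-d = trans (total-A· 1S) (cong (K *_) (total-indicator S))
      norm²-A·u : norm² (A· u) ≡ V * V * ∑d² - V * (K * K * (a * a))
      norm²-A·u = trans (sum-cong (λ y → trans (cong (λ t → t * t) (A·u y)) (expand V (a * K) (d y))))
        (trans (sum-linear₃ (V * V) (- (V * (a * K) + V * (a * K))) (a * K * (a * K)) (λ y → d y * d y) d (λ _ → 1ℤ))
          (trans (cong₂ (λ p q → V * V * ∑d² + - (V * (a * K) + V * (a * K)) * p + a * K * (a * K) * q) total-d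
            (sum-const v 1ℤ)) (collect V a K ∑d²)))
        where
        expand : ∀ V b e → (V * e + (- b) * 1ℤ) * (V * e + (- b) * 1ℤ) ≡ V * V * (e * e) + - (V * b + V * b) * e + b *
          b * 1ℤ
        expand = solve-∀
        collect : ∀ V a K q → V * V * q + - (V * (a * K) + V * (a * K)) * (K * a) + a * K * (a * K) * (V * 1ℤ) ≡ V * V
          * q - V * (K * K * (a * a))
        collect = solve-∀
      variance : 0ℤ ≤ Θ * (V * a * V) - (V * V * ∑d² - V * (K * K * (a * a)))
      variance = ≤⇒0≤- (≤-trans (subst₂ _≤_ norm²-A·u (cong (Θ *_) norm²-u) (norm²-A·-≤ r≤θ s≤θ u total-u))
        (ℤP.*-monoˡ-≤-nonNeg Θ {{nonNegative (*-nonneg (0≤pos θ) (0≤pos θ))}}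
          (≤-from-difference (*-nonneg (*-nonneg (0≤pos v) (0≤pos (count S))) (0≤pos (count S))) (difference V a))))
        where
        difference : ∀ V a → V * a * V - V * a * (V - a) ≡ V * a * a
        difference = solve-∀
      -- The degrees into S vanish outside the neighbourhood of S.
      cauchy : 0ℤ ≤ N * ∑d² - K * a * (K * a)
      cauchy = ≤⇒0≤- (subst₂ _≤_ (cong (λ t → t * t) supported) (cong (_* ∑d²) (norm²-indicator (neighbourhood G S)))
        (cauchy-schwarz (indicator (neighbourhood G S)) d))
        where
        supported : ∑[ y < v ] (indicator (neighbourhood G S) y * d y) ≡ K * a
        supported = trans (sum-cong inside) total-d
          where
          inside : ∀ y → indicator (neighbourhood G S) y * d y ≡ d y
          inside y with neighbourhood G S y in eq
          ... | true = ℤP.*-identityˡ (d y)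
          ... | false = trans (ℤP.*-zeroˡ (d y)) (sym (trans (sum-cong vanish) (sum-zero v)))
            where
            vanish : ∀ z → A y z * 1S z ≡ 0ℤ
            vanish z with S z in ez | adj G y z in ea
            ... | false | true = refl
            ... | false | false = refl
            ... | true | false = refl
            ... | true | true = ⊥-elim (true≢false (∃ᵇ-intro (λ x → S x ∧ adj G x y) z
                  (∧-true ez (trans (symmetric G z y) ea))) eq)
      combine : ∀ K V N Θ a q → N * (Θ * (V * a * V) - (V * V * q - V * (K * K * (a * a)))) + V * V *
        (N * q - K * a * (K * a))
              ≡ a * V * (N * (Θ * V + K * K * a) - K * K * a * V)
      combine = solve-∀

-- Pósa rotations.

module Rotations where

  open import Defs using (Graph; adj; count)
  open FiniteSets
  open Mixing using (neighbourhood)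
  open Paths
  open import Data.Nat using (ℕ; suc; _+_; _*_; _≤_)
  open import Data.Nat.Properties using (≤-trans; ≤-reflexive)
  open import Data.List.Membership.Propositional.Properties
  open import Data.Unit using (⊤; tt)

  module _ {A : Set} where

    consec-into : ∀ {x xs} {w : A} → w ∈ xs → ∃ λ a → Consec (x ∷ xs) a w
    consec-into {x} (here refl) = x , here
    consec-into (there w∈) with consec-into w∈
    ... | a , c = a , there c

    consec-from : ∀ {xs} {w : A} → w ∈ xs → Last xs w ⊎ ∃ λ b → Consec xs w b
    consec-from {x ∷ []} (here refl) = inj₁ here
    consec-from {x ∷ y ∷ ys} (here refl) = inj₂ (y , here)
    consec-from (there w∈) with consec-from w∈
    ... | inj₁ l = inj₁ (there l)
    ... | inj₂ (b , c) = inj₂ (b , there c)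

    position : ∀ {x xs} {w : A} → w ∈ x ∷ xs →
               w ≡ x ⊎ Last (x ∷ xs) w ⊎ ∃₂ λ a b → Consec (x ∷ xs) a w × Consec (x ∷ xs) w b
    position (here refl) = inj₁ refl
    position (there w∈) with consec-into w∈ | consec-from (there w∈)
    ... | a , c | inj₁ l = inj₂ (inj₁ l)
    ... | a , c | inj₂ (b , d) = inj₂ (inj₂ (a , b , c , d))

    last-exists : ∀ x (xs : List A) → ∃ λ y → Last (x ∷ xs) y
    last-exists x [] = x , here
    last-exists x (y ∷ ys) with last-exists y ys
    ... | z , l = z , there l

  module _ {v : ℕ} where

    -- Elements without a successor (predecessor) in the list are fixed.
    nxt prv : List (Fin v) → Fin v → Fin v
    nxt [] a = a
    nxt (x ∷ []) a = a
    nxt (x ∷ y ∷ ys) a = if does (x FinP.≟ a) then y else nxt (y ∷ ys) a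
    prv [] a = a
    prv (x ∷ []) a = a
    prv (x ∷ y ∷ ys) a = if does (y FinP.≟ a) then x else prv (y ∷ ys) a

    nxt-consec : ∀ {xs a b} → Unique xs → Consec xs a b → nxt xs a ≡ b
    nxt-consec {a = a} u here with a FinP.≟ a
    ... | yes _ = refl
    ... | no a≢a = ⊥-elim (a≢a refl)
    nxt-consec {x ∷ y ∷ ys} {a} u@(_ ∷ u′) (there c) with x FinP.≟ a
    ... | yes refl = ⊥-elim (∉-unique u (consec-∈ˡ c) refl)
    ... | no _ = nxt-consec u′ c

    prv-consec : ∀ {xs a b} → Unique xs → Consec xs a b → prv xs b ≡ a
    prv-consec {b = b} u here with b FinP.≟ b
    ... | yes _ = refl
    ... | no b≢b = ⊥-elim (b≢b refl)
    prv-consec {x ∷ y ∷ ys} {b = b} (_ ∷ u) (there c) with y FinP.≟ b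
    ... | yes refl = ⊥-elim (no-pred u c)
      where
      no-pred : ∀ {y : Fin v} {ys a} → Unique (y ∷ ys) → Consec (y ∷ ys) a y → ⊥
      no-pred u here = ∉-unique u (here refl) refl
      no-pred u (there c) = ∉-unique u (consec-∈ʳ c) refl
    ... | no _ = prv-consec u c

    consec-nxt : ∀ xs {a} → nxt xs a ≢ a → Consec xs a (nxt xs a)
    consec-nxt [] h = ⊥-elim (h refl)
    consec-nxt (x ∷ []) h = ⊥-elim (h refl)
    consec-nxt (x ∷ y ∷ ys) {a} h = step (x FinP.≟ a) h (consec-nxt (y ∷ ys))
      where
      step : (d : Dec (x ≡ a)) → (if does d then y else nxt (y ∷ ys) a) ≢ a →
             (nxt (y ∷ ys) a ≢ a → Consec (y ∷ ys) a (nxt (y ∷ ys) a)) →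
             Consec (x ∷ y ∷ ys) a (if does d then y else nxt (y ∷ ys) a)
      step (yes refl) _ _ = here
      step (no _) h rec = there (rec h)

    consec-prv : ∀ xs {a} → prv xs a ≢ a → Consec xs (prv xs a) a
    consec-prv [] h = ⊥-elim (h refl)
    consec-prv (x ∷ []) h = ⊥-elim (h refl)
    consec-prv (x ∷ y ∷ ys) {a} h = step (y FinP.≟ a) h (consec-prv (y ∷ ys))
      where
      step : (d : Dec (y ≡ a)) → (if does d then x else prv (y ∷ ys) a) ≢ a →
             (prv (y ∷ ys) a ≢ a → Consec (y ∷ ys) (prv (y ∷ ys) a) a) →
             Consec (x ∷ y ∷ ys) (if does d then x else prv (y ∷ ys) a) a
      step (yes refl) _ _ = here
      step (no _) h rec = there (rec h)

    -- The counting half of Pósa's lemma: S will be a set of endpoints, W a neighbourhood, and f, g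
    -- the two neighbour maps along the path.
    count-≤-images : (S W : Subset v) (f g : Fin v → Fin v) (extra : List (Fin v)) →
      (∀ w → W w ≡ true → w ∈ extra ⊎ ∃ λ s → S s ≡ true × w ∈ s ∷ f s ∷ g s ∷ []) →
      count W ≤ length extra + count S * 3
    count-≤-images S W f g extra h = ≤-trans
      (count-≤-length W (extra ++ concatMap images (elems S)) (λ w e → inside w (h w e)))
      (≤-reflexive (trans (length-++ extra) (cong (length extra +_) (length-concatMap images 3 (λ _ → refl)
        (elems S)))))
      where
      images : Fin v → List (Fin v)
      images s = s ∷ f s ∷ g s ∷ []
      inside : ∀ w → w ∈ extra ⊎ (∃ λ s → S s ≡ true × w ∈ images s) → w ∈ extra ++ concatMap images (elems S)
      inside w (inj₁ w∈) = ∈-++⁺ˡ w∈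
      inside w (inj₂ (s , s∈ , w∈)) = ∈-++⁺ʳ extra (∈-concatMap images (∈-elems S s∈) w∈)

  module Rotation {v : ℕ} (G : Graph v) where

    open GraphPaths G

    seg-position : ∀ {x y xs w} → Seg x y xs → w ∈ xs →
                   w ≡ x ⊎ w ≡ y ⊎ ∃₂ λ a b → Consec xs a w × Consec xs w b
    seg-position [-] (here e) = inj₁ e
    seg-position s@(_ ∷ _) w∈ with position w∈
    ... | inj₁ e = inj₁ e
    ... | inj₂ (inj₁ last) = inj₂ (inj₁ (last-unique last (seg-last s)))
    ... | inj₂ (inj₂ interior) = inj₂ (inj₂ interior)

    -- `D` restricts which vertices may become endpoints: any vertex in the first rounds, later only
    -- the admissible vertices of a zone.
    module From {e₀ l : Fin v} {P : List (Fin v)} (path : Seg e₀ l P) (uniq : Unique P) (D : Fin v → Set) where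

      -- Pósa rotations at the first vertex.
      data Reach : ℕ → Fin v → List (Fin v) → Set where
        start  : ∀ {n} → Reach n e₀ P
        rotate : ∀ {n e z w A B} → Reach n e (A ++ w ∷ B) → Seg e z A → R e w → Seg w l (w ∷ B) → D z →
                 Reach (suc n) z (reverse A ++ w ∷ B)

      Head : ℕ → Fin v → Set
      Head n x = ∃ λ Q → Reach n x Q

      reach-seg : ∀ {n e Q} → Reach n e Q → Seg e l Q
      reach-seg start = path
      reach-seg (rotate _ s r t _) = seg-join (seg-reverse s) r t

      reach-↭ : ∀ {n e Q} → Reach n e Q → Q ↭ P
      reach-↭ start = ↭-refl
      reach-↭ (rotate {w = w} {A} {B} q _ _ _ _) = ↭-trans (++⁺ʳ (w ∷ B) (↭-reverse A)) (reach-↭ q)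

      reach-suc : ∀ {n e Q} → Reach n e Q → Reach (suc n) e Q
      reach-suc start = start
      reach-suc (rotate q s r t d) = rotate (reach-suc q) s r t d

      head-suc : ∀ {n x} → Head n x → Head (suc n) x
      head-suc (Q , q) = Q , reach-suc q

      reach-unique : ∀ {n e Q} → Reach n e Q → Unique Q
      reach-unique q = Unique-↭ (↭-sym (reach-↭ q)) uniq

      reach-head : ∀ {n e Q} → Reach n e Q → e ≡ e₀ ⊎ D e
      reach-head start = inj₁ refl
      reach-head (rotate _ _ _ _ d) = inj₂ d

      -- A rotation breaks only the pair z, w, and z becomes the new endpoint. So a pair of
      -- neighbours on the original path stays together until one of the two has been an endpoint.
      intact : ∀ {n e Q a b} → Reach n e Q → Neighbouring P a b → Neighbouring Q a b ⊎ Head n a ⊎ Head n b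
      intact start c = inj₁ c
      intact q₀@(rotate {z = z} {w} {A} {B} q s r t d) c with intact q c
      ... | inj₂ (inj₁ h) = inj₂ (inj₁ (head-suc h))
      ... | inj₂ (inj₂ h) = inj₂ (inj₂ (head-suc h))
      ... | inj₁ (inj₁ c′) with consec-split A c′
      ... | inj₁ c″ = inj₁ (neighbouring-++ˡ (neighbouring-reverse (inj₁ c″)))
      ... | inj₂ (inj₁ (la , refl)) with last-unique la (seg-last s)
      ... | refl = inj₂ (inj₁ (_ , q₀))
      intact q₀@(rotate {z = z} {w} {A} {B} q s r t d) c | inj₁ (inj₁ c′) | inj₂ (inj₂ c″) = inj₁
        (neighbouring-++ʳ (reverse A) (inj₁ c″))
      intact q₀@(rotate {z = z} {w} {A} {B} q s r t d) c | inj₁ (inj₂ c′) with consec-split A c′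
      ... | inj₁ c″ = inj₁ (neighbouring-++ˡ (neighbouring-reverse (inj₂ c″)))
      ... | inj₂ (inj₁ (la , refl)) with last-unique la (seg-last s)
      ... | refl = inj₂ (inj₂ (_ , q₀))
      intact q₀@(rotate {z = z} {w} {A} {B} q s r t d) c | inj₁ (inj₂ c′) | inj₂ (inj₂ c″) = inj₁
        (neighbouring-++ʳ (reverse A) (inj₂ c″))

      -- Pósa's lemma. If the pairs around w are intact, then w still sits between a and b in Q, in
      -- one of two orientations, and rotating along the edge to w makes its predecessor in Q, one
      -- of a and b, an endpoint.
      growth : ∀ {n e Q w a b} → Reach n e Q → R e w → Consec P a w → Consec P w b → D a → D b →
               Head n w ⊎ Head (suc n) a ⊎ Head (suc n) b
      growth {w = w} {a} {b} q r aw wb da db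
        with ∈-∃++ (∈-resp-↭ (↭-sym (reach-↭ q)) (consec-∈ʳ aw))
      ... | [] , B , refl = ⊥-elim (R-irrefl r (seg-head (reach-seg q)))
      ... | c ∷ A , B , refl with seg-split c A (reach-seg q) | intact q (inj₁ aw) | intact q (inj₁ wb)
      ... | _ | inj₂ (inj₁ h) | _ = inj₂ (inj₁ (head-suc h))
      ... | _ | inj₂ (inj₂ h) | _ = inj₁ h
      ... | _ | inj₁ _ | inj₂ (inj₁ h) = inj₁ h
      ... | _ | inj₁ _ | inj₂ (inj₂ h) = inj₂ (inj₂ (head-suc h))
      ... | z , s , _ , t | inj₁ (inj₁ c₁) | inj₁ _
        with consec-pred-unique (reach-unique q) c₁ (consec-join {ys = B} (seg-last s))
      ... | refl = inj₂ (inj₁ (_ , rotate q s r t da))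
      growth {w = w} {a} {b} q r aw wb da db | c ∷ A , B , refl | z , s , _ , t | inj₁ (inj₂ c₁) | inj₁ (inj₂ c₂)
        with consec-pred-unique (reach-unique q) c₂ (consec-join {ys = B} (seg-last s))
      ... | refl = inj₂ (inj₂ (_ , rotate q s r t db))
      growth {w = w} {a} {b} q r aw wb da db | c ∷ A , B , refl | z , s , _ , t | inj₁ (inj₂ c₁) | inj₁ (inj₁ c₂)
        with consec-succ-unique (reach-unique q) c₁ c₂
      ... | refl = ⊥-elim (consec-asym uniq aw wb)

    module Unrestricted {e₀ l : Fin v} {P : List (Fin v)} (path : Seg e₀ l P) (uniq : Unique P)
      (closed : ∀ {x Q w} → Q ↭ P → Seg x l Q → R x w → w ∈ P) where

      open From path uniq (λ _ → ⊤) public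

      -- Every neighbour w of an endpoint lies on the path, and by `growth` w or one of its two path
      -- neighbours is an endpoint one round later. The extra 1 is the fixed end l, which has no
      -- successor.
      neighbourhood-bound : ∀ {n} (T T′ : Subset v) → (∀ x → T x ≡ true → Head n x) → (∀ x → Head (suc n) x → T′ x ≡
        true) →
                            count (neighbourhood G T) ≤ 1 + count T′ * 3
      neighbourhood-bound {n} T T′ T⇒ ⇒T′ = count-≤-images T′ (neighbourhood G T) (nxt P) (prv P) (l ∷ []) covered
        where
        covered : ∀ w → neighbourhood G T w ≡ true → w ∈ l ∷ [] ⊎ ∃ λ s → T′ s ≡ true × w ∈ s ∷ nxt P s ∷ prv P s ∷ []
        covered w e with ∃ᵇ-elim (λ x → T x ∧ adj G x w) e
        ... | x , xw with T⇒ x (∧-trueˡ (T x) xw) | ∧-trueʳ (T x) xw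
        ... | Q , q | r with seg-position path (closed (reach-↭ q) (reach-seg q) r)
        ... | inj₁ refl = inj₂ (w , ⇒T′ w (P , start) , here refl)
        ... | inj₂ (inj₁ refl) = inj₁ (here refl)
        ... | inj₂ (inj₂ (a , b , aw , wb)) with growth q r aw wb tt tt
        ... | inj₁ h = inj₂ (w , ⇒T′ w (head-suc h) , here refl)
        ... | inj₂ (inj₁ h) = inj₂ (a , ⇒T′ a h , there (here (sym (nxt-consec uniq aw))))
        ... | inj₂ (inj₂ h) = inj₂ (b , ⇒T′ b h , there (there (here (sym (prv-consec uniq wb)))))

-- Arcs that contain an expanding zone.

module Zones where

  open import Defs using (Graph; adj; count)
  open FiniteSets
  open Mixing using (neighbourhood)
  open Paths
  open Rotations
  open import Data.Nat using (ℕ; zero; suc; _+_; _*_; _≤_; _<_; z≤n; _<?_; _≤?_)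
  open import Data.Nat.Properties
  open import Data.Nat.Tactic.RingSolver using (solve-∀)
  open import Data.List.Membership.Propositional.Properties

  module Zone {v : ℕ} (G : Graph v) (b : ℕ) where

    open GraphPaths G

    N : Subset v → Subset v
    N = neighbourhood G

    N-intro : ∀ (S : Subset v) {x w} → S x ≡ true → R x w → N S w ≡ true
    N-intro S {x} {w} sx r = ∃ᵇ-intro (λ x → S x ∧ adj G x w) x (∧-true sx r)

    N-elim : ∀ (S : Subset v) {w} → N S w ≡ true → ∃ λ x → S x ≡ true × R x w
    N-elim S {w} e = let x , p = ∃ᵇ-elim (λ x → S x ∧ adj G x w) e in x , ∧-trueˡ (S x) p , ∧-trueʳ (S x) p

    -- `D` holds the admissible endpoints, `I` the vertices both of whose neighbours on the arc lie
    -- in `D`, so that rotating at a vertex of `I` stays admissible. The maps `f` and `g` are the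
    -- two neighbour maps, left unordered so that reversing the arc keeps the zone.
    record Zone (A : List (Fin v)) : Set where
      field
        D I       : Subset v
        f g       : Fin v → Fin v
        interior  : ∀ w → I w ≡ true → ∃₂ λ a c → Consec A a w × Consec A w c × D a ≡ true × D c ≡ true ×
                    (w ≡ f a ⊎ w ≡ g a) × (w ≡ f c ⊎ w ≡ g c)
        expanding : ∀ S → (∀ x → S x ≡ true → D x ≡ true) → 1 ≤ count S → count S ≤ b → 10 * count S < count (N S ∩ I)
        large     : b ≤ count I

    open Zone

    zone-reverse : ∀ {A} → Zone A → Zone (reverse A)
    zone-reverse z = record
      { D = D z ; I = I z ; f = f z ; g = g z ; expanding = expanding z ; large = large z
      ; interior = λ w w∈ → let a , c , aw , wc , da , dc , wa , w′ = interior z w w∈ in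
          c , a , consec-reverse wc , consec-reverse aw , dc , da , w′ , wa }

    module _ (b≥1 : 1 ≤ b) (joined : ∀ S → b ≤ count S → v < count (N S) + b) where

      count-∩-joined : ∀ S T → b ≤ count S → count T < count (N S ∩ T) + b
      count-∩-joined S T h = +-cancelˡ-< v _ _ (begin-strict
        v + count T                                ≡⟨ +-comm v (count T) ⟩
        count T + v                                <⟨ +-monoʳ-< (count T) (joined S h) ⟩
        count T + (count (N S) + b)                ≡⟨ +-assoc (count T) (count (N S)) b ⟨
        count T + count (N S) + b                  ≡⟨ cong (_+ b) (+-comm (count T) (count (N S))) ⟩
        count (N S) + count T + b                  ≤⟨ +-monoˡ-≤ b (count-∪-∩ (N S) T) ⟩
        count (N S ∪ T) + count (N S ∩ T) + b
          ≤⟨ +-monoˡ-≤ b (+-monoˡ-≤ _ (≤-trans (count-mono (N S ∪ T) full (λ _ _ → refl)) (≤-reflexive count-full))) ⟩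
        v + count (N S ∩ T) + b                    ≡⟨ +-assoc v _ b ⟩
        v + (count (N S ∩ T) + b)                  ∎)
        where open ≤-Reasoning

      module _ (A : List (Fin v)) (uniq : Unique A) (long : 30 * b ≤ length A) where

        -- `prv` and `nxt` fix elements without a neighbour on that side, so the last two clauses
        -- exclude the ends of the arc and all vertices off it.
        inner : Subset v → Subset v
        inner Z w = (not (Z (prv A w)) ∧ not (Z (nxt A w))) ∧ (not (does (prv A w FinP.≟ w)) ∧ not
          (does (nxt A w FinP.≟ w)))

        inner-antitone : ∀ Z Z′ → (∀ x → Z x ≡ true → Z′ x ≡ true) → ∀ w → inner Z′ w ≡ true → inner Z w ≡ true
        inner-antitone Z Z′ sub w e = ∧-true (∧-true (weaken (prv A w) (∧-trueˡ (not (Z′ (prv A w))) p))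
          (weaken (nxt A w) (∧-trueʳ (not (Z′ (prv A w))) p)))
            (∧-trueʳ (not (Z′ (prv A w)) ∧ not (Z′ (nxt A w))) e)
          where
          p : not (Z′ (prv A w)) ∧ not (Z′ (nxt A w)) ≡ true
          p = ∧-trueˡ (not (Z′ (prv A w)) ∧ not (Z′ (nxt A w))) e
          weaken : ∀ x → not (Z′ x) ≡ true → not (Z x) ≡ true
          weaken x h = not-true (¬true⇒false λ zx → true≢false (sub x zx) (not-true⁻¹ h))

        not-does : ∀ {P : Set} (d : Dec P) → not (does d) ≡ true → ¬ P
        not-does (no ¬p) _ = ¬p

        not-does⁺ : ∀ {P : Set} (d : Dec P) → ¬ P → not (does d) ≡ true
        not-does⁺ (no _) _ = refl
        not-does⁺ (yes p) ¬p = ⊥-elim (¬p p)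

        inner-spec : ∀ Z w → inner Z w ≡ true → Consec A (prv A w) w × Consec A w (nxt A w) × ∁ Z (prv A w) ≡ true × ∁
          Z (nxt A w) ≡ true
        inner-spec Z w e =
          consec-prv A (not-does (prv A w FinP.≟ w) (∧-trueˡ (not (does (prv A w FinP.≟ w))) q))
          , consec-nxt A (not-does (nxt A w FinP.≟ w) (∧-trueʳ (not (does (prv A w FinP.≟ w))) q))
          , ∧-trueˡ (not (Z (prv A w))) p , ∧-trueʳ (not (Z (prv A w))) p
          where
          p = ∧-trueˡ (not (Z (prv A w)) ∧ not (Z (nxt A w))) e
          q = ∧-trueʳ (not (Z (prv A w)) ∧ not (Z (nxt A w))) e

        -- Only the two ends of the arc and the arc neighbours of `Z` are lost.
        inner-large : ∀ Z → 30 * b ≤ count (inner Z) + (2 + count Z * 3)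
        inner-large Z = ≤-trans long (cover A refl)
          where
          covered : ∀ {x y xs} → A ≡ x ∷ xs → Last A y → ∀ {w} → w ∈ A →
                    inner Z w ≡ true ⊎ (w ∈ x ∷ y ∷ [] ⊎ ∃ λ s → Z s ≡ true × w ∈ s ∷ nxt A s ∷ prv A s ∷ [])
          covered refl last {w} w∈ with position w∈
          ... | inj₁ refl = inj₂ (inj₁ (here refl))
          ... | inj₂ (inj₁ l) = inj₂ (inj₁ (there (here (last-unique l last))))
          ... | inj₂ (inj₂ (a , c , aw , wc)) with ≡true? (Z a) | ≡true? (Z c)
          ... | inj₁ za | _ = inj₂ (inj₂ (a , za , there (here (sym (nxt-consec uniq aw)))))
          ... | inj₂ _ | inj₁ zc = inj₂ (inj₂ (c , zc , there (there (here (sym (prv-consec uniq wc))))))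
          ... | inj₂ za | inj₂ zc = inj₁ (∧-true
                (∧-true (not-true (subst (λ t → Z t ≡ false) (sym (prv-consec uniq aw)) za))
                  (not-true (subst (λ t → Z t ≡ false) (sym (nxt-consec uniq wc)) zc)))
                (∧-true (not-does⁺ (prv A w FinP.≟ w) (λ e → consec-irrefl uniq aw (trans (sym (prv-consec uniq aw))
                  e)))
                        (not-does⁺ (nxt A w FinP.≟ w) (λ e → consec-irrefl uniq wc
                          (sym (trans (sym (nxt-consec uniq wc)) e))))))
          cover : ∀ A′ → A ≡ A′ → length A ≤ count (inner Z) + (2 + count Z * 3)
          cover [] e = subst (λ A → length A ≤ count (inner Z) + (2 + count Z * 3)) (sym e) z≤n
          cover (x ∷ xs) e with last-exists x xs
          ... | y , last = ≤-trans (length-⊆ uniq listed)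
              (≤-reflexive (trans (length-++ (elems (inner Z))) (cong (count (inner Z) +_)
                (cong (2 +_) (length-concatMap images 3 (λ _ → refl) (elems Z))))))
            where
            images : Fin v → List (Fin v)
            images s = s ∷ nxt A s ∷ prv A s ∷ []
            listed : ∀ {w} → w ∈ A → w ∈ elems (inner Z) ++ (x ∷ y ∷ concatMap images (elems Z))
            listed {w} w∈ with covered e (subst (λ A → Last A y) (sym e) last) w∈
            ... | inj₁ h = ∈-++⁺ˡ (∈-elems (inner Z) h)
            ... | inj₂ (inj₁ h) = ∈-++⁺ʳ (elems (inner Z)) (∈-++⁺ˡ h)
            ... | inj₂ (inj₂ (s , zs , h)) = ∈-++⁺ʳ (elems (inner Z))
              (there (there (∈-concatMap images (∈-elems Z zs) h)))

        -- D is the complement of a maximal set Z of at most b vertices that expands badly into A: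
        -- a badly expanding S ⊆ D could be added to Z.
        zone : (Zone A → ⊥) → ⊥
        zone k = improve b ∅ (≤-trans (≤-reflexive (count-∅ {v})) z≤n) (m≤m+n b _)
            (≤-trans (count-mono (N ∅ ∩ inner ∅) ∅ (λ w e → ⊥-elim (no-neighbour w (∧-trueˡ (N ∅ w) e))))
              (≤-reflexive (trans (count-∅ {v}) (cong (10 *_) (sym (count-∅ {v}))))))
          where
          no-neighbour : ∀ w → N ∅ w ≡ true → ⊥
          no-neighbour w e with N-elim ∅ {w} e
          ... | _ , () , _
          -- The fuel bounds b - |Z|, and the last hypothesis is the invariant of bad expansion,
          -- which survives unions because `inner` shrinks as `Z` grows.
          improve : ∀ fuel Z → count Z ≤ b → b ≤ fuel + count Z → count (N Z ∩ inner Z) ≤ 10 * count Z → ⊥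
          improve fuel Z Z≤b fuel≥ bad = k (record
            { D = ∁ Z ; I = inner Z ; f = nxt A ; g = prv A
            ; interior = λ w e → let aw , wc , da , dc = inner-spec Z w e in
                prv A w , nxt A w , aw , wc , da , dc , inj₁ (sym (nxt-consec uniq aw)) , inj₂
                  (sym (prv-consec uniq wc))
            ; expanding = expands
            ; large = +-cancelʳ-≤ (2 + b * 3) b (count (inner Z)) (begin
                b + (2 + b * 3)                     ≤⟨ +-monoʳ-≤ b (+-monoˡ-≤ (b * 3) (*-monoʳ-≤ 2 b≥1)) ⟩
                b + (2 * b + b * 3)                 ≡⟨ collect₁ b ⟩
                6 * b                               ≤⟨ *-monoˡ-≤ b (m≤m+n 6 24) ⟩
                30 * b                              ≤⟨ inner-large Z ⟩
                count (inner Z) + (2 + count Z * 3) ≤⟨ +-monoʳ-≤ (count (inner Z)) (+-monoʳ-≤ 2 (*-monoˡ-≤ 3 Z≤b)) ⟩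
                count (inner Z) + (2 + b * 3)       ∎) })
            where
            open ≤-Reasoning
            collect₁ : ∀ b → b + (2 * b + b * 3) ≡ 6 * b
            collect₁ = solve-∀
            expands : ∀ S → (∀ x → S x ≡ true → ∁ Z x ≡ true) → 1 ≤ count S → count S ≤ b → 10 * count S < count
              (N S ∩ inner Z)
            expands S S⊆D S≥1 S≤b with 10 * count S <? count (N S ∩ inner Z)
            ... | yes h = h
            ... | no h = ⊥-elim (contradict (count Z′ ≤? b) fuel fuel≥)
              where
              Z′ : Subset v
              Z′ = Z ∪ S
              sum≤ : count Z + count S ≤ count Z′
              sum≤ = ≤-trans (count-∪-∩ Z S) (≤-trans (+-monoʳ-≤ (count Z′) (≤-trans
                (count-mono (Z ∩ S) ∅ (λ x e → ⊥-elim (true≢false (∧-trueˡ (Z x) e)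
                  (not-true⁻¹ (S⊆D x (∧-trueʳ (Z x) e))))))
                (≤-reflexive (count-∅ {v})))) (≤-reflexive (+-identityʳ (count Z′))))
              bad′ : count (N Z′ ∩ inner Z′) ≤ 10 * count Z′
              bad′ = begin
                count (N Z′ ∩ inner Z′)                             ≤⟨ count-mono (N Z′ ∩ inner Z′)
                  ((N Z ∩ inner Z) ∪ (N S ∩ inner Z)) (λ w e → split w e (N-elim Z′ (∧-trueˡ (N Z′ w) e))) ⟩
                count ((N Z ∩ inner Z) ∪ (N S ∩ inner Z))           ≤⟨ count-∪ (N Z ∩ inner Z) (N S ∩ inner Z) ⟩
                count (N Z ∩ inner Z) + count (N S ∩ inner Z)       ≤⟨ +-mono-≤ bad (≮⇒≥ h) ⟩
                10 * count Z + 10 * count S                         ≡⟨ *-distribˡ-+ 10 (count Z) (count S) ⟨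
                10 * (count Z + count S)                            ≤⟨ *-monoʳ-≤ 10 sum≤ ⟩
                10 * count Z′                                       ∎
                where
                split : ∀ w → (N Z′ w ∧ inner Z′ w) ≡ true → (∃ λ x → Z′ x ≡ true × R x w) →
                        (N Z w ∧ inner Z w) ∨ (N S w ∧ inner Z w) ≡ true
                split w e (x , zx , r) with ∨-split (Z x) zx | inner-antitone Z Z′ (λ x zx → ∨-trueˡ (S x) zx) w
                  (∧-trueʳ (N Z′ w) e)
                ... | inj₁ z | i = ∨-trueˡ (N S w ∧ inner Z w) (∧-true (N-intro Z z r) i)
                ... | inj₂ s | i = ∨-trueʳ (N Z w ∧ inner Z w) (∧-true (N-intro S s r) i)
              contradict : Dec (count Z′ ≤ b) → ∀ fuel → b ≤ fuel + count Z → ⊥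
              contradict (yes Z′≤b) zero fuel≥ = <⇒≱ (≤-<-trans fuel≥ (m<m+n (count Z) S≥1)) (≤-trans sum≤ Z′≤b)
              contradict (yes Z′≤b) (suc fuel) fuel≥ = improve fuel Z′ Z′≤b
                (≤-trans fuel≥ (≤-trans (≤-reflexive (sym (+-suc fuel (count Z))))
                  (+-monoʳ-≤ fuel (≤-trans (≤-trans (≤-reflexive (+-comm 1 (count Z))) (+-monoʳ-≤ (count Z) S≥1))
                  sum≤)))) bad′
              -- Once b < |Z′| ≤ 2b, `joined` makes Z′ reach all but fewer than b interior vertices,
              -- while bad expansion allows only 20b. The arc would have at most 20b + b + 2b + 6b =
              -- 29b vertices, whence the required length 30b.
              contradict (no Z′≰b) _ _ = <⇒≱ (count-∩-joined Z′ (inner Z′) (<⇒≤ (≰⇒> Z′≰b)))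
                (+-cancelʳ-≤ (2 + 2 * b * 3) _ _ (begin
                count (N Z′ ∩ inner Z′) + b + (2 + 2 * b * 3)
                  ≤⟨ +-mono-≤ (+-monoˡ-≤ b (≤-trans bad′ (*-monoʳ-≤ 10 Z′≤2b)))
                  (+-monoˡ-≤ (2 * b * 3) (*-monoʳ-≤ 2 b≥1)) ⟩
                10 * (2 * b) + b + (2 * b + 2 * b * 3)               ≡⟨ collect₂ b ⟩
                29 * b                                               ≤⟨ *-monoˡ-≤ b (m≤m+n 29 1) ⟩
                30 * b                                               ≤⟨ inner-large Z′ ⟩
                count (inner Z′) + (2 + count Z′ * 3)                ≤⟨ +-monoʳ-≤ (count (inner Z′))
                  (+-monoʳ-≤ 2 (*-monoˡ-≤ 3 Z′≤2b)) ⟩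
                count (inner Z′) + (2 + 2 * b * 3)                   ∎))
                where
                collect₂ : ∀ b → 10 * (2 * b) + b + (2 * b + 2 * b * 3) ≡ 29 * b
                collect₂ = solve-∀
                Z′≤2b : count Z′ ≤ 2 * b
                Z′≤2b = ≤-trans (count-∪ Z S) (≤-trans (+-mono-≤ Z≤b S≤b)
                  (≤-reflexive (cong (b +_) (sym (+-identityʳ b)))))

    -- Pósa's argument inside the zone: the set S of admissible endpoints satisfies
    -- |N(S) ∩ I| ≤ 3|S| + 3, so it cannot be small.
    many-endpoints : ∀ {e₀ l P A} → (z : Zone A) → Seg e₀ l P → Unique P →
      (∀ {a c} → Consec A a c → Consec P a c) → N (I z) e₀ ≡ true →
      ((S : Subset v) → b < count S → (∀ s → S s ≡ true → ∃ λ Q → Q ↭ P × Seg s l Q) → ⊥) → ⊥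
    many-endpoints {e₀} {l} {P} {A} z path uniq A⊆P good k =
      classify (λ x → ∃ λ n → Head n x) λ T T⇒ ⇒T →
        k (T ∩ D z) (≰⇒> (small T T⇒ ⇒T)) λ s s∈ → let _ , Q , q = T⇒ s (∧-trueˡ (T s) s∈) in Q , reach-↭ q , reach-seg q
      where
      open Rotation G
      open From path uniq (λ x → D z x ≡ true)
      grow : ∀ {n e Q w} → Reach n e Q → R e w → I z w ≡ true →
             ∃ λ s → (∃ λ n → Head n s) × w ∈ s ∷ f z s ∷ g z s ∷ [] × (D z s ≡ true ⊎ s ≡ w)
      grow {n} {w = w} q r w∈ with interior z w w∈
      ... | a , c , aw , wc , da , dc , wa , w′ with growth q r (A⊆P aw) (A⊆P wc) da dc
      ... | inj₁ h = w , (n , h) , here refl , inj₂ refl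
      ... | inj₂ (inj₁ h) = a , (suc n , h) , image a wa , inj₁ da
        where
        image : ∀ a → w ≡ f z a ⊎ w ≡ g z a → w ∈ a ∷ f z a ∷ g z a ∷ []
        image a (inj₁ e) = there (here e)
        image a (inj₂ e) = there (there (here e))
      ... | inj₂ (inj₂ h) = c , (suc n , h) , image c w′ , inj₁ dc
        where
        image : ∀ a → w ≡ f z a ⊎ w ≡ g z a → w ∈ a ∷ f z a ∷ g z a ∷ []
        image a (inj₁ e) = there (here e)
        image a (inj₂ e) = there (there (here e))
      small : ∀ T → (∀ x → T x ≡ true → ∃ λ n → Head n x) → (∀ x → (∃ λ n → Head n x) → T x ≡ true) → count (T ∩ D z)
        ≤ b → ⊥
      small T T⇒ ⇒T S≤b = <⇒≱ (expanding z S (λ x → ∧-trueʳ (T x)) S≥1 S≤b) (begin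
          count (N S ∩ I z)       ≤⟨ count-≤-images T (N S ∩ I z) (f z) (g z) [] (λ w e → inj₂ (covered w e)) ⟩
          count T * 3             ≤⟨ *-monoˡ-≤ 3 T≤S+1 ⟩
          (count S + 1) * 3       ≤⟨ *-monoˡ-≤ 3 (+-monoʳ-≤ (count S) S≥1) ⟩
          (count S + count S) * 3 ≡⟨ collect (count S) ⟩
          6 * count S             ≤⟨ *-monoˡ-≤ (count S) (m≤m+n 6 4) ⟩
          10 * count S            ∎)
        where
        open ≤-Reasoning hiding (start)
        collect : ∀ s → (s + s) * 3 ≡ 6 * s
        collect = solve-∀
        S : Subset v
        S = T ∩ D z
        covered : ∀ w → N S w ∧ I z w ≡ true → ∃ λ s → T s ≡ true × w ∈ s ∷ f z s ∷ g z s ∷ []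
        covered w e with N-elim S (∧-trueˡ (N S w) e)
        ... | x , sx , r with T⇒ x (∧-trueˡ (T x) sx)
        ... | n , Q , q with grow q r (∧-trueʳ (N S w) e)
        ... | s , h , w∈ , _ = s , ⇒T s h , w∈
        in-D : ∀ {x} → (∃ λ n → Head n x) → x ≡ e₀ ⊎ D z x ≡ true
        in-D (n , Q , q) = reach-head q
        -- Only the initial endpoint e₀ can lie outside `D`; every endpoint gained by a rotation is
        -- admissible.
        T≤S+1 : count T ≤ count S + 1
        T≤S+1 = ≤-trans (count-mono T (S ∪ (λ x → does (e₀ FinP.≟ x))) (λ x tx → into x tx (in-D (T⇒ x tx))))
          (≤-trans (count-∪ S (λ x → does (e₀ FinP.≟ x))) (+-monoʳ-≤ (count S)
            (∈-singleton⇒≤1 (λ x → does (e₀ FinP.≟ x)) e₀ (λ x e → sym (isTrue⁻¹ (e₀ FinP.≟ x) e)))))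
          where
          into : ∀ x → T x ≡ true → x ≡ e₀ ⊎ D z x ≡ true → S x ∨ does (e₀ FinP.≟ x) ≡ true
          into x tx (inj₁ refl) = ∨-trueʳ (S x) (isTrue (e₀ FinP.≟ e₀) refl)
          into x tx (inj₂ dx) = ∨-trueˡ (does (e₀ FinP.≟ x)) (∧-true tx dx)
        -- Expansion is assumed only for nonempty sets. The hypothesis on e₀ supplies a neighbour in
        -- `I`, and the first rotation there yields an endpoint in `D`.
        S≥1 : 1 ≤ count S
        S≥1 with N-elim (I z) good
        ... | w , w∈ , r with grow (start {zero}) (R-sym r) w∈
        ... | s , h , _ , inj₁ ds = count-pos S s (∧-true (⇒T s h) ds)
        ... | .w , h , _ , inj₂ refl with in-D h
        ... | inj₁ refl = ⊥-elim (R-irrefl r refl)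
        ... | inj₂ dw = count-pos S w (∧-true (⇒T w h) dw)

-- A Hamiltonicity criterion for pseudorandom graphs.

module Criterion where

  open import Defs using (Graph; count; Connected; HamiltonianCycle)
  open FiniteSets
  open Mixing using (neighbourhood)
  open Paths
  open Rotations
  open Zones
  open import Data.Nat using (>-nonZero; ℕ; zero; suc; _+_; _*_; _∸_; _^_; _≤_; _<_; z≤n; s≤s)
  open import Data.Nat.Properties
  open import Data.List using (take; drop)
  open import Data.List.Membership.Propositional.Properties
  open import Data.List.Relation.Unary.All.Properties using (¬Any⇒All¬)

  module _ {X : Set} where

    compare-++ : ∀ (xs : List X) {ys} as {bs} → xs ++ ys ≡ as ++ bs →
                 (∃ λ as′ → as ≡ xs ++ as′ × ys ≡ as′ ++ bs) ⊎ (∃ λ bs′ → xs ≡ as ++ bs′ × bs ≡ bs′ ++ ys)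
    compare-++ [] as e = inj₁ (as , refl , e)
    compare-++ (x ∷ xs) [] e = inj₂ (x ∷ xs , refl , sym e)
    compare-++ (x ∷ xs) (a ∷ as) e with ∷-injective e
    ... | refl , e′ with compare-++ xs as e′
    ... | inj₁ (as′ , refl , q) = inj₁ (as′ , refl , q)
    ... | inj₂ (bs′ , refl , q) = inj₂ (bs′ , refl , q)

    -- Marks n disjoint good intervals in a list, separated by arbitrary stretches.
    data Layout (Good : List X → Set) : ℕ → List X → Set where
      nil  : Layout Good 0 []
      junk : ∀ xs {n ys} → Layout Good n ys → Layout Good n (xs ++ ys)
      good : ∀ {xs n ys} → Good xs → Layout Good n ys → Layout Good (suc n) (xs ++ ys)

    layout-map : ∀ {Good Good′ : List X → Set} → (∀ {xs} → Good xs → Good′ xs) → ∀ {n ys} → Layout Good n ys → Layout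
      Good′ n ys
    layout-map h nil = nil
    layout-map h (junk xs L) = junk xs (layout-map h L)
    layout-map h (good g L) = good (h g) (layout-map h L)

    module _ {Good : List X → Set} where

      all-junk : ∀ xs → Layout Good 0 xs
      all-junk xs = subst (Layout Good 0) (++-identityʳ xs) (junk xs nil)

      layout-++ : ∀ {n m xs ys} → Layout Good n xs → Layout Good m ys → Layout Good (n + m) (xs ++ ys)
      layout-++ nil M = M
      layout-++ {ys = ys} (junk xs {ys = zs} L) M = subst (Layout Good _) (sym (++-assoc xs zs ys))
        (junk xs (layout-++ L M))
      layout-++ {ys = ys} (good {xs} {ys = zs} g L) M = subst (Layout Good _) (sym (++-assoc xs zs ys))
        (good g (layout-++ L M))

      layout-≤ : ∀ {m n xs} → m ≤ n → Layout Good n xs → Layout Good m xs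
      layout-≤ z≤n L = all-junk _
      layout-≤ (s≤s h) (junk xs L) = junk xs (layout-≤ (s≤s h) L)
      layout-≤ (s≤s h) (good g L) = good g (layout-≤ h L)

      layout-reverse : (∀ {xs} → Good xs → Good (reverse xs)) → ∀ {n xs} → Layout Good n xs → Layout Good n (reverse xs)
      layout-reverse h nil = nil
      layout-reverse h (junk xs {n} {ys} L) = subst₂ (Layout Good) (+-identityʳ n) (sym (reverse-++ xs ys))
        (layout-++ (layout-reverse h L) (all-junk (reverse xs)))
      layout-reverse h (good {xs} {n} {ys} g L) = subst₂ (Layout Good) (+-comm n 1) (sym (reverse-++ xs ys))
        (layout-++ (layout-reverse h L) (subst (Layout Good 1) (++-identityʳ (reverse xs)) (good (h g) nil)))

      -- At most one interval straddles the cut, and it is demoted to junk on both sides.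
      layout-cut : ∀ {n xs} → Layout Good n xs → ∀ as {bs} → xs ≡ as ++ bs →
                   ∃₂ λ i j → Layout Good i as × Layout Good j bs × n ≤ suc (i + j)
      layout-cut nil [] refl = 0 , 0 , nil , nil , z≤n
      layout-cut (junk xs L) as e with compare-++ xs as e
      ... | inj₁ (as′ , refl , q) = let i , j , L₁ , L₂ , le = layout-cut L as′ q in i , j , junk xs L₁ , L₂ , le
      ... | inj₂ (bs′ , refl , refl) = 0 , _ , all-junk as , junk bs′ L , n≤1+n _
      layout-cut (good {xs} g L) as e with compare-++ xs as e
      ... | inj₁ (as′ , refl , q) = let i , j , L₁ , L₂ , le = layout-cut L as′ q in suc i , j , good g L₁ , L₂ , s≤s le
      ... | inj₂ (bs′ , refl , refl) = 0 , _ , all-junk as , junk bs′ L , ≤-refl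

      -- A rotation is one cut followed by the reversal of the first piece, so it costs one
      -- interval.
      layout-rotate : (∀ {xs} → Good xs → Good (reverse xs)) → ∀ {n} as {bs} → Layout Good (suc n) (as ++ bs) → Layout
        Good n (reverse as ++ bs)
      layout-rotate h as L with layout-cut L as refl
      ... | i , j , L₁ , L₂ , s≤s le = layout-≤ le (layout-++ (layout-reverse h L₁) L₂)

      first-block : ∀ {n xs} → Layout Good (suc n) xs → ∃ λ as → ∃₂ λ bs cs → xs ≡ as ++ bs ++ cs × Good bs × Layout
        Good n cs
      first-block (junk xs L) with first-block L
      ... | as , bs , cs , refl , g , M = xs ++ as , bs , cs , sym (++-assoc xs as (bs ++ cs)) , g , M
      first-block (good {xs} {ys = ys} g L) = [] , xs , ys , refl , g , L

  -- L is the growth factor of the endpoint set in one round; the 4 in `grow` pays for the loss in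
  -- Pósa's inequality. `joined` says that b vertices have neighbours nearly everywhere.
  module Pseudorandom {v : ℕ} (G : Graph v) (b L : ℕ) (b≥1 : 1 ≤ b) (1000b≤v : 1000 * b ≤ v) (v≤L⁹ : v ≤ L ^ 9)
    (joined : ∀ S → b ≤ count S → v < count (neighbourhood G S) + b)
    (grow : ∀ S x → S x ≡ true → 4 * (L * count S) ≤ count (neighbourhood G S) ⊎ v ≤ 2 * count (neighbourhood G S)) where

    open GraphPaths G
    open Rotation G
    open Zone G b
    open import Data.List.Membership.DecPropositional (FinP._≟_ {v}) using (_∈?_)

    -- A single set `Bad` serves all arcs, so that one endpoint outside it can enter whichever arcs
    -- survive.
    GoodBlock : Subset v → List (Fin v) → Set
    GoodBlock Bad A = Σ (Zone A) λ z → ∀ x → Bad x ≡ false → N (Zone.I z) x ≡ true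

    good-reverse : ∀ {Bad A} → GoodBlock Bad A → GoodBlock Bad (reverse A)
    good-reverse (z , h) = zone-reverse z , h

    -- The interior of a zone has at least b vertices, so by `joined` fewer than b vertices fail to
    -- see it; over q arcs at most qb vertices are bad.
    arcs : ∀ q P → Unique P → q * (30 * b) ≤ length P →
           ((Bad : Subset v) → count Bad ≤ q * b → Layout (GoodBlock Bad) q P → ⊥) → ⊥
    arcs zero P u h k = k ∅ (≤-reflexive (count-∅ {v})) (all-junk P)
    arcs (suc q) P u h k =
      zone b≥1 joined A (unique-++ˡ A u′)
        (≤-reflexive (sym (trans (length-take ℓ P) (m≤n⇒m⊓n≡m (≤-trans (m≤m+n ℓ (q * ℓ)) h))))) λ z →
      arcs q (drop ℓ P) (unique-++ʳ A u′) (subst (q * ℓ ≤_) (sym (length-drop ℓ P)) (subst (_≤ length P ∸ ℓ)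
        (m+n∸m≡n ℓ (q * ℓ)) (∸-monoˡ-≤ ℓ h))) λ Bad small L →
      k (∁ (N (Zone.I z)) ∪ Bad)
        (≤-trans (count-∪ (∁ (N (Zone.I z))) Bad) (+-mono-≤ (missing z) small))
        (subst (Layout _ (suc q)) (take++drop≡id ℓ P) (good (z , λ x e → not-false (∨-falseˡ (∁ (N (Zone.I z)) x) e))
          (layout-map (λ { (z′ , g) → z′ , λ x e → g x (∨-falseʳ (∁ (N (Zone.I z)) x) e) }) L)))
      where
      ℓ : ℕ
      ℓ = 30 * b
      A : List (Fin v)
      A = take ℓ P
      u′ : Unique (A ++ drop ℓ P)
      u′ = subst Unique (sym (take++drop≡id ℓ P)) u
      not-false : ∀ {a} → not a ≡ false → a ≡ true
      not-false {true} _ = refl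
      missing : (z : Zone A) → count (∁ (N (Zone.I z))) ≤ b
      missing z = <⇒≤ (+-cancelˡ-< (count (N (Zone.I z))) _ _ (subst (_< count (N (Zone.I z)) + b)
        (sym (count-∁ (N (Zone.I z)))) (joined (Zone.I z) (Zone.large z))))

    -- What maximality of a path gives: a neighbour outside P would prolong some path on the same
    -- vertices.
    Saturated : List (Fin v) → Set
    Saturated P = ∀ {x y Q w} → Q ↭ P → Seg x y Q → R x w → w ∈ P

    module Ends {e₀ l : Fin v} {P : List (Fin v)} (path : Seg e₀ l P) (uniq : Unique P) (saturated : Saturated P) where

      open Unrestricted path uniq saturated

      -- With T′ the next endpoint set, |N(T)| ≤ 1 + 3|T′| ≤ 4|T′|. So 4L|T| ≤ |N(T)| multiplies the
      -- size by L, and the alternative v ≤ 2|N(T)| gives v ≤ 8|T′|.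
      many-heads : ∀ n → ((T : Subset v) → (∀ x → T x ≡ true → Head n x) → T e₀ ≡ true → L ^ n ≤ count T ⊎ v ≤ 8 *
        count T → ⊥) → ⊥
      many-heads zero k = classify (Head zero) λ T T⇒ ⇒T →
        k T T⇒ (⇒T e₀ (P , start)) (inj₁ (count-pos T e₀ (⇒T e₀ (P , start))))
      many-heads (suc n) k = many-heads n λ T T⇒ e∈T size → classify (Head (suc n)) λ T′ T′⇒ ⇒T′ →
        k T′ T′⇒ (⇒T′ e₀ (P , start)) (larger T T′ T⇒ ⇒T′ e∈T size)
        where
        larger : ∀ T T′ → (∀ x → T x ≡ true → Head n x) → (∀ x → Head (suc n) x → T′ x ≡ true) → T e₀ ≡ true →
               L ^ n ≤ count T ⊎ v ≤ 8 * count T → L ^ suc n ≤ count T′ ⊎ v ≤ 8 * count T′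
        larger T T′ T⇒ ⇒T′ e∈T size = f size (grow T e₀ e∈T)
          where
          N≤4T′ : count (neighbourhood G T) ≤ 4 * count T′
          N≤4T′ = ≤-trans (neighbourhood-bound T T′ T⇒ ⇒T′)
            (≤-trans (+-monoˡ-≤ _ (count-pos T′ e₀ (⇒T′ e₀ (P , start))))
            (≤-reflexive (cong (count T′ +_) (*-comm (count T′) 3))))
          f : L ^ n ≤ count T ⊎ v ≤ 8 * count T → 4 * (L * count T) ≤ count (neighbourhood G T) ⊎ v ≤ 2 * count
            (neighbourhood G T) →
              L ^ suc n ≤ count T′ ⊎ v ≤ 8 * count T′
          f (inj₂ h) _ = inj₂ (≤-trans h (*-monoʳ-≤ 8 (count-mono T T′ (λ x tx → ⇒T′ x (head-suc (T⇒ x tx))))))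
          f (inj₁ h) (inj₁ g) = inj₁ (≤-trans (*-monoʳ-≤ L h) (*-cancelˡ-≤ 4 (≤-trans g N≤4T′)))
          f (inj₁ h) (inj₂ g) = inj₂ (≤-trans g (≤-trans (*-monoʳ-≤ 2 N≤4T′)
            (≤-reflexive (sym (*-assoc 2 4 (count T′))))))

      -- L⁹ ≥ v, so either alternative gives v ≤ 8|T|. The target 20b is the largest possible number
      -- of bad vertices for 20 arcs, and 8 · 20b stays below 1000b ≤ v.
      nine-rounds : ((T : Subset v) → (∀ x → T x ≡ true → Head 9 x) → 20 * b < count T → ⊥) → ⊥
      nine-rounds k = many-heads 9 λ T T⇒ _ size → k T T⇒ (enough T size)
        where
        open ≤-Reasoning hiding (start)
        enough : ∀ T → L ^ 9 ≤ count T ⊎ v ≤ 8 * count T → 20 * b < count T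
        enough T size = ≰⇒> λ T≤20b → <⇒≱ (begin-strict
          8 * (20 * b)  ≡⟨ *-assoc 8 20 b ⟨
          160 * b       <⟨ *-monoˡ-< b {{>-nonZero b≥1}} {160} {1000} (m≤m+n 161 839) ⟩
          1000 * b      ≤⟨ 1000b≤v ⟩
          v             ≤⟨ large size ⟩
          8 * count T   ∎) (*-monoʳ-≤ 8 T≤20b)
          where
          large : L ^ 9 ≤ count T ⊎ v ≤ 8 * count T → v ≤ 8 * count T
          large (inj₁ h) = ≤-trans v≤L⁹ (≤-trans h (m≤n*m (count T) 8))
          large (inj₂ h) = h

      -- Saturation puts all neighbours of the many endpoints into P, and by `joined` these are all
      -- but fewer than b vertices. Twenty arcs of length 30b need 600b.
      long : (600 * b ≤ length P → ⊥) → ⊥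
      long k = nine-rounds λ T T⇒ big → k (+-cancelʳ-≤ b _ _ (begin
          600 * b + b                        ≡⟨ +-comm (600 * b) b ⟩
          601 * b                            ≤⟨ *-monoˡ-≤ b (m≤m+n 601 399) ⟩
          1000 * b                           ≤⟨ 1000b≤v ⟩
          v                                  ≤⟨ <⇒≤ (joined T (≤-trans (m≤n*m b 20) (<⇒≤ big))) ⟩
          count (N T) + b
            ≤⟨ +-monoˡ-≤ b (count-≤-length (N T) P (λ w e → inside T T⇒ w (N-elim T e))) ⟩
          length P + b                       ∎))
        where
        open ≤-Reasoning hiding (start)
        inside : ∀ T → (∀ x → T x ≡ true → Head 9 x) → ∀ w → (∃ λ x → T x ≡ true × R x w) → w ∈ P
        inside T T⇒ w (x , tx , r) = let Q , q = T⇒ x tx in saturated (reach-↭ q) (reach-seg q) r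

      good-end : ∀ (Bad : Subset v) m → count Bad ≤ 20 * b → Layout (GoodBlock Bad) (9 + m) P →
                 (∀ {x Q} → Seg x l Q → Q ↭ P → Bad x ≡ false → Layout (GoodBlock Bad) m Q → ⊥) → ⊥
      good-end Bad m small layout k = nine-rounds λ T T⇒ big →
        let x , tx , bx = count-< T Bad (≤-<-trans small big)
            Q , q = T⇒ x tx
        in k (reach-seg q) (reach-↭ q) bx (reach-layout q layout)
        where
        reach-layout : ∀ {n m e Q} → Reach n e Q → Layout (GoodBlock Bad) (n + m) P → Layout (GoodBlock Bad) m Q
        reach-layout {n} {m} start M = layout-≤ (m≤n+m m n) M
        reach-layout {suc n} {m} (rotate {A = A} q _ _ _ _) M =
          layout-rotate good-reverse A (reach-layout q (subst (λ t → Layout (GoodBlock Bad) t P) (sym (+-suc n m)) M))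

    seg-divide : ∀ {x y a c} us vs → Seg x y (us ++ vs) → a ∈ us → c ∈ vs → ∃₂ λ z w → Seg x z us × R z w × Seg w y vs
    seg-divide (u ∷ us) (w ∷ vs) s _ _ with seg-split u us s
    ... | z , s₁ , r , s₂ = z , w , s₁ , r , s₂

    -- The path is cut behind `A` at an edge from p to q. The first half is rotated at x with p
    -- fixed, the reversed second half at y with q fixed, so neither disturbs the other. An edge
    -- between the two endpoint sets, together with the edge from p to q, closes the cycle.
    close-up : ∀ {Bad x y X A Y B Z} → GoodBlock Bad A → GoodBlock Bad B → Bad x ≡ false → Bad y ≡ false →
               let Q = (X ++ A) ++ (Y ++ (B ++ Z)) in Seg x y Q → Unique Q →
               (∀ Q′ → Closed Q′ → Q′ ↭ Q → ⊥) → ⊥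
    close-up {Bad} {x} {y} {X} {A} {Y} {B} {Z} (zA , hA) (zB , hB) bx by s u k
      with seg-divide (X ++ A) (Y ++ (B ++ Z)) s (∈-++⁺ʳ X (proj₂ (member zA))) (∈-++⁺ʳ Y (∈-++⁺ˡ (proj₂ (member zB))))
      where
      member : ∀ {A} → Zone A → ∃ λ a → a ∈ A
      member z = let w , w∈ = count-witness (Zone.I z) (≤-trans b≥1 (Zone.large z))
                     a , _ , c , _ = Zone.interior z w w∈
                 in a , consec-∈ˡ c
    ... | p , q , s₁ , r , s₂ =
      many-endpoints zA s₁ (unique-++ˡ (X ++ A) u) (consec-++ʳ X) (hA x bx) λ S S>b S⇒ →
      many-endpoints (zone-reverse zB) (seg-reverse s₂) (Unique-↭ (↭-sym (↭-reverse _)) (unique-++ʳ (X ++ A) u))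
        in-reverse (hB y by) λ S′ S′>b S′⇒ →
      let w , e = count-witness (N S ∩ S′) (meet S S′ (<⇒≤ S>b) S′>b)
          t , t∈S , tw = N-elim S (∧-trueˡ (N S w) e)
          P₁ , perm₁ , t₁ = S⇒ t t∈S
          P₂ , perm₂ , t₂ = S′⇒ w (∧-trueʳ (N S w) e)
      in k (reverse P₁ ++ P₂) (_ , _ , seg-join (seg-reverse t₁) tw t₂ , R-sym r)
           (++⁺ (↭-trans (↭-reverse P₁) perm₁) (↭-trans perm₂ (↭-reverse _)))
      where
      in-reverse : ∀ {a c} → Consec (reverse B) a c → Consec (reverse (Y ++ (B ++ Z))) a c
      in-reverse h = consec-reverse (consec-++ʳ Y (consec-++ˡ (subst (λ l → Consec l _ _) (reverse-involutive B)
        (consec-reverse h))))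
      meet : ∀ S S′ → b ≤ count S → b < count S′ → 1 ≤ count (N S ∩ S′)
      meet S S′ h h′ = +-cancelʳ-≤ b 1 _ (≤-trans h′ (<⇒≤ (count-∩-joined b≥1 joined S S′ h)))

    hamiltonian : 3 ≤ v → Connected G → Fin v → ¬ HamiltonianCycle G → ⊥
    hamiltonian 3≤v conn x₀ ¬ham = extend v ([-] {x₀}) ([] ∷ []) (m≤m+n v 1)
      where
      -- Nine rotations at either end destroy at most 18 of the 20 arcs, one for each edge they break.
      core : ∀ {e l P} → Seg e l P → Unique P → (∀ {x y Q} → Seg x y Q → Unique Q → length P < length Q → ⊥) → ⊥
      core {e} {l} {P} path uniq longest =
        Ends.long path uniq saturated λ 600b≤ →
        arcs 20 P uniq (≤-trans (≤-reflexive (sym (*-assoc 20 30 b))) 600b≤) λ Bad small layout →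
        Ends.good-end path uniq saturated Bad 11 small layout λ {x} {Q} s p bx layout₁ →
        Ends.good-end (seg-reverse s) (Unique-↭ (↭-sym (↭-trans (↭-reverse Q) p)) uniq)
          (saturated-↭ (↭-trans (↭-reverse Q) p)) Bad 2 small
          (layout-reverse good-reverse layout₁) λ {y} {Q′} s′ p′ by layout₂ →
        finish s′ (↭-trans p′ (↭-trans (↭-reverse Q) p)) by bx layout₂
        where
        saturated : Saturated P
        saturated {Q = Q} {w = w} p s r with w ∈? Q
        ... | yes w∈ = ∈-resp-↭ p w∈
        ... | no w∉ = ⊥-elim (longest (R-sym r ∷ s) (¬Any⇒All¬ Q w∉ ∷ Unique-↭ (↭-sym p) uniq)
          (s≤s (≤-reflexive (sym (↭-length p)))))
        saturated-↭ : ∀ {Q} → Q ↭ P → Saturated Q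
        saturated-↭ p q s r = ∈-resp-↭ (↭-sym p) (saturated (↭-trans q p) s r)
        -- A cycle on the vertices of P that misses a vertex has, by connectedness, an edge leaving
        -- it; opened at the foot of that edge it yields a path longer than P.
        not-closed : ∀ Q → Closed Q → Q ↭ P → ⊥
        not-closed Q c p with FinP.all? (λ z → z ∈? Q)
        ... | yes all = ¬ham (closed⇒hamiltonian 3≤v c (Unique-↭ (↭-sym p) uniq) (covers (Unique-↭ (↭-sym p) uniq) all))
        ... | no ¬all with FinP.¬∀⟶∃¬ v _ (λ z → z ∈? Q) ¬all
        ... | z , z∉ with exit-edge conn (seg-first-∈ (proj₁ (proj₂ (proj₂ c)))) z∉
        ... | a , w , a∈ , w∉ , r with closed-from c a∈
        ... | _ , Q′ , s , _ , p′ = longest (R-sym r ∷ s)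
                (¬Any⇒All¬ Q′ (λ w∈ → w∉ (∈-resp-↭ p′ w∈)) ∷ Unique-↭ (↭-sym (↭-trans p′ p)) uniq)
                  (s≤s (≤-reflexive (sym (↭-length (↭-trans p′ p)))))
        finish : ∀ {Bad x y Q} → Seg x y Q → Q ↭ P → Bad x ≡ false → Bad y ≡ false → Layout (GoodBlock Bad) 2 Q → ⊥
        finish s p bx by layout with first-block layout
        ... | X , A , cs , refl , gA , layout′ with first-block layout′
        ... | Y , B , Z , refl , gB , _ = close-up {X = X} {Y = Y} gA gB bx by (subst (Seg _ _) assoc s)
          (subst Unique assoc (Unique-↭ (↭-sym p) uniq))
                (λ Q′ c p′ → not-closed Q′ c (↭-trans p′ (↭-trans (↭-reflexive (sym assoc)) p)))
          where
          assoc : X ++ A ++ Y ++ B ++ Z ≡ (X ++ A) ++ Y ++ B ++ Z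
          assoc = sym (++-assoc X A (Y ++ B ++ Z))
      extend : ∀ fuel {x y P} → Seg x y P → Unique P → v ≤ fuel + length P → ⊥
      extend zero s u h = core s u λ t w lt → <⇒≱ lt (≤-trans (length-≤-v w) h)
      extend (suc fuel) {P = P} s u h = core s u λ t w lt → extend fuel t w
        (≤-trans h (≤-trans (≤-reflexive (sym (+-suc fuel (length P)))) (+-monoʳ-≤ fuel lt)))

-- Parameter estimates and the case distinction.

module LargeGraphs where

  open import Defs
  open FiniteSets
  open Paths using (module GraphPaths)
  open ChvatalErdos using (module Separation)
  open IntegerSums using (≤-from-difference; +-nonneg; *-nonneg; ≤⇒0≤-)
  open SRG
  open Eigenvalues
  open Spectrum
  open Krein
  open Claw
  open Mixing
  open Criterion
  open import Data.Nat using (ℕ; zero; suc; _+_; _*_; _^_; _⊓_; _⊔_; _≤_; _<_; _>_; z≤n; s≤s; _≤?_; >-nonZero)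
  open import Data.Nat.Properties
  open import Data.Nat.DivMod using (_/_; _%_; m≡m%n+[m/n]*n; m%n<n)
  open import Data.Nat.Tactic.RingSolver using (solve-∀)
  open import Data.Integer as ℤ using (ℤ; +_; 1ℤ; +≤+)
  import Data.Integer.Properties as ℤP
  import Data.Integer.Tactic.RingSolver as ℤSolver
  open import Data.List.Relation.Unary.All using (tabulate)

  -- By v ≤ 512R⁸, exceeding it forces R ≥ 4096. What is used later is R ≥ 8 in `grow`, R ≥ 512 in
  -- `v≤R⁹` and R ≥ 2000 in `v<Rb`.
  threshold : ℕ
  threshold = 512 * 4096 ^ 8

  module _ {v : ℕ} (G : Graph v) {k ℓ μ : ℕ} (srg : IsStronglyRegular G k ℓ μ) (conn : Connected G) (large : threshold < v) where

    open IsStronglyRegular srg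
    open AdjacencyMatrix G srg using (τ; κ; parameter-identity)
    open Parameters G srg
    open Restricted G srg
    open GraphPaths G using (R-sym; length-≤-v; R-irrefl)

    x₀ : Fin v
    x₀ = proj₁ notEmpty

    -- If μ = 0, the relation "equal or adjacent" is transitive, and a connected graph would be
    -- complete.
    μ≥1 : 1 ≤ μ
    μ≥1 = n≢0⇒n>0 λ μ≡0 → let x , y , x≢y , e = notComplete in absurd x≢y e (reach μ≡0 (conn x y) (inj₁ refl))
      where
      absurd : ∀ {x y} → x ≢ y → adj G x y ≡ false → x ≡ y ⊎ adj G x y ≡ true → ⊥
      absurd x≢y e (inj₁ p) = x≢y p
      absurd x≢y e (inj₂ p) = true≢false p e
      reach : μ ≡ 0 → ∀ {x z y} → Walk G z y → x ≡ z ⊎ adj G x z ≡ true → x ≡ y ⊎ adj G x y ≡ true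
      reach μ≡0 [] h = h
      reach μ≡0 (r ∷ w) (inj₁ refl) = reach μ≡0 w (inj₂ r)
      reach μ≡0 {x} {z} (_∷_ {y = y} r w) (inj₂ xz) with x FinP.≟ y | ≡true? (adj G x y)
      ... | yes e | _ = reach μ≡0 w (inj₁ e)
      ... | no _ | inj₁ xy = reach μ≡0 w (inj₂ xy)
      ... | no x≢y | inj₂ xy = ⊥-elim (<⇒≱ (count-pos (λ t → adj G x t ∧ adj G y t) z (∧-true xz (R-sym r)))
              (≤-reflexive (trans (nonadjμ x y x≢y xy) μ≡0)))

    k+2≤v : 2 + k ≤ v
    k+2≤v with notComplete
    ... | x , y , x≢y , e = subst (λ d → 2 + d ≤ v) (regular x) (length-≤-v {x ∷ y ∷ elems (adj G x)}
          ((x≢y ∷ tabulate (λ z∈ x≡z → R-irrefl (∈-elems⁻¹ (adj G x) z∈) x≡z))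
            ∷ tabulate (λ z∈ y≡z → true≢false (∈-elems⁻¹ (adj G x) z∈) (trans (cong (adj G x) (sym y≡z)) e))
            ∷ elems-unique (adj G x)))

    -- From 0 < k ≤ v - 2 < 2t the factor μ - ℓ can only be 1, so t = k. Then `parameter-identity`
    -- becomes k² = 2μk.
    conference-parameters : ∀ t → + k ≡ + t ℤ.* (+ μ ℤ.- + ℓ) → + v ≡ 1ℤ ℤ.+ (+ t ℤ.+ + t) → v ≡ 1 + 4 * μ × k ≡ 2 * μ
      × 1 + ℓ ≡ μ
    conference-parameters t k≡ v≡ = trans v≡1+2t (cong (_+_ 1) (trans (cong₂ _+_ (trans t≡k k≡2μ) (trans t≡k k≡2μ))
      (double μ))) , k≡2μ , ℓ+1≡μ
      where
      double : ∀ m → 2 * m + 2 * m ≡ 4 * m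
      double = solve-∀
      v≡1+2t : v ≡ 1 + (t + t)
      v≡1+2t = ℤP.+-injective (trans v≡ refl)
      gap : ∃ λ c → + μ ℤ.- + ℓ ≡ + c × k ≡ t * c
      gap = f (+ μ ℤ.- + ℓ) refl
        where
        f : ∀ d → + μ ℤ.- + ℓ ≡ d → ∃ λ c → + μ ℤ.- + ℓ ≡ + c × k ≡ t * c
        f (+ c) e = c , e , ℤP.+-injective (trans k≡ (trans (cong (+ t ℤ.*_) e) (sym (ℤP.pos-* t c))))
        f (ℤ.-[1+ n ]) e = ⊥-elim (negative t (trans k≡ (cong (+ t ℤ.*_) e)))
          where
          negative : ∀ t → + k ≡ + t ℤ.* ℤ.-[1+ n ] → ⊥
          negative zero h = <⇒≢ k≥1 (sym (ℤP.+-injective h))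
          negative (suc t) ()
      c≡1 : ∀ c → k ≡ t * c → c ≡ 1
      c≡1 zero e = ⊥-elim (<⇒≢ k≥1 (sym (trans e (*-zeroʳ t))))
      c≡1 (suc zero) e = refl
      c≡1 (suc (suc c)) e = ⊥-elim (<⇒≱ k+2≤v (≤-trans (≤-reflexive v≡1+2t)
        (s≤s (≤-trans (≤-reflexive (trans (cong (_+_ t) (sym (+-identityʳ t))) (*-comm 2 t)))
        (≤-trans (*-monoʳ-≤ t (s≤s (s≤s (z≤n {c})))) (≤-reflexive (sym e)))))))
      ℓ+1≡μ : 1 + ℓ ≡ μ
      ℓ+1≡μ = let c , e , e′ = gap in ℤP.+-injective (trans (ℤP.pos-+ 1 ℓ) (trans (cong (ℤ._+ + ℓ) (trans (cong +_ (sym (c≡1 c e′))) (sym e))) (cancel (+ μ) (+ ℓ))))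
        where
        cancel : ∀ m l → m ℤ.- l ℤ.+ l ≡ m
        cancel = ℤSolver.solve-∀
      t≡k : t ≡ k
      t≡k = let c , _ , e = gap in trans (sym (*-identityʳ t)) (trans (cong (t *_) (sym (c≡1 c e))) (sym e))
      k≡2μ : k ≡ 2 * μ
      k≡2μ = *-cancelʳ-≡ k (2 * μ) k {{>-nonZero k≥1}}
        (ℤP.+-injective (trans (ℤP.pos-* k k) (trans (parameter-identity x₀)
        (trans (cong₂ (λ l w → (l ℤ.- + μ) ℤ.* + k ℤ.+ (+ k ℤ.- + μ) ℤ.+ + μ ℤ.* w) ℓ≡ v≡′)
          (trans (collect (+ k) (+ μ)) (sym (trans (ℤP.pos-* (2 * μ) k) (cong (ℤ._* + k) (ℤP.pos-* 2 μ)))))))))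
        where
        ℓ≡ : + ℓ ≡ + μ ℤ.- 1ℤ
        ℓ≡ = trans (minus (+ ℓ)) (cong (ℤ._- 1ℤ) (trans (sym (ℤP.pos-+ 1 ℓ)) (cong +_ ℓ+1≡μ)))
          where
          minus : ∀ l → l ≡ 1ℤ ℤ.+ l ℤ.- 1ℤ
          minus = ℤSolver.solve-∀
        v≡′ : + v ≡ 1ℤ ℤ.+ (+ k ℤ.+ + k)
        v≡′ = trans v≡ (cong (λ t → 1ℤ ℤ.+ (+ t ℤ.+ + t)) t≡k)
        collect : ∀ k m → (m ℤ.- 1ℤ ℤ.- m) ℤ.* k ℤ.+ (k ℤ.- m) ℤ.+ m ℤ.* (1ℤ ℤ.+ (k ℤ.+ k)) ≡ + 2 ℤ.* m ℤ.* k
        collect = ℤSolver.solve-∀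

    3≤v : 3 ≤ v
    3≤v = ≤-trans (m≤m+n 3 _) large

    6≤v : 6 ≤ v
    6≤v = ≤-trans (m≤m+n 6 _) large

    module Pseudo (r s : ℕ) (τ≡ : τ ≡ + r ℤ.- + s) (κ≡ : κ ≡ + r ℤ.* + s) (s≥1 : 1 ≤ s) (μ<s : μ < s) where

      open Eigen r s τ≡ κ≡ s≥1 using (vertex-count)

      k≡ : k ≡ μ + r * s
      k≡ = ℤP.+-injective (trans (split (+ k) (+ μ)) (trans (cong (λ t → + μ ℤ.+ t) (trans κ≡ (sym (ℤP.pos-* r s))))
        (sym (ℤP.pos-+ μ (r * s)))))
        where
        split : ∀ k m → k ≡ m ℤ.+ (k ℤ.- m)
        split = ℤSolver.solve-∀

      ℓ≡ : ℓ + s ≡ μ + r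
      ℓ≡ = ℤP.+-injective (trans (ℤP.pos-+ ℓ s) (trans (shuffle (+ ℓ) (+ s) (+ μ))
        (trans (cong (λ t → t ℤ.+ + s ℤ.+ + μ) τ≡) (trans (collect (+ r) (+ s) (+ μ)) (sym (ℤP.pos-+ μ r))))))
        where
        shuffle : ∀ l s m → l ℤ.+ s ≡ (l ℤ.- m) ℤ.+ s ℤ.+ m
        shuffle = ℤSolver.solve-∀
        collect : ∀ r s m → r ℤ.- s ℤ.+ s ℤ.+ m ≡ m ℤ.+ r
        collect = ℤSolver.solve-∀

      r≥1 : 1 ≤ r
      r≥1 = n≢0⇒n>0 λ r≡0 → <⇒≱ μ<s (≤-trans (m≤n+m s ℓ)
        (≤-reflexive (trans ℓ≡ (trans (cong (_+_ μ) r≡0) (+-identityʳ μ)))))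

      r≤7s³ : r ≤ 7 * (s * s * s)
      r≤7s³ = largest-eigenvalue-bound (sym (m+[n∸m]≡n (<⇒≤ μ<s))) μ≥1 (m<n⇒0<n∸m μ<s) k≡ ℓ≡
        (ClawBound.claw-bound G srg x₀)

      s≤8r² : s ≤ 8 * (r * r)
      s≤8r² = ≤-trans (KreinCondition.s-bound G srg r s τ≡ κ≡ s≥1 x₀ (<⇒≤ μ<s) r≥1)
        (≤-trans (*-monoʳ-≤ 2 (*-mono-≤ r+1≤2r r+1≤2r)) (≤-reflexive (collect r)))
        where
        r+1≤2r : suc r ≤ 2 * r
        r+1≤2r = subst (suc r ≤_) (cong (_+_ r) (sym (+-identityʳ r))) (+-monoˡ-≤ r r≥1)
        collect : ∀ r → 2 * ((2 * r) * (2 * r)) ≡ 8 * (r * r)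
        collect = solve-∀

      R θ : ℕ
      R = r ⊓ s
      θ = r ⊔ s

      rs≡Rθ : r * s ≡ R * θ
      rs≡Rθ with ≤-total r s
      ... | inj₁ r≤s = sym (cong₂ _*_ (m≤n⇒m⊓n≡m r≤s) (m≤n⇒m⊔n≡n r≤s))
      ... | inj₂ s≤r = trans (*-comm r s) (sym (cong₂ _*_ (m≥n⇒m⊓n≡n s≤r) (m≥n⇒m⊔n≡m s≤r)))

      Rθ≤k : R * θ ≤ k
      Rθ≤k = ≤-trans (≤-reflexive (sym rs≡Rθ)) (≤-trans (m≤n+m (r * s) μ) (≤-reflexive (sym k≡)))

      θ≥1 : 1 ≤ θ
      θ≥1 = ≤-trans r≥1 (m≤m⊔n r s)

      k≤[r+1]s : k ≤ suc r * s
      k≤[r+1]s = ≤-trans (≤-reflexive k≡) (+-monoˡ-≤ (r * s) (<⇒≤ μ<s))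

      -- As μ < s, k is at most (r + 1)s. The larger of r and s is expressed through the smaller by
      -- s ≤ 8r² or r ≤ 7s³.
      k≤16R⁴ : k ≤ 16 * (R * R * R * R)
      k≤16R⁴ with ≤-total r s
      ... | inj₁ r≤s = subst (λ R → k ≤ 16 * (R * R * R * R)) (sym (m≤n⇒m⊓n≡m r≤s)) (begin
            k                         ≤⟨ k≤[r+1]s ⟩
            suc r * s                 ≤⟨ *-mono-≤ (+-monoˡ-≤ r r≥1) s≤8r² ⟩
            (r + r) * (8 * (r * r))   ≡⟨ collect r ⟩
            16 * (r * r * r * 1)      ≤⟨ *-monoʳ-≤ 16 (*-monoʳ-≤ (r * r * r) r≥1) ⟩
            16 * (r * r * r * r)      ∎)
        where
        open ≤-Reasoning
        collect : ∀ r → (r + r) * (8 * (r * r)) ≡ 16 * (r * r * r * 1)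
        collect = solve-∀
      ... | inj₂ s≤r = subst (λ R → k ≤ 16 * (R * R * R * R)) (sym (m≥n⇒m⊓n≡n s≤r)) (begin
            k                                 ≤⟨ k≤[r+1]s ⟩
            suc r * s                         ≤⟨ *-monoˡ-≤ s (+-mono-≤ (*-mono-≤ (*-mono-≤ s≥1 s≥1) s≥1) r≤7s³) ⟩
            (s * s * s + 7 * (s * s * s)) * s ≡⟨ collect s ⟩
            8 * (s * s * s * s)               ≤⟨ *-monoˡ-≤ (s * s * s * s) (m≤m+n 8 8) ⟩
            16 * (s * s * s * s)              ∎)
        where
        open ≤-Reasoning
        collect : ∀ s → (s * s * s + 7 * (s * s * s)) * s ≡ 8 * (s * s * s * s)
        collect = solve-∀

      -- From μv = (k - r)(k + s) with μ ≥ 1 and s ≤ k.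
      v≤2k² : v ≤ 2 * (k * k)
      v≤2k² = ℤP.drop‿+≤+ (subst (+ v ℤ.≤_) (sym (trans (ℤP.pos-* 2 (k * k)) (cong (λ t → + 2 ℤ.* t) (ℤP.pos-* k k))))
        (≤-from-difference (+-nonneg (*-nonneg (≤⇒0≤- (+≤+ μ≥1)) (0≤pos v))
          (+-nonneg (*-nonneg (0≤pos k) (≤⇒0≤- (+≤+ s≤k))) (*-nonneg (0≤pos r) (+-nonneg (0≤pos k) (0≤pos s)))))
          (trans (split (+ v) (+ μ) (+ k)) (trans (cong (λ t → (+ μ ℤ.- 1ℤ) ℤ.* + v ℤ.+ (+ 2 ℤ.* (+ k ℤ.* + k) ℤ.- t))
            (vertex-count x₀)) (factor (+ v) (+ μ) (+ k) (+ r) (+ s))))))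
        where
        s≤k : s ≤ k
        s≤k = ≤-trans (≤-trans (≤-reflexive (sym (*-identityˡ s))) (*-monoˡ-≤ s r≥1)) (≤-trans (m≤n+m (r * s) μ)
          (≤-reflexive (sym k≡)))
        split : ∀ v m k → + 2 ℤ.* (k ℤ.* k) ℤ.- v ≡ (m ℤ.- 1ℤ) ℤ.* v ℤ.+ (+ 2 ℤ.* (k ℤ.* k) ℤ.- m ℤ.* v)
        split = ℤSolver.solve-∀
        factor : ∀ v m k r s → (m ℤ.- 1ℤ) ℤ.* v ℤ.+ (+ 2 ℤ.* (k ℤ.* k) ℤ.- (k ℤ.- r) ℤ.* (k ℤ.+ s)) ≡ (m ℤ.- 1ℤ) ℤ.* v
          ℤ.+ (k ℤ.* (k ℤ.- s) ℤ.+ r ℤ.* (k ℤ.+ s))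
        factor = ℤSolver.solve-∀

      v≤512R⁸ : v ≤ 512 * R ^ 8
      v≤512R⁸ = ≤-trans v≤2k² (≤-trans (*-monoʳ-≤ 2 (*-mono-≤ k≤16R⁴ k≤16R⁴)) (≤-reflexive (collect R)))
        where
        collect : ∀ R → 2 * ((16 * (R * R * R * R)) * (16 * (R * R * R * R))) ≡ 512 *
          (R * (R * (R * (R * (R * (R * (R * (R * 1))))))))
        collect = solve-∀

      R≥4096 : 4096 ≤ R
      R≥4096 = ≮⇒≥ λ R<4096 → <⇒≱ large (≤-trans v≤512R⁸ (*-monoʳ-≤ 512 (^-monoˡ-≤ 8 (<⇒≤ R<4096))))

      v≤R⁹ : v ≤ R ^ 9
      v≤R⁹ = ≤-trans v≤512R⁸ (*-monoˡ-≤ (R ^ 8) (≤-trans (m≤m+n 512 3584) R≥4096))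

      b : ℕ
      b = v / 1000

      1000b≤v : 1000 * b ≤ v
      1000b≤v = subst (_≤ v) (*-comm b 1000) (subst (b * 1000 ≤_) (sym (m≡m%n+[m/n]*n v 1000))
        (m≤n+m (b * 1000) (v % 1000)))

      v<1000+1000b : v < 1000 + 1000 * b
      v<1000+1000b = subst₂ _<_ (sym (m≡m%n+[m/n]*n v 1000)) (cong (_+_ 1000) (*-comm b 1000))
        (+-monoˡ-< (b * 1000) (m%n<n v 1000))

      b≥1 : 1 ≤ b
      b≥1 = n≢0⇒n>0 λ b≡0 → <⇒≱ (subst (λ b → v < 1000 + 1000 * b) b≡0 v<1000+1000b) (≤-trans (m≤m+n 1000 _) large)

      v<Rb : v < R * b
      v<Rb = <-≤-trans v<1000+1000b (≤-trans (+-monoˡ-≤ (1000 * b) (*-monoʳ-≤ 1000 b≥1))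
        (≤-trans (≤-reflexive (sym (*-distribʳ-+ b 1000 1000)))
        (*-monoˡ-≤ b (≤-trans (m≤m+n 2000 2096) R≥4096))))

      -- The expander mixing lemma, with k/θ ≥ R.
      mixing : ∀ S x → S x ≡ true → let N = neighbourhood G S in R * R * count S * count (∁ N) ≤ count N * v
      mixing S x x∈S = *-cancelˡ-≤ (θ * θ) {{>-nonZero (*-mono-≤ θ≥1 θ≥1)}} (begin
          θ * θ * (R * R * a * Y)      ≡⟨ regroup θ R a Y ⟩
          (R * θ) * (R * θ) * a * Y    ≤⟨ *-monoˡ-≤ Y (*-monoˡ-≤ a (*-mono-≤ Rθ≤k Rθ≤k)) ⟩
          k * k * a * Y                ≤⟨ +-cancelˡ-≤ (n * (k * k * a)) _ _ (begin
              n * (k * k * a) + k * k * a * Y        ≡⟨ factor n (k * k * a) Y ⟩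
              k * k * a * (n + Y)                    ≡⟨ cong (k * k * a *_) (count-∁ N) ⟩
              k * k * a * v                          ≤⟨ ExpanderMixing.expansion G srg r s τ≡ κ≡ s≥1 (m≤m⊔n r s)
                (m≤n⊔m r s) S x x∈S ⟩
              n * (θ * θ * v + k * k * a)            ≡⟨ expand n (θ * θ) v (k * k * a) ⟩
              n * (k * k * a) + θ * θ * (n * v)      ∎) ⟩
          θ * θ * (n * v)              ∎)
        where
        open ≤-Reasoning
        N : Subset v
        N = neighbourhood G S
        n a Y : ℕ
        n = count N
        a = count S
        Y = count (∁ N)
        regroup : ∀ t R a Y → t * t * (R * R * a * Y) ≡ (R * t) * (R * t) * a * Y
        regroup = solve-∀
        factor : ∀ n q Y → n * q + q * Y ≡ q * (n + Y)
        factor = solve-∀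
        expand : ∀ n t v q → n * (t * v + q) ≡ n * q + t * (n * v)
        expand = solve-∀

      -- If the complement of N(S) is the larger part, it has at least v/2 elements, and cancelling
      -- it from `mixing` leaves R²|S| ≤ 2|N(S)|; one factor R ≥ 8 pays for the constants.
      grow : ∀ S x → S x ≡ true → 4 * (R * count S) ≤ count (neighbourhood G S) ⊎ v ≤ 2 * count (neighbourhood G S)
      grow S x x∈S with ≤-total (count (∁ (neighbourhood G S))) (count (neighbourhood G S))
      ... | inj₁ Y≤n = inj₂ (≤-trans (≤-reflexive (sym (count-∁ N))) (≤-trans (+-monoʳ-≤ (count N) Y≤n)
        (≤-reflexive (cong (_+_ (count N)) (sym (+-identityʳ (count N)))))))
        where
        N : Subset v
        N = neighbourhood G S
      ... | inj₂ n≤Y = inj₁ (*-cancelˡ-≤ 2 (begin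
            2 * (4 * (R * a))  ≡⟨ regroup R a ⟩
            8 * (R * a)        ≤⟨ *-monoˡ-≤ (R * a) (≤-trans (m≤m+n 8 4088) R≥4096) ⟩
            R * (R * a)        ≡⟨ *-assoc R R a ⟨
            R * R * a          ≤⟨ *-cancelʳ-≤ (R * R * a) (2 * n) Y {{>-nonZero Y≥1}} (begin
                R * R * a * Y      ≤⟨ mixing S x x∈S ⟩
                n * v              ≡⟨ cong (n *_) (count-∁ N) ⟨
                n * (n + Y)        ≤⟨ *-monoʳ-≤ n (+-monoˡ-≤ Y n≤Y) ⟩
                n * (Y + Y)        ≡⟨ double n Y ⟩
                2 * n * Y          ∎) ⟩
            2 * n              ∎))
        where
        open ≤-Reasoning
        N : Subset v
        N = neighbourhood G S
        n a Y : ℕ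
        n = count N
        a = count S
        Y = count (∁ N)
        regroup : ∀ R a → 2 * (4 * (R * a)) ≡ 8 * (R * a)
        regroup = solve-∀
        double : ∀ n Y → n * (Y + Y) ≡ 2 * n * Y
        double = solve-∀
        Y≥1 : 1 ≤ Y
        Y≥1 = n≢0⇒n>0 λ Y≡0 → <⇒≱ (≤-trans (s≤s z≤n) 3≤v) (≤-trans (≤-reflexive (sym (count-∁ N)))
          (+-mono-≤ (≤-trans n≤Y (≤-reflexive Y≡0)) (≤-reflexive Y≡0)))

      -- Were b vertices missed by N(S), `mixing` would give (Rb)² ≤ v², although v < Rb.
      joined : ∀ S → b ≤ count S → v < count (neighbourhood G S) + b
      joined S b≤a = subst (_< count N + b) (count-∁ N) (+-monoʳ-< (count N) (≰⇒> λ b≤Y → <⇒≱ (*-mono-< v<Rb v<Rb)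
        (begin
          R * b * (R * b)              ≡⟨ regroup R b ⟩
          R * R * b * b                ≤⟨ *-mono-≤ (*-monoʳ-≤ (R * R) b≤a) b≤Y ⟩
          R * R * count S * count (∁ N) ≤⟨ mixing S (proj₁ member) (proj₂ member) ⟩
          count N * v                  ≤⟨ *-monoˡ-≤ v (≤-trans (m≤m+n (count N) (count (∁ N)))
            (≤-reflexive (count-∁ N))) ⟩
          v * v                        ∎)))
        where
        open ≤-Reasoning
        N : Subset v
        N = neighbourhood G S
        member : ∃ λ x → S x ≡ true
        member = count-witness S (≤-trans b≥1 b≤a)
        regroup : ∀ R b → R * b * (R * b) ≡ R * R * b * b
        regroup = solve-∀

      pseudorandom : ¬ HamiltonianCycle G → ⊥
      pseudorandom = Pseudorandom.hamiltonian G b R b≥1 1000b≤v v≤R⁹ joined grow 3≤v conn x₀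

    -- Whether X² = τX + κ has an integer root is settled by excluded middle, allowed here since the
    -- goal is ⊥. No root means conference parameters; a root gives r and s, and the comparison of s
    -- with μ selects the method.
    not-nonhamiltonian : ¬ HamiltonianCycle G → ⊥
    not-nonhamiltonian ¬ham = excluded-middle by-root
      where
      with-separator : (Separation.Separator G → ⊥) → ⊥
      with-separator = Separation.nonhamiltonian⇒separator G 3≤v ¬ham (proj₂ (proj₂ notEmpty))
      by-root : Dec (∃ λ t → t ℤ.* t ≡ τ ℤ.* t ℤ.+ κ) → ⊥
      by-root (no irrational) =
        let t , k≡ , v≡ = irrational⇒conference λ t e → irrational (t , e)
            v≡′ , k≡′ , ℓ≡ = conference-parameters t k≡ v≡
        in with-separator (no-conference-separator 6≤v v≡′ k≡′ ℓ≡)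
      by-root (yes (t , e)) with integer-root⇒eigenvalues t e
      ... | r , s , τ≡ , κ≡ , s≥1 with s ≤? μ
      ... | yes s≤μ = with-separator (Eigen.no-separator r s τ≡ κ≡ s≥1 s≤μ)
      ... | no s≰μ = Pseudo.pseudorandom r s τ≡ κ≡ s≥1 (≰⇒> s≰μ) ¬ham

  large⇒hamiltonian : ∀ (v : ℕ) → v > threshold → (G : Graph v) → StronglyRegular G → Connected G → HamiltonianCycle G
  large⇒hamiltonian v large G (_ , _ , _ , srg) conn with GraphPaths.hamiltonian? G
  ... | yes h = h
  ... | no ¬h = ⊥-elim (not-nonhamiltonian G srg conn large ¬h)

theorem0p1 : Σ ℕ λ N → ∀ (v : ℕ) → v > N → (G : Graph v) →
    StronglyRegular G → Connected G → HamiltonianCycle G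
theorem0p1 = LargeGraphs.threshold , LargeGraphs.large⇒hamiltonian
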